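{- Let $n\ge5$ be odd and let $\mathcal{C}_n$ be the set of all $n$-cycles in $\mathrm{Sym}(n)$. Let $S\subseteq\mathrm{Alt}(n)$ be such that there are no $\pi,\sigma\in S$ with $\pi\sigma^{ -1}\in\mathcal{C}_n$. Then $|S|\le\frac{(n-1)!}{2}$, and equality holds if and only if $S$ is a coset of a point-stabilizer in $\mathrm{Alt}(n)$, i.e. $S=\{\pi\in\mathrm{Alt}(n):\pi(i)=j\}$ for some $i,j\in[n]$.
   Context: $\mathrm{Alt}(n)$ acts naturally on $[n]=\{1,\dots,n\}$. -}

module Defs where

open import Data.Nat using (ℕ; zero; suc; _<_; _%_)
open import Data.Nat.Properties using (_<?_)
open import Data.Fin using (Fin; zero; suc; toℕ; fromℕ<)
open import Data.Fin.Permutation using (Permutation′; _⟨$⟩ʳ_; _∘ₚ_; flip; _≈_)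
open import Data.List using (List; length; filter; allFin; cartesianProduct)
open import Data.List.Relation.Unary.Any using (Any)
open import Data.Product using (_×_; _,_; Σ; ∃; ∃₂)
open import Relation.Binary.PropositionalEquality using (_≡_)
open import Relation.Nullary using (yes; no)
open import Relation.Nullary.Decidable using (_×-dec_)

csucc : ∀ {m} → Fin (suc m) → Fin (suc m)
csucc {m} i with suc (toℕ i) <? suc m
... | yes p = fromℕ< p
... | no _  = zero

inversions : ∀ {n} → Permutation′ n → ℕ
inversions {n} π =
  length (filter (λ (ij : Fin n × Fin n) →
                    let (i , j) = ij in
                    (toℕ i <? toℕ j) ×-dec (toℕ (π ⟨$⟩ʳ j) <? toℕ (π ⟨$⟩ʳ i)))
                 (cartesianProduct (allFin n) (allFin n)))

IsEven : ∀ {n} → Permutation′ n → Set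
IsEven π = inversions π % 2 ≡ 0

-- τ ∈ 𝒞_n: τ is an n-cycle (a₀ a₁ … a_{n-1}), i.e. there is an
-- enumeration a of [n] (a bijection) with τ(a_k) = a_{k+1 mod n}
IsNCycle : ∀ {n} → Permutation′ n → Set
IsNCycle {zero} τ = Data.Empty.⊥ where import Data.Empty
IsNCycle {suc m} τ = Σ (Permutation′ (suc m)) λ a →
  ∀ k → τ ⟨$⟩ʳ (a ⟨$⟩ʳ k) ≡ a ⟨$⟩ʳ csucc k

-- π σ⁻¹ (composition read right to left: x ↦ π(σ⁻¹(x)))
_·_⁻¹ : ∀ {n} → Permutation′ n → Permutation′ n → Permutation′ n
π · σ ⁻¹ = flip σ ∘ₚ π

_∈ₚ_ : ∀ {n} → Permutation′ n → List (Permutation′ n) → Set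
π ∈ₚ S = Any (λ σ → σ ≈ π) S

{-# OPTIONS --safe #-}

-- Let f be the indicator function of S.  The sum A over all n-cycles is the product of the
-- Jucys–Murphy operators, hence ⟨f , A f⟩ = 0.  On functions of degree one (sums of functions
-- of a single value π(j)) A is explicit: −(n−2)! on those of sum 0 and (n−1)! on constants.
-- On even functions orthogonal to the functions of degree one its norm is < (n−2)!: the factors
-- are bounded one by one, by induction on n, using the spectral gap of the star transpositions
-- and the fact that on {π : π(0) = k} A f is A for n − 1 applied to J f.  Hoffman's argument then
-- gives 2|S| ≤ (n−1)!, and in the case of equality f has degree one.
-- Such an f on Alt(n) is determined by the counts M j k of π ∈ S with π(j) = k; comparing even
-- permutations which differ in three places shows that the difference of two rows of M takes at
-- most two values, at distance n(n−2)!/2, and counting how often forces some M j k = |S|.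

module Submission where

open import Defs
open import Data.Bool using (Bool; true; false; _∧_)
open import Data.Nat as ℕ using (ℕ; zero; suc; _!; _%_; _/_; _<ᵇ_)
import Data.Nat.Properties as ℕₚ
open import Data.Nat.DivMod using (/-monoˡ-≤; m*n/n≡m; m/n*n≡m)
open import Data.Nat.Divisibility using (_∣_; m≤n⇒m!∣n!)
open import Data.Fin using (Fin; zero; suc; toℕ; fromℕ; inject₁; punchIn; punchOut; pinch; _≟_)
open import Data.Fin.Properties using (punchInᵢ≢i; punchIn-injective; punchIn-punchOut; any?; toℕ-injective; toℕ-fromℕ; toℕ-fromℕ<; toℕ-inject₁; toℕ<n)
open import Data.Fin.Induction using (<-weakInduction)
open import Data.Fin.Permutation using (Permutation′; permutation; _⟨$⟩ʳ_; _⟨$⟩ˡ_; _∘ₚ_; _≈_; remove; insert; insert-punchIn; punchIn-permute; transpose; lift₀; inverseˡ; inverseʳ) renaming (id to idₚ)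
open import Data.Fin.Relation.Unary.Top using (‵fromℕ; ‵inject₁) renaming (view to topView)
open import Data.Integer using (ℤ; +_; -[1+_]; 0ℤ; 1ℤ; _+_; _*_; -_; _-_; _≤_; _<_; +≤+; +<+; positive; >-nonZero) renaming (_≟_ to _≟ᶻ_)
open import Data.Integer.Properties hiding (_≟_)
open import Data.Integer.Tactic.RingSolver using (solve-∀)
open import Data.List using (List; []; _∷_; length; filter; map; _++_; tabulate; allFin; cartesianProduct)
open import Data.List.Membership.Propositional using (_∈_; find; lose)
open import Data.List.Relation.Unary.All using (All; []; _∷_)
open import Data.List.Relation.Unary.All.Properties using (All¬⇒¬Any)
open import Data.List.Relation.Unary.AllPairs using (AllPairs; []; _∷_)
open import Data.List.Relation.Unary.Any as Any using (Any; here; there)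
open import Data.Product using (_×_; _,_; ∃; ∃₂; proj₁; proj₂)
open import Data.Sum using (_⊎_; inj₁; inj₂; [_,_]′)
open import Function using (_∘_)
open import Function.Bundles using (_⇔_; mk⇔; Equivalence)
open import Relation.Binary.PropositionalEquality hiding (J)
open import Relation.Nullary using (¬_; Dec; does; yes; no; contradiction)
open import Relation.Nullary.Decidable using (¬?; decidable-stable; dec-true; dec-false)
open import Relation.Unary using (Pred; Decidable)

-- The gap of `J` bounds its eigenvalues from above only, and on all of Sym(n) there is no matching
-- lower bound: the sign function has eigenvalue -(n - 1). A norm bound exists because `J` exchanges
-- even and odd functions, so f ⟂ J f for f on one parity. Hence the parity is carried through all
-- estimates. Passing to tails does not preserve orthogonality to degree one: of the tails of J f
-- only the vanishing of their sums survives. The induction therefore proves the weaker bound (n -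
-- 2)! for all functions of sum 0 on one parity, where it is attained. Strictness comes from the
-- first factor alone: on functions without marginals the bound n - 2 for `J` on n points improves
-- to n - 2 - 1/(n - 2). Everything takes values in ℤ. Projections are multiplied by their
-- denominators, and norms are compared through their squares.

+-congˡ : ∀ x {y z} → y ≡ z → x + y ≡ x + z
+-congˡ x = cong (λ t → x + t)

-- Finite sums of integers, over positions and over permutations

opaque
  ∑ : ∀ {n} → (Fin n → ℤ) → ℤ
  ∑ {zero}  f = 0ℤ
  ∑ {suc n} f = f zero + ∑ (λ i → f (suc i))

  ∑-zero : (f : Fin 0 → ℤ) → ∑ f ≡ 0ℤ
  ∑-zero f = refl

  ∑-suc : ∀ {n} (f : Fin (suc n) → ℤ) → ∑ f ≡ f zero + ∑ (λ i → f (suc i))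
  ∑-suc f = refl

lin-step : ∀ a b x y X Y → (a * x + b * y) + (a * X + b * Y) ≡ a * (x + X) + b * (y + Y)
lin-step = solve-∀

opaque
  unfolding ∑

  ∑-cong : ∀ {n} {f g : Fin n → ℤ} → (∀ i → f i ≡ g i) → ∑ f ≡ ∑ g
  ∑-cong {zero}  e = refl
  ∑-cong {suc n} e = cong₂ _+_ (e zero) (∑-cong (λ i → e (suc i)))

  ∑-lin : ∀ {n} a b (f g : Fin n → ℤ) → ∑ (λ i → a * f i + b * g i) ≡ a * ∑ f + b * ∑ g
  ∑-lin {zero}  a b f g = zero-lin a b
    where
    zero-lin : ∀ a b → 0ℤ ≡ a * 0ℤ + b * 0ℤ
    zero-lin = solve-∀
  ∑-lin {suc n} a b f g =
    trans (+-congˡ (a * f zero + b * g zero) (∑-lin {n} a b (λ i → f (suc i)) (λ i → g (suc i))))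
          (lin-step a b (f zero) (g zero) (∑ λ i → f (suc i)) (∑ λ i → g (suc i)))

  ∑-0≤ : ∀ {n} {f : Fin n → ℤ} → (∀ i → 0ℤ ≤ f i) → 0ℤ ≤ ∑ f
  ∑-0≤ {zero}  p = ≤-refl
  ∑-0≤ {suc n} p = +-mono-≤ (p zero) (∑-0≤ λ i → p (suc i))

-- Lehmer codes of permutations

data Code : ℕ → Set where
  []  : Code 0
  _∷_ : ∀ {n} → Fin (suc n) → Code n → Code (suc n)

infixr 5 _∷_

⟦_⟧ : ∀ {n} → Code n → Fin n → Fin n
⟦ k ∷ u ⟧ zero    = k
⟦ k ∷ u ⟧ (suc i) = punchIn k (⟦ u ⟧ i)

⟦⟧-ext : ∀ {n} (v w : Code n) → (∀ x → ⟦ v ⟧ x ≡ ⟦ w ⟧ x) → v ≡ w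
⟦⟧-ext []      []       e = refl
⟦⟧-ext (k ∷ v) (l ∷ w) e with e zero
... | refl = cong (k ∷_) (⟦⟧-ext v w (λ x → punchIn-injective k _ _ (e (suc x))))

opaque
  ∑ₚ : ∀ {n} → (Code n → ℤ) → ℤ
  ∑ₚ {zero}  f = f []
  ∑ₚ {suc n} f = ∑ λ k → ∑ₚ λ u → f (k ∷ u)

  ∑ₚ-[] : (f : Code 0 → ℤ) → ∑ₚ f ≡ f []
  ∑ₚ-[] f = refl

  ∑ₚ-∷ : ∀ {n} (f : Code (suc n) → ℤ) → ∑ₚ f ≡ ∑ λ k → ∑ₚ λ u → f (k ∷ u)
  ∑ₚ-∷ f = refl

  ∑ₚ-cong : ∀ {n} {f g : Code n → ℤ} → (∀ w → f w ≡ g w) → ∑ₚ f ≡ ∑ₚ g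
  ∑ₚ-cong {zero}  e = e []
  ∑ₚ-cong {suc n} e = ∑-cong λ k → ∑ₚ-cong λ u → e (k ∷ u)

  ∑ₚ-lin : ∀ {n} a b (f g : Code n → ℤ) → ∑ₚ (λ w → a * f w + b * g w) ≡ a * ∑ₚ f + b * ∑ₚ g
  ∑ₚ-lin {zero}  a b f g = refl
  ∑ₚ-lin {suc n} a b f g =
    trans (∑-cong λ k → ∑ₚ-lin a b (λ u → f (k ∷ u)) (λ u → g (k ∷ u)))
          (∑-lin a b (λ k → ∑ₚ λ u → f (k ∷ u)) (λ k → ∑ₚ λ u → g (k ∷ u)))

  ∑ₚ-0≤ : ∀ {n} {f : Code n → ℤ} → (∀ i → 0ℤ ≤ f i) → 0ℤ ≤ ∑ₚ f
  ∑ₚ-0≤ {zero}  p = p []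
  ∑ₚ-0≤ {suc n} p = ∑-0≤ λ k → ∑ₚ-0≤ λ u → p (k ∷ u)

record Summation (I : Set) : Set where
  field
    sum      : (I → ℤ) → ℤ
    sum-cong : ∀ {f g} → (∀ i → f i ≡ g i) → sum f ≡ sum g
    sum-lin  : ∀ a b f g → sum (λ i → a * f i + b * g i) ≡ a * sum f + b * sum g

  sum-0 : ∀ {f} → (∀ i → f i ≡ 0ℤ) → sum f ≡ 0ℤ
  sum-0 {f} e = trans (sum-cong λ i → trans (e i) (sym (z (f i) (f i)))) (trans (sum-lin 0ℤ 0ℤ f f) (z (sum f) (sum f)))
    where
    z : ∀ x y → 0ℤ * x + 0ℤ * y ≡ 0ℤ
    z = solve-∀

  sum-* : ∀ a f → sum (λ i → a * f i) ≡ a * sum f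
  sum-* a f = trans (sum-cong λ i → sym (z a (f i))) (trans (sum-lin a 0ℤ f f) (z a (sum f)))
    where
    z : ∀ a x → a * x + 0ℤ * x ≡ a * x
    z = solve-∀

  sum-*ʳ : ∀ a f → sum (λ i → f i * a) ≡ sum f * a
  sum-*ʳ a f = trans (sum-cong λ i → *-comm (f i) a) (trans (sum-* a f) (*-comm a (sum f)))

  sum-neg : ∀ f → sum (λ i → - f i) ≡ - sum f
  sum-neg f = trans (sum-cong λ i → sym (-1*i≡-i (f i))) (trans (sum-* (- 1ℤ) f) (-1*i≡-i (sum f)))

  sum-+ : ∀ f g → sum (λ i → f i + g i) ≡ sum f + sum g
  sum-+ f g = trans (sum-cong λ i → z (f i) (g i)) (trans (sum-lin 1ℤ 1ℤ f g) (sym (z (sum f) (sum g))))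
    where
    z : ∀ x y → x + y ≡ 1ℤ * x + 1ℤ * y
    z = solve-∀

  sum-- : ∀ f g → sum (λ i → f i - g i) ≡ sum f - sum g
  sum-- f g = trans (sum-+ f (λ i → - g i)) (+-congˡ (sum f) (sum-neg g))

finS : ∀ n → Summation (Fin n)
finS n = record { sum = ∑ ; sum-cong = ∑-cong ; sum-lin = ∑-lin }

codeS : ∀ n → Summation (Code n)
codeS n = record { sum = ∑ₚ ; sum-cong = ∑ₚ-cong ; sum-lin = ∑ₚ-lin }

module _ {n : ℕ} where
  open Summation (finS n) public
    using () renaming (sum-0 to ∑-0; sum-* to ∑-*; sum-*ʳ to ∑-*ʳ; sum-neg to ∑-neg; sum-+ to ∑-+; sum-- to ∑--)
  open Summation (codeS n) public
    using () renaming (sum-0 to ∑ₚ-0; sum-* to ∑ₚ-*; sum-*ʳ to ∑ₚ-*ʳ; sum-neg to ∑ₚ-neg; sum-+ to ∑ₚ-+; sum-- to ∑ₚ--)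

opaque
  fac : ℕ → ℤ
  fac n = + (n !)

  fac-! : ∀ n → fac n ≡ + (n !)
  fac-! n = refl

  fac-zero : fac 0 ≡ 1ℤ
  fac-zero = refl

  fac-suc : ∀ n → fac (suc n) ≡ + suc n * fac n
  fac-suc n = pos-* (suc n) (n !)

  0<fac : ∀ n → 0ℤ < fac n
  0<fac n = +<+ (ℕₚ.1≤n! n)

∑-const : ∀ n a → ∑ {n} (λ _ → a) ≡ + n * a
∑-const zero    a = trans (∑-zero _) (sym (*-zeroˡ a))
∑-const (suc n) a = trans (∑-suc _) (trans (+-congˡ a (∑-const n a)) (sym (suc-* (+ n) a)))

∑ₚ-const : ∀ n a → ∑ₚ {n} (λ _ → a) ≡ fac n * a
∑ₚ-const zero    a = trans (∑ₚ-[] _) (sym (trans (cong (_* a) fac-zero) (*-identityˡ a)))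
∑ₚ-const (suc n) a = begin
  ∑ₚ {suc n} (λ _ → a)                ≡⟨ ∑ₚ-∷ _ ⟩
  ∑ {suc n} (λ _ → ∑ₚ {n} (λ _ → a))  ≡⟨ ∑-cong {suc n} (λ _ → ∑ₚ-const n a) ⟩
  ∑ {suc n} (λ _ → fac n * a)       ≡⟨ ∑-const (suc n) (fac n * a) ⟩
  + suc n * (fac n * a)             ≡⟨ *-assoc (+ suc n) (fac n) a ⟨
  + suc n * fac n * a               ≡⟨ cong (_* a) (fac-suc n) ⟨
  fac (suc n) * a               ∎
  where open ≡-Reasoning

module _ {I : Set} (S : Summation I) where
  open Summation S

  sum-∑-comm : ∀ {n} (h : I → Fin n → ℤ) → sum (λ i → ∑ (h i)) ≡ ∑ (λ j → sum (λ i → h i j))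
  sum-∑-comm {zero}  h = trans (sum-0 λ i → ∑-zero (h i)) (sym (∑-zero _))
  sum-∑-comm {suc n} h = begin
    sum (λ i → ∑ (h i))                                             ≡⟨ sum-cong (λ i → ∑-suc (h i)) ⟩
    sum (λ i → h i zero + ∑ (λ j → h i (suc j)))                    ≡⟨ sum-+ _ _ ⟩
    sum (λ i → h i zero) + sum (λ i → ∑ (λ j → h i (suc j)))        ≡⟨ +-congˡ (sum λ i → h i zero) (sum-∑-comm (λ i j → h i (suc j))) ⟩
    sum (λ i → h i zero) + ∑ (λ j → sum (λ i → h i (suc j)))        ≡⟨ ∑-suc _ ⟨
    ∑ (λ j → sum (λ i → h i j))                                     ∎
    where open ≡-Reasoning

∑ₚ-∑-comm : ∀ {m n} (h : Code m → Fin n → ℤ) → ∑ₚ (λ i → ∑ (h i)) ≡ ∑ (λ j → ∑ₚ (λ i → h i j))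
∑ₚ-∑-comm {m} = sum-∑-comm (codeS m)

∑-∑-comm : ∀ {m n} (h : Fin m → Fin n → ℤ) → ∑ (λ i → ∑ (h i)) ≡ ∑ (λ j → ∑ (λ i → h i j))
∑-∑-comm {m} = sum-∑-comm (finS m)

opaque
  unfolding ∑

  ∑-punchIn : ∀ {n} (i : Fin (suc n)) f → ∑ f ≡ f i + ∑ (λ j → f (punchIn i j))
  ∑-punchIn zero f = refl
  ∑-punchIn {suc n} (suc i) f =
    trans (+-congˡ (f zero) (∑-punchIn i (λ j → f (suc j)))) (r (f zero) (f (suc i)) (∑ λ j → f (suc (punchIn i j))))
    where
    r : ∀ a b c → a + (b + c) ≡ b + (a + c)
    r = solve-∀

∑-update : ∀ {n} (i : Fin n) f g → (∀ j → j ≢ i → f j ≡ g j) → ∑ f ≡ ∑ g - g i + f i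
∑-update {suc n} i f g e = begin
  ∑ f                                                ≡⟨ ∑-punchIn i f ⟩
  f i + ∑ (λ j → f (punchIn i j))                    ≡⟨ +-congˡ (f i) (∑-cong λ j → e _ (punchInᵢ≢i i j)) ⟩
  f i + ∑ (λ j → g (punchIn i j))                    ≡⟨ r (f i) (g i) _ ⟩
  (g i + ∑ (λ j → g (punchIn i j))) - g i + f i      ≡⟨ cong (λ t → t - g i + f i) (∑-punchIn i g) ⟨
  ∑ g - g i + f i                                    ∎
  where
  open ≡-Reasoning
  r : ∀ a b c → a + c ≡ (b + c) - b + a
  r = solve-∀

δ : ∀ {n} → Fin n → Fin n → ℤ
δ zero    zero    = 1ℤ
δ zero    (suc j) = 0ℤ
δ (suc i) zero    = 0ℤ
δ (suc i) (suc j) = δ i j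

opaque
  unfolding ∑

  ∑-δ : ∀ {n} (i : Fin n) (f : Fin n → ℤ) → ∑ (λ j → δ i j * f j) ≡ f i
  ∑-δ zero    f = trans (cong₂ _+_ (*-identityˡ (f zero)) (∑-0 λ j → *-zeroˡ (f (suc j)))) (+-identityʳ (f zero))
  ∑-δ (suc i) f = trans (cong₂ _+_ (*-zeroˡ (f zero)) (∑-δ i (λ j → f (suc j)))) (+-identityˡ (f (suc i)))

∑-⟦⟧ : ∀ {n} (w : Code n) f → ∑ (λ j → f (⟦ w ⟧ j)) ≡ ∑ f
∑-⟦⟧ []      f = ∑-cong λ ()
∑-⟦⟧ (k ∷ u) f = begin
  ∑ (λ j → f (⟦ k ∷ u ⟧ j))                  ≡⟨ ∑-suc _ ⟩
  f k + ∑ (λ j → f (punchIn k (⟦ u ⟧ j)))    ≡⟨ +-congˡ (f k) (∑-⟦⟧ u (λ l → f (punchIn k l))) ⟩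
  f k + ∑ (λ l → f (punchIn k l))            ≡⟨ ∑-punchIn k f ⟨
  ∑ f                                        ∎
  where open ≡-Reasoning

0≤² : ∀ x → 0ℤ ≤ x * x
0≤² (+ n)      = subst (0ℤ ≤_) (pos-* n n) (+≤+ ℕ.z≤n)
0≤² -[1+ n ]   = +≤+ ℕ.z≤n

0≤-+ : ∀ {x y} → 0ℤ ≤ x → 0ℤ ≤ y → 0ℤ ≤ x + y
0≤-+ = +-mono-≤

0≤-* : ∀ {x y} → 0ℤ ≤ x → 0ℤ ≤ y → 0ℤ ≤ x * y
0≤-* {+ m} {+ n} (+≤+ _) (+≤+ _) = subst (0ℤ ≤_) (pos-* m n) (+≤+ ℕ.z≤n)

0≤-cancel : ∀ {c x} → 0ℤ < c → 0ℤ ≤ c * x → 0ℤ ≤ x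
0≤-cancel {c} {x} 0<c p = *-cancelˡ-≤-pos 0ℤ x c {{positive 0<c}} (subst (_≤ c * x) (sym (*-zeroʳ c)) p)

0≤+ : ∀ n → 0ℤ ≤ + n
0≤+ n = +≤+ ℕ.z≤n

01⇒0≤ : ∀ {x} → x ≡ 0ℤ ⊎ x ≡ 1ℤ → 0ℤ ≤ x
01⇒0≤ (inj₁ refl) = 0≤+ 0
01⇒0≤ (inj₂ refl) = 0≤+ 1

01⇒≤1 : ∀ {x} → x ≡ 0ℤ ⊎ x ≡ 1ℤ → 0ℤ ≤ 1ℤ - x
01⇒≤1 (inj₁ refl) = 0≤+ 1
01⇒≤1 (inj₂ refl) = 0≤+ 0

+-zero⁻¹ : ∀ {x y} → 0ℤ ≤ x → 0ℤ ≤ y → x + y ≡ 0ℤ → x ≡ 0ℤ × y ≡ 0ℤ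
+-zero⁻¹ {+ zero} {+ zero} _ _ _ = refl , refl

opaque
  unfolding ∑ ∑ₚ

  ∑-0⁻¹ : ∀ {n} {f : Fin n → ℤ} → (∀ i → 0ℤ ≤ f i) → ∑ f ≡ 0ℤ → ∀ i → f i ≡ 0ℤ
  ∑-0⁻¹ p e zero    = proj₁ (+-zero⁻¹ (p zero) (∑-0≤ λ i → p (suc i)) e)
  ∑-0⁻¹ p e (suc i) = ∑-0⁻¹ (λ i → p (suc i)) (proj₂ (+-zero⁻¹ (p zero) (∑-0≤ λ i → p (suc i)) e)) i

  ∑ₚ-0⁻¹ : ∀ {n} {f : Code n → ℤ} → (∀ w → 0ℤ ≤ f w) → ∑ₚ f ≡ 0ℤ → ∀ w → f w ≡ 0ℤ
  ∑ₚ-0⁻¹ p e []      = e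
  ∑ₚ-0⁻¹ p e (k ∷ u) = ∑ₚ-0⁻¹ (λ u → p (k ∷ u)) (∑-0⁻¹ (λ k → ∑ₚ-0≤ λ u → p (k ∷ u)) e k) u

-- The code of w ∘ (0 1) is obtained from that of w by replacing the first two digits
-- k , l with punchIn k l , pinch l k.

punchIn-pinch : ∀ {n} (k : Fin (suc (suc n))) l → punchIn (punchIn k l) (pinch l k) ≡ k
punchIn-pinch zero    l       = refl
punchIn-pinch (suc k) zero    = refl
punchIn-pinch {suc n} (suc k) (suc l) = cong suc (punchIn-pinch k l)

pinch-punchIn : ∀ {n} (k : Fin (suc (suc n))) l → pinch (pinch l k) (punchIn k l) ≡ l
pinch-punchIn zero    l       = refl
pinch-punchIn (suc k) zero    = refl
pinch-punchIn {suc n} (suc k) (suc l) = cong suc (pinch-punchIn k l)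

punchIn-comm : ∀ {n} (k : Fin (suc (suc n))) l x →
               punchIn (punchIn k l) (punchIn (pinch l k) x) ≡ punchIn k (punchIn l x)
punchIn-comm zero    l       x       = refl
punchIn-comm (suc k) zero    x       = refl
punchIn-comm {suc n} (suc k) (suc l) zero    = refl
punchIn-comm {suc n} (suc k) (suc l) (suc x) = cong suc (punchIn-comm k l x)

-- This is (-1)^i. A digit `i` of a Lehmer code counts the later positions with a smaller value, so
-- the product of these signs over all digits is the sign of the permutation.
ε : ∀ {n} → Fin n → ℤ
ε zero    = 1ℤ
ε (suc i) = - ε i

ε-exch : ∀ {n} (k : Fin (suc (suc n))) l → ε (punchIn k l) * ε (pinch l k) ≡ - (ε k * ε l)
ε-exch zero    l       = r (ε l)
  where
  r : ∀ x → - x * 1ℤ ≡ - (1ℤ * x)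
  r = solve-∀
ε-exch (suc k) zero    = r (ε k)
  where
  r : ∀ x → 1ℤ * x ≡ - (- x * 1ℤ)
  r = solve-∀
ε-exch {suc n} (suc k) (suc l) =
  trans (r (ε (punchIn k l)) (ε (pinch l k))) (trans (ε-exch k l) (cong -_ (sym (r (ε k) (ε l)))))
  where
  r : ∀ x y → - x * - y ≡ x * y
  r = solve-∀

-- Reversing an ordered pair of distinct values exchanges the row `k = 0` with the column `l = 0`
-- and acts on the remaining pairs as the same map one size smaller.
∑-exch : ∀ {n} (h : Fin (suc (suc n)) → Fin (suc n) → ℤ) →
         ∑ (λ k → ∑ (λ l → h (punchIn k l) (pinch l k))) ≡ ∑ (λ k → ∑ (λ l → h k l))
∑-exch {n} h = begin
  ∑ (λ k → ∑ (λ l → h (punchIn k l) (pinch l k)))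
    ≡⟨ ∑-suc _ ⟩
  ∑ (λ l → h (suc l) zero) + ∑ (λ k → ∑ (λ l → h (punchIn (suc k) l) (pinch l (suc k))))
    ≡⟨ +-congˡ X (trans (∑-cong λ k → ∑-suc _) (∑-+ (λ k → h zero k) _)) ⟩
  X + (Y + ∑ (λ k → ∑ (λ l → h (suc (punchIn k l)) (suc (pinch l k)))))
    ≡⟨ cong (λ t → X + (Y + t)) (rest n h) ⟩
  X + (Y + Z)
    ≡⟨ r X Y Z ⟩
  Y + (X + Z)
    ≡⟨ +-congˡ Y (trans (∑-cong λ k → ∑-suc _) (∑-+ (λ k → h (suc k) zero) _)) ⟨
  Y + ∑ (λ k → ∑ (λ l → h (suc k) l))
    ≡⟨ ∑-suc _ ⟨
  ∑ (λ k → ∑ (λ l → h k l)) ∎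
  where
  open ≡-Reasoning
  X = ∑ (λ l → h (suc l) zero)
  Y = ∑ (λ l → h zero l)
  Z = ∑ (λ k → ∑ (λ l → h (suc k) (suc l)))
  r : ∀ a b c → a + (b + c) ≡ b + (a + c)
  r = solve-∀
  rest : ∀ n (h : Fin (suc (suc n)) → Fin (suc n) → ℤ) →
         ∑ (λ k → ∑ (λ l → h (suc (punchIn k l)) (suc (pinch l k)))) ≡ ∑ (λ k → ∑ (λ l → h (suc k) (suc l)))
  rest zero    h = ∑-cong λ k → ∑-cong λ ()
  rest (suc n) h = ∑-exch (λ k l → h (suc k) (suc l))

exch : ∀ {n} → Code (suc (suc n)) → Code (suc (suc n))
exch (k ∷ l ∷ u) = punchIn k l ∷ pinch l k ∷ u

onTail : ∀ {n} → (Code n → Code n) → Code (suc n) → Code (suc n)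
onTail φ (k ∷ u) = k ∷ φ u

-- w ∘ (0 i+1)
swap : ∀ {n} → Fin n → Code (suc n) → Code (suc n)
swap zero    w = exch w
-- (0 i+2) is the conjugate of (1 i+2) by (0 1), and (1 i+2) is `swap i` on the tail.
swap (suc i) w = exch (onTail (swap i) (exch w))

exch-invol : ∀ {n} (w : Code (suc (suc n))) → exch (exch w) ≡ w
exch-invol (k ∷ l ∷ u) = cong₂ _∷_ (punchIn-pinch k l) (cong (_∷ u) (pinch-punchIn k l))

swap-invol : ∀ {n} (i : Fin n) w → swap i (swap i w) ≡ w
swap-invol zero    w = exch-invol w
swap-invol (suc i) w = trans (cong (exch ∘ onTail (swap i)) (exch-invol (onTail (swap i) (exch w))))
  (trans (cong exch (tail (exch w))) (exch-invol w))
  where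
  tail : ∀ v → onTail (swap i) (onTail (swap i) v) ≡ v
  tail (k ∷ u) = cong (k ∷_) (swap-invol i u)

⟦exch⟧-0 : ∀ {n} (w : Code (suc (suc n))) → ⟦ exch w ⟧ zero ≡ ⟦ w ⟧ (suc zero)
⟦exch⟧-0 (k ∷ l ∷ u) = refl

⟦exch⟧-1 : ∀ {n} (w : Code (suc (suc n))) → ⟦ exch w ⟧ (suc zero) ≡ ⟦ w ⟧ zero
⟦exch⟧-1 (k ∷ l ∷ u) = punchIn-pinch k l

⟦exch⟧-2 : ∀ {n} (w : Code (suc (suc n))) x → ⟦ exch w ⟧ (suc (suc x)) ≡ ⟦ w ⟧ (suc (suc x))
⟦exch⟧-2 (k ∷ l ∷ u) x = punchIn-comm k l (⟦ u ⟧ x)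

⟦onTail⟧-0 : ∀ {n} (φ : Code n → Code n) w → ⟦ onTail φ w ⟧ zero ≡ ⟦ w ⟧ zero
⟦onTail⟧-0 φ (k ∷ u) = refl

⟦onTail⟧-suc : ∀ {n} (φ : Code n → Code n) {x y} → (∀ u → ⟦ φ u ⟧ x ≡ ⟦ u ⟧ y) →
               ∀ w → ⟦ onTail φ w ⟧ (suc x) ≡ ⟦ w ⟧ (suc y)
⟦onTail⟧-suc φ e (k ∷ u) = cong (punchIn k) (e u)

⟦swap⟧-0 : ∀ {n} (i : Fin n) w → ⟦ swap i w ⟧ zero ≡ ⟦ w ⟧ (suc i)
⟦swap⟧-0 zero    w = ⟦exch⟧-0 w
⟦swap⟧-0 (suc i) w = trans (⟦exch⟧-0 (onTail (swap i) (exch w))) (trans (⟦onTail⟧-suc (swap i) (⟦swap⟧-0 i) (exch w)) (⟦exch⟧-2 w i))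

⟦swap⟧-i : ∀ {n} (i : Fin n) w → ⟦ swap i w ⟧ (suc i) ≡ ⟦ w ⟧ zero
⟦swap⟧-i i w = trans (sym (⟦swap⟧-0 i (swap i w))) (cong (λ v → ⟦ v ⟧ zero) (swap-invol i w))

⟦swap⟧-≢ : ∀ {n} (i j : Fin n) w → j ≢ i → ⟦ swap i w ⟧ (suc j) ≡ ⟦ w ⟧ (suc j)
⟦swap⟧-≢ zero    zero    w j≢i = contradiction refl j≢i
⟦swap⟧-≢ zero    (suc j) w j≢i = ⟦exch⟧-2 w j
⟦swap⟧-≢ (suc i) zero    w j≢i = trans (⟦exch⟧-1 (onTail (swap i) (exch w))) (trans (⟦onTail⟧-0 (swap i) (exch w)) (⟦exch⟧-0 w))
⟦swap⟧-≢ (suc i) (suc j) w j≢i =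
  trans (⟦exch⟧-2 (onTail (swap i) (exch w)) j) (trans (⟦onTail⟧-suc (swap i) (λ u → ⟦swap⟧-≢ i j u (j≢i ∘ cong suc)) (exch w)) (⟦exch⟧-2 w j))

∑ₚ-exch : ∀ {n} (f : Code (suc (suc n)) → ℤ) → ∑ₚ (λ w → f (exch w)) ≡ ∑ₚ f
∑ₚ-exch f = begin
  ∑ₚ (λ w → f (exch w))                                              ≡⟨ ∑ₚ-∷ _ ⟩
  ∑ (λ k → ∑ₚ (λ u → f (exch (k ∷ u))))                              ≡⟨ ∑-cong (λ k → ∑ₚ-∷ _) ⟩
  ∑ (λ k → ∑ (λ l → ∑ₚ (λ u → f (punchIn k l ∷ pinch l k ∷ u))))     ≡⟨ ∑-exch (λ k l → ∑ₚ (λ u → f (k ∷ l ∷ u))) ⟩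
  ∑ (λ k → ∑ (λ l → ∑ₚ (λ u → f (k ∷ l ∷ u))))                       ≡⟨ ∑-cong (λ k → ∑ₚ-∷ _) ⟨
  ∑ (λ k → ∑ₚ (λ u → f (k ∷ u)))                                     ≡⟨ ∑ₚ-∷ _ ⟨
  ∑ₚ f                                                               ∎
  where open ≡-Reasoning

∑ₚ-swap : ∀ {n} (i : Fin n) (f : Code (suc n) → ℤ) → ∑ₚ (λ w → f (swap i w)) ≡ ∑ₚ f
∑ₚ-swap zero    f = ∑ₚ-exch f
∑ₚ-swap (suc i) f = begin
  ∑ₚ (λ w → f (exch (onTail (swap i) (exch w))))   ≡⟨ ∑ₚ-exch (λ w → f (exch (onTail (swap i) w))) ⟩
  ∑ₚ (λ w → f (exch (onTail (swap i) w)))          ≡⟨ ∑ₚ-∷ _ ⟩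
  ∑ (λ k → ∑ₚ (λ u → f (exch (k ∷ swap i u))))     ≡⟨ ∑-cong (λ k → ∑ₚ-swap i (λ u → f (exch (k ∷ u)))) ⟩
  ∑ (λ k → ∑ₚ (λ u → f (exch (k ∷ u))))            ≡⟨ ∑ₚ-∷ _ ⟨
  ∑ₚ (λ w → f (exch w))                            ≡⟨ ∑ₚ-exch f ⟩
  ∑ₚ f                                             ∎
  where open ≡-Reasoning

-- The sign, and permutations with one prescribed value

sgn : ∀ {n} → Code n → ℤ
sgn []      = 1ℤ
sgn (k ∷ u) = ε k * sgn u

ε² : ∀ {n} (k : Fin n) → ε k * ε k ≡ 1ℤ
ε² zero    = refl
ε² (suc k) = trans (r (ε k)) (ε² k)
  where
  r : ∀ x → - x * - x ≡ x * x
  r = solve-∀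

sgn² : ∀ {n} (w : Code n) → sgn w * sgn w ≡ 1ℤ
sgn² []      = refl
sgn² (k ∷ u) = trans (r (ε k) (sgn u)) (cong₂ _*_ (ε² k) (sgn² u))
  where
  r : ∀ x y → (x * y) * (x * y) ≡ (x * x) * (y * y)
  r = solve-∀

sgn-exch : ∀ {n} (w : Code (suc (suc n))) → sgn (exch w) ≡ - sgn w
sgn-exch (k ∷ l ∷ u) = begin
  ε (punchIn k l) * (ε (pinch l k) * sgn u)   ≡⟨ *-assoc (ε (punchIn k l)) (ε (pinch l k)) (sgn u) ⟨
  ε (punchIn k l) * ε (pinch l k) * sgn u     ≡⟨ cong (_* sgn u) (ε-exch k l) ⟩
  - (ε k * ε l) * sgn u                       ≡⟨ r (ε k) (ε l) (sgn u) ⟩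
  - (ε k * (ε l * sgn u))                     ∎
  where
  open ≡-Reasoning
  r : ∀ x y z → - (x * y) * z ≡ - (x * (y * z))
  r = solve-∀

sgn-swap : ∀ {n} (i : Fin n) w → sgn (swap i w) ≡ - sgn w
sgn-swap zero    w = sgn-exch w
sgn-swap (suc i) w = trans (sgn-exch (onTail (swap i) (exch w))) (cong -_
  (trans (tail (exch w)) (trans (cong -_ (sgn-exch w)) (neg-involutive (sgn w)))))
  where
  tail : ∀ v → sgn (onTail (swap i) v) ≡ - sgn v
  tail (k ∷ u) = trans (cong (ε k *_) (sgn-swap i u)) (sym (neg-distribʳ-* (ε k) (sgn u)))

i≡-i⇒i≡0 : ∀ {i} → i ≡ - i → i ≡ 0ℤ
i≡-i⇒i≡0 {+ zero} _ = refl

∑ₚ-sgn : ∀ {n} → ∑ₚ (sgn {suc (suc n)}) ≡ 0ℤ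
∑ₚ-sgn {n} = i≡-i⇒i≡0 (trans (sym (∑ₚ-swap {suc n} zero sgn)) (trans (∑ₚ-cong (sgn-swap zero)) (∑ₚ-neg sgn)))

-- This generalizes `k ∷ u` from position 0 to position `j`: moving `k` past the digit `l` changes
-- both by the rule of `exch`.
ins : ∀ {n} → Fin (suc n) → Fin (suc n) → Code n → Code (suc n)
ins zero    k u       = k ∷ u
ins (suc j) k (l ∷ u) = punchIn k l ∷ ins j (pinch l k) u

⟦ins⟧-j : ∀ {n} j k (u : Code n) → ⟦ ins j k u ⟧ j ≡ k
⟦ins⟧-j zero    k u       = refl
⟦ins⟧-j (suc j) k (l ∷ u) = trans (cong (punchIn (punchIn k l)) (⟦ins⟧-j j (pinch l k) u)) (punchIn-pinch k l)

⟦ins⟧-punchIn : ∀ {n} j k (u : Code n) x → ⟦ ins j k u ⟧ (punchIn j x) ≡ punchIn k (⟦ u ⟧ x)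
⟦ins⟧-punchIn zero    k u       x       = refl
⟦ins⟧-punchIn (suc j) k (l ∷ u) zero    = refl
⟦ins⟧-punchIn (suc j) k (l ∷ u) (suc x) =
  trans (cong (punchIn (punchIn k l)) (⟦ins⟧-punchIn j (pinch l k) u x)) (punchIn-comm k l (⟦ u ⟧ x))

-- The extra factor is the cofactor sign (-1)^(j+k).
sgn-ins : ∀ {n} j k (u : Code n) → sgn (ins j k u) ≡ ε j * ε k * sgn u
sgn-ins zero    k u       = cong (_* sgn u) (sym (*-identityˡ (ε k)))
sgn-ins (suc j) k (l ∷ u) = begin
  ε (punchIn k l) * sgn (ins j (pinch l k) u)           ≡⟨ cong (ε (punchIn k l) *_) (sgn-ins j (pinch l k) u) ⟩
  ε (punchIn k l) * (ε j * ε (pinch l k) * sgn u)       ≡⟨ r (ε (punchIn k l)) (ε j) (ε (pinch l k)) (sgn u) ⟩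
  ε j * (ε (punchIn k l) * ε (pinch l k)) * sgn u       ≡⟨ cong (λ t → ε j * t * sgn u) (ε-exch k l) ⟩
  ε j * (- (ε k * ε l)) * sgn u                         ≡⟨ r′ (ε j) (ε k) (ε l) (sgn u) ⟩
  - ε j * ε k * (ε l * sgn u)                           ∎
  where
  open ≡-Reasoning
  r : ∀ a b c d → a * (b * c * d) ≡ b * (a * c) * d
  r = solve-∀
  r′ : ∀ a b c d → a * (- (b * c)) * d ≡ - a * b * (c * d)
  r′ = solve-∀

∑ₚ-ins : ∀ {n} (j : Fin (suc n)) (f : Code (suc n) → ℤ) → ∑ₚ f ≡ ∑ (λ k → ∑ₚ (λ u → f (ins j k u)))
∑ₚ-ins zero f = ∑ₚ-∷ f
∑ₚ-ins {suc n} (suc j) f = begin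
  ∑ₚ f                                                                 ≡⟨ ∑ₚ-∷ f ⟩
  ∑ (λ k → ∑ₚ (λ u → f (k ∷ u)))                                       ≡⟨ ∑-cong (λ k → ∑ₚ-ins j (λ u → f (k ∷ u))) ⟩
  ∑ (λ k → ∑ (λ l → ∑ₚ (λ u → f (k ∷ ins j l u))))                     ≡⟨ ∑-exch (λ k l → ∑ₚ (λ u → f (k ∷ ins j l u))) ⟨
  ∑ (λ k → ∑ (λ l → ∑ₚ (λ u → f (punchIn k l ∷ ins j (pinch l k) u)))) ≡⟨ ∑-cong (λ k → ∑ₚ-∷ _) ⟨
  ∑ (λ k → ∑ₚ (λ u → f (ins (suc j) k u)))                             ∎
  where open ≡-Reasoning

data View {n} (i : Fin (suc n)) : Fin (suc n) → Set where
  same  : View i i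
  other : ∀ x → View i (punchIn i x)

view : ∀ {n} (i j : Fin (suc n)) → View i j
view i j with i ≟ j
... | yes refl = same
... | no i≢j   = subst (View i) (punchIn-punchOut i≢j) (other (punchOut i≢j))

-- A transposition (0 i) that avoids position `j + 1` acts within the permutations with a given
-- value there. This lets `J` on fewer points be recognized in the restrictions of `f`, from which
-- its gap is derived.
swap-ins : ∀ {n} (j : Fin (suc n)) k i w → swap (punchIn j i) (ins (suc j) k w) ≡ ins (suc j) k (swap i w)
swap-ins j k i w = ⟦⟧-ext _ _ pt
  where
  open ≡-Reasoning
  W = ins (suc j) k w
  V = ins (suc j) k (swap i w)
  pt : ∀ x → ⟦ swap (punchIn j i) W ⟧ x ≡ ⟦ V ⟧ x
  pt zero = begin
    ⟦ swap (punchIn j i) W ⟧ zero   ≡⟨ ⟦swap⟧-0 (punchIn j i) W ⟩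
    ⟦ W ⟧ (suc (punchIn j i))       ≡⟨ ⟦ins⟧-punchIn (suc j) k w (suc i) ⟩
    punchIn k (⟦ w ⟧ (suc i))       ≡⟨ cong (punchIn k) (⟦swap⟧-0 i w) ⟨
    punchIn k (⟦ swap i w ⟧ zero)   ≡⟨ ⟦ins⟧-punchIn (suc j) k (swap i w) zero ⟨
    ⟦ V ⟧ zero                      ∎
  pt (suc x) with view j x
  ... | same = begin
    ⟦ swap (punchIn j i) W ⟧ (suc j)  ≡⟨ ⟦swap⟧-≢ (punchIn j i) j W (punchInᵢ≢i j i ∘ sym) ⟩
    ⟦ W ⟧ (suc j)                     ≡⟨ ⟦ins⟧-j (suc j) k w ⟩
    k                                 ≡⟨ ⟦ins⟧-j (suc j) k (swap i w) ⟨
    ⟦ V ⟧ (suc j)                     ∎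
  ... | other y with y ≟ i
  ...   | yes refl = begin
    ⟦ swap (punchIn j i) W ⟧ (suc (punchIn j i))  ≡⟨ ⟦swap⟧-i (punchIn j i) W ⟩
    ⟦ W ⟧ zero                                    ≡⟨ ⟦ins⟧-punchIn (suc j) k w zero ⟩
    punchIn k (⟦ w ⟧ zero)                        ≡⟨ cong (punchIn k) (⟦swap⟧-i i w) ⟨
    punchIn k (⟦ swap i w ⟧ (suc i))              ≡⟨ ⟦ins⟧-punchIn (suc j) k (swap i w) (suc i) ⟨
    ⟦ V ⟧ (suc (punchIn j i))                     ∎
  ...   | no y≢i = begin
    ⟦ swap (punchIn j i) W ⟧ (suc (punchIn j y))  ≡⟨ ⟦swap⟧-≢ (punchIn j i) (punchIn j y) W (y≢i ∘ punchIn-injective j y i) ⟩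
    ⟦ W ⟧ (suc (punchIn j y))                     ≡⟨ ⟦ins⟧-punchIn (suc j) k w (suc y) ⟩
    punchIn k (⟦ w ⟧ (suc y))                     ≡⟨ cong (punchIn k) (⟦swap⟧-≢ i y w y≢i) ⟨
    punchIn k (⟦ swap i w ⟧ (suc y))              ≡⟨ ⟦ins⟧-punchIn (suc j) k (swap i w) (suc y) ⟨
    ⟦ V ⟧ (suc (punchIn j y))                     ∎

-- The inner product, and the operators `J` and `A`

infix 8 ⟪_,_⟫

⟪_,_⟫ : ∀ {n} → (Code n → ℤ) → (Code n → ℤ) → ℤ
⟪ f , g ⟫ = ∑ₚ λ w → f w * g w

⟪⟫-sym : ∀ {n} (f g : Code n → ℤ) → ⟪ f , g ⟫ ≡ ⟪ g , f ⟫
⟪⟫-sym f g = ∑ₚ-cong λ w → *-comm (f w) (g w)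

⟪⟫-congʳ : ∀ {n} (f : Code n → ℤ) {g h : Code n → ℤ} → (∀ w → g w ≡ h w) → ⟪ f , g ⟫ ≡ ⟪ f , h ⟫
⟪⟫-congʳ f e = ∑ₚ-cong λ w → cong (f w *_) (e w)

⟪⟫-linʳ : ∀ {n} (f : Code n → ℤ) a b (g h : Code n → ℤ) →
          ⟪ f , (λ w → a * g w + b * h w) ⟫ ≡ a * ⟪ f , g ⟫ + b * ⟪ f , h ⟫
⟪⟫-linʳ f a b g h = trans (∑ₚ-cong λ w → r (f w) a b (g w) (h w)) (∑ₚ-lin a b (λ w → f w * g w) (λ w → f w * h w))
  where
  r : ∀ x a b y z → x * (a * y + b * z) ≡ a * (x * y) + b * (x * z)
  r = solve-∀

⟪⟫-linˡ : ∀ {n} (f : Code n → ℤ) a b (g h : Code n → ℤ) →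
          ⟪ (λ w → a * g w + b * h w) , f ⟫ ≡ a * ⟪ g , f ⟫ + b * ⟪ h , f ⟫
⟪⟫-linˡ f a b g h = trans (∑ₚ-cong λ w → r (f w) a b (g w) (h w)) (∑ₚ-lin a b (λ w → g w * f w) (λ w → h w * f w))
  where
  r : ∀ x a b y z → (a * y + b * z) * x ≡ a * (y * x) + b * (z * x)
  r = solve-∀

⟪⟫-lin² : ∀ {n} a b c d (f g h k : Code n → ℤ) →
          ⟪ (λ w → a * f w + b * g w) , (λ w → c * h w + d * k w) ⟫
          ≡ a * c * ⟪ f , h ⟫ + a * d * ⟪ f , k ⟫ + b * c * ⟪ g , h ⟫ + b * d * ⟪ g , k ⟫
⟪⟫-lin² a b c d f g h k = begin
  ⟪ (λ w → a * f w + b * g w) , (λ w → c * h w + d * k w) ⟫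
    ≡⟨ ⟪⟫-linˡ (λ w → c * h w + d * k w) a b f g ⟩
  a * ⟪ f , (λ w → c * h w + d * k w) ⟫ + b * ⟪ g , (λ w → c * h w + d * k w) ⟫
    ≡⟨ cong₂ (λ x y → a * x + b * y) (⟪⟫-linʳ f c d h k) (⟪⟫-linʳ g c d h k) ⟩
  a * (c * ⟪ f , h ⟫ + d * ⟪ f , k ⟫) + b * (c * ⟪ g , h ⟫ + d * ⟪ g , k ⟫)
    ≡⟨ r a b c d ⟪ f , h ⟫ ⟪ f , k ⟫ ⟪ g , h ⟫ ⟪ g , k ⟫ ⟩
  a * c * ⟪ f , h ⟫ + a * d * ⟪ f , k ⟫ + b * c * ⟪ g , h ⟫ + b * d * ⟪ g , k ⟫ ∎
  where
  open ≡-Reasoning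
  r : ∀ a b c d x y z t → a * (c * x + d * y) + b * (c * z + d * t) ≡ a * c * x + a * d * y + b * c * z + b * d * t
  r = solve-∀

⟪⟫-scale : ∀ {n} c (f g : Code n → ℤ) → ⟪ (λ w → c * f w) , (λ w → c * g w) ⟫ ≡ c * c * ⟪ f , g ⟫
⟪⟫-scale c f g = trans (∑ₚ-cong λ w → r c (f w) (g w)) (∑ₚ-* (c * c) _)
  where
  r : ∀ c x y → (c * x) * (c * y) ≡ (c * c) * (x * y)
  r = solve-∀

0≤⟪⟫ : ∀ {n} (f : Code n → ℤ) → 0ℤ ≤ ⟪ f , f ⟫
0≤⟪⟫ f = ∑ₚ-0≤ λ w → 0≤² (f w)

-- The Jucys–Murphy operator J (sum over the transpositions moving position 0)
-- and the product A of the Jucys–Murphy operators of all tails,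
-- which is the sum over all full cycles.

J : ∀ {n} → (Code (suc n) → ℤ) → Code (suc n) → ℤ
J f w = ∑ λ i → f (swap i w)

A : ∀ {n} → (Code (suc n) → ℤ) → Code (suc n) → ℤ
A {zero}  f w       = f w
A {suc n} f (k ∷ u) = A (λ v → J f (k ∷ v)) u

J-cong : ∀ {n} {f g : Code (suc n) → ℤ} → (∀ w → f w ≡ g w) → ∀ w → J f w ≡ J g w
J-cong e w = ∑-cong λ i → e (swap i w)

J-lin : ∀ {n} a b (f g : Code (suc n) → ℤ) w → J (λ w → a * f w + b * g w) w ≡ a * J f w + b * J g w
J-lin a b f g w = ∑-lin a b (λ i → f (swap i w)) (λ i → g (swap i w))

J-const : ∀ {n} c (w : Code (suc n)) → J (λ _ → c) w ≡ + n * c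
J-const {n} c w = ∑-const n c

J-adj : ∀ {n} (f g : Code (suc n) → ℤ) → ⟪ f , J g ⟫ ≡ ⟪ J f , g ⟫
J-adj f g = begin
  ∑ₚ (λ w → f w * ∑ (λ i → g (swap i w)))              ≡⟨ ∑ₚ-cong (λ w → sym (∑-* (f w) _)) ⟩
  ∑ₚ (λ w → ∑ (λ i → f w * g (swap i w)))              ≡⟨ ∑ₚ-∑-comm _ ⟩
  ∑ (λ i → ∑ₚ (λ w → f w * g (swap i w)))              ≡⟨ ∑-cong (λ i → sym (∑ₚ-swap i (λ w → f w * g (swap i w)))) ⟩
  ∑ (λ i → ∑ₚ (λ w → f (swap i w) * g (swap i (swap i w))))
    ≡⟨ ∑-cong (λ i → ∑ₚ-cong λ w → cong (λ v → f (swap i w) * g v) (swap-invol i w)) ⟩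
  ∑ (λ i → ∑ₚ (λ w → f (swap i w) * g w))              ≡⟨ ∑ₚ-∑-comm _ ⟨
  ∑ₚ (λ w → ∑ (λ i → f (swap i w) * g w))              ≡⟨ ∑ₚ-cong (λ w → ∑-*ʳ (g w) _) ⟩
  ∑ₚ (λ w → ∑ (λ i → f (swap i w)) * g w)              ∎
  where open ≡-Reasoning

J-sgn : ∀ {n} (f : Code (suc n) → ℤ) w → J (λ w → sgn w * f w) w ≡ - (sgn w * J f w)
J-sgn f w = begin
  ∑ (λ i → sgn (swap i w) * f (swap i w))   ≡⟨ ∑-cong (λ i → trans (cong (_* f (swap i w)) (sgn-swap i w)) (sym (neg-distribˡ-* (sgn w) (f (swap i w))))) ⟩
  ∑ (λ i → - (sgn w * f (swap i w)))        ≡⟨ ∑-neg _ ⟩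
  - ∑ (λ i → sgn w * f (swap i w))          ≡⟨ cong -_ (∑-* (sgn w) _) ⟩
  - (sgn w * J f w)                         ∎
  where open ≡-Reasoning

∑ₚ-J : ∀ {n} (f : Code (suc n) → ℤ) → ∑ₚ (J f) ≡ + n * ∑ₚ f
∑ₚ-J {n} f = begin
  ∑ₚ (λ w → ∑ (λ i → f (swap i w)))   ≡⟨ ∑ₚ-∑-comm _ ⟩
  ∑ (λ i → ∑ₚ (λ w → f (swap i w)))   ≡⟨ ∑-cong (λ i → ∑ₚ-swap i f) ⟩
  ∑ {n} (λ i → ∑ₚ f)                  ≡⟨ ∑-const n (∑ₚ f) ⟩
  + n * ∑ₚ f                          ∎
  where open ≡-Reasoning

hd : ∀ {n} → Code (suc n) → Fin (suc n)
hd w = ⟦ w ⟧ zero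

J-hd : ∀ {n} (φ : Fin (suc n) → ℤ) w → J (λ w → φ (hd w)) w ≡ ∑ φ - φ (hd w)
J-hd φ w = begin
  ∑ (λ i → φ (hd (swap i w)))                              ≡⟨ ∑-cong (λ i → cong φ (⟦swap⟧-0 i w)) ⟩
  ∑ (λ i → φ (⟦ w ⟧ (suc i)))                              ≡⟨ r (φ (hd w)) (∑ λ i → φ (⟦ w ⟧ (suc i))) ⟩
  φ (hd w) + ∑ (λ i → φ (⟦ w ⟧ (suc i))) - φ (hd w)        ≡⟨ cong (_- φ (hd w)) (trans (sym (∑-suc _)) (∑-⟦⟧ w φ)) ⟩
  ∑ φ - φ (hd w)                                           ∎
  where
  open ≡-Reasoning
  r : ∀ a b → b ≡ a + b - a
  r = solve-∀

A-cong : ∀ {n} {f g : Code (suc n) → ℤ} → (∀ w → f w ≡ g w) → ∀ w → A f w ≡ A g w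
A-cong {zero}  e w       = e w
A-cong {suc n} e (k ∷ u) = A-cong (λ v → J-cong e (k ∷ v)) u

A-lin : ∀ {n} a b (f g : Code (suc n) → ℤ) w → A (λ w → a * f w + b * g w) w ≡ a * A f w + b * A g w
A-lin {zero}  a b f g w       = refl
A-lin {suc n} a b f g (k ∷ u) =
  trans (A-cong (λ v → J-lin a b f g (k ∷ v)) u) (A-lin a b (λ v → J f (k ∷ v)) (λ v → J g (k ∷ v)) u)

A-* : ∀ {n} a (f : Code (suc n) → ℤ) w → A (λ w → a * f w) w ≡ a * A f w
A-* a f w = trans (A-cong (λ w → r a (f w)) w) (trans (A-lin a 0ℤ f f w) (sym (r a (A f w))))
  where
  r : ∀ a x → a * x ≡ a * x + 0ℤ * x
  r = solve-∀

∑ₚ-A : ∀ {n} (f : Code (suc n) → ℤ) → ∑ₚ (A f) ≡ fac n * ∑ₚ f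
∑ₚ-A {zero}  f = sym (trans (cong (_* ∑ₚ f) fac-zero) (*-identityˡ (∑ₚ f)))
∑ₚ-A {suc n} f = begin
  ∑ₚ (A f)                                           ≡⟨ ∑ₚ-∷ _ ⟩
  ∑ (λ k → ∑ₚ (A (λ v → J f (k ∷ v))))               ≡⟨ ∑-cong (λ k → ∑ₚ-A (λ v → J f (k ∷ v))) ⟩
  ∑ (λ k → fac n * ∑ₚ (λ v → J f (k ∷ v)))         ≡⟨ ∑-* (fac n) _ ⟩
  fac n * ∑ (λ k → ∑ₚ (λ v → J f (k ∷ v)))         ≡⟨ cong (fac n *_) (trans (sym (∑ₚ-∷ (J f))) (∑ₚ-J f)) ⟩
  fac n * (+ suc n * ∑ₚ f)                         ≡⟨ r (fac n) (+ suc n) (∑ₚ f) ⟩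
  + suc n * fac n * ∑ₚ f                           ≡⟨ cong (_* ∑ₚ f) (sym (fac-suc n)) ⟩
  fac (suc n) * ∑ₚ f                                 ∎
  where
  open ≡-Reasoning
  r : ∀ a b c → a * (b * c) ≡ b * a * c
  r = solve-∀

A-const : ∀ {n} c (w : Code (suc n)) → A (λ _ → c) w ≡ fac n * c
A-const {zero}  c w       = sym (trans (cong (_* c) fac-zero) (*-identityˡ c))
A-const {suc n} c (k ∷ u) = begin
  A (λ v → J (λ _ → c) (k ∷ v)) u   ≡⟨ A-cong (λ v → J-const c (k ∷ v)) u ⟩
  A (λ v → + suc n * c) u           ≡⟨ A-const (+ suc n * c) u ⟩
  fac n * (+ suc n * c)           ≡⟨ r (fac n) (+ suc n) c ⟩
  + suc n * fac n * c             ≡⟨ cong (_* c) (sym (fac-suc n)) ⟩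
  fac (suc n) * c                   ∎
  where
  open ≡-Reasoning
  r : ∀ a b c → a * (b * c) ≡ b * a * c
  r = solve-∀

altSign : ℕ → ℤ
altSign zero    = 1ℤ
altSign (suc n) = - altSign n

altSign² : ∀ n → altSign n * altSign n ≡ 1ℤ
altSign² zero    = refl
altSign² (suc n) = trans (r (altSign n)) (altSign² n)
  where
  r : ∀ x → - x * - x ≡ x * x
  r = solve-∀

-- A full cycle on `suc n` points is a product of `n` transpositions, one from each factor of `A`,
-- and each of them changes the sign.
A-sgn : ∀ {n} (f : Code (suc n) → ℤ) w → A (λ w → sgn w * f w) w ≡ altSign n * (sgn w * A f w)
A-sgn {zero}  f w       = sym (*-identityˡ (sgn w * f w))
A-sgn {suc n} f (k ∷ u) = begin
  A (λ v → J (λ w → sgn w * f w) (k ∷ v)) u               ≡⟨ A-cong (λ v → trans (J-sgn f (k ∷ v)) (r (ε k) (sgn v) (J f (k ∷ v)))) u ⟩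
  A (λ v → - ε k * (sgn v * J f (k ∷ v))) u               ≡⟨ A-* (- ε k) (λ v → sgn v * J f (k ∷ v)) u ⟩
  - ε k * A (λ v → sgn v * J f (k ∷ v)) u                 ≡⟨ cong (- ε k *_) (A-sgn (λ v → J f (k ∷ v)) u) ⟩
  - ε k * (altSign n * (sgn u * A f (k ∷ u)))             ≡⟨ r′ (ε k) (altSign n) (sgn u) (A f (k ∷ u)) ⟩
  - altSign n * (ε k * sgn u * A f (k ∷ u))               ∎
  where
  open ≡-Reasoning
  r : ∀ a b c → - (a * b * c) ≡ - a * (b * c)
  r = solve-∀
  r′ : ∀ a b c d → - a * (b * (c * d)) ≡ - b * (a * c * d)
  r′ = solve-∀

-- Functions of degree one

Mat : ℕ → Set
Mat n = Fin n → Fin n → ℤ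

F : ∀ {n} → Mat n → Code n → ℤ
F g w = ∑ λ j → g j (⟦ w ⟧ j)

row : ∀ {n} → Mat n → Fin n → ℤ
row g j = ∑ λ k → g j k

col : ∀ {n} → Mat n → Fin n → ℤ
col g k = ∑ λ j → g j k

tot : ∀ {n} → Mat n → ℤ
tot g = ∑ λ j → row g j

minor : ∀ {n} → Fin (suc n) → Fin (suc n) → Mat (suc n) → Mat n
minor j k g i l = g (punchIn j i) (punchIn k l)

tot-minor : ∀ {n} (g : Mat (suc n)) j k → tot (minor j k g) ≡ tot g - row g j - col g k + g j k
tot-minor g j k = begin
  ∑ (λ i → ∑ (λ l → g (punchIn j i) (punchIn k l)))
    ≡⟨ ∑-cong (λ i → trans (r (g (punchIn j i) k) _) (cong (_- g (punchIn j i) k) (sym (∑-punchIn k (g (punchIn j i)))))) ⟩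
  ∑ (λ i → row g (punchIn j i) - g (punchIn j i) k)
    ≡⟨ ∑-- _ _ ⟩
  ∑ (λ i → row g (punchIn j i)) - ∑ (λ i → g (punchIn j i) k)
    ≡⟨ r′ (row g j) (g j k) (∑ λ i → row g (punchIn j i)) (∑ λ i → g (punchIn j i) k) ⟩
  (row g j + ∑ (λ i → row g (punchIn j i))) - row g j - (g j k + ∑ (λ i → g (punchIn j i) k)) + g j k
    ≡⟨ cong₂ (λ x y → x - row g j - y + g j k) (sym (∑-punchIn j (row g))) (sym (∑-punchIn j (λ i → g i k))) ⟩
  tot g - row g j - col g k + g j k ∎
  where
  open ≡-Reasoning
  r : ∀ a b → b ≡ a + b - a
  r = solve-∀
  r′ : ∀ a b c d → c - d ≡ (a + c) - a - (b + d) + b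
  r′ = solve-∀

F-∷ : ∀ {n} (g : Mat (suc n)) k u → F g (k ∷ u) ≡ g zero k + F (minor zero k g) u
F-∷ g k u = ∑-suc _

F-ins : ∀ {n} (g : Mat (suc n)) j k u → F g (ins j k u) ≡ g j k + F (minor j k g) u
F-ins g j k u = trans (∑-punchIn j _)
  (cong₂ _+_ (cong (g j) (⟦ins⟧-j j k u)) (∑-cong λ x → cong (g (punchIn j x)) (⟦ins⟧-punchIn j k u x)))

F-swap : ∀ {n} (g : Mat (suc n)) i w →
         F g (swap i w) ≡ F g w + (g zero (⟦ w ⟧ (suc i)) + g (suc i) (hd w) - g zero (hd w) - g (suc i) (⟦ w ⟧ (suc i)))
F-swap g i w = begin
  F g (swap i w)                                               ≡⟨ ∑-suc _ ⟩
  g zero (hd (swap i w)) + ∑ (λ j → g (suc j) (⟦ swap i w ⟧ (suc j)))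
    ≡⟨ cong₂ _+_ (cong (g zero) (⟦swap⟧-0 i w))
         (∑-update i _ (λ j → g (suc j) (⟦ w ⟧ (suc j))) (λ j j≢i → cong (g (suc j)) (⟦swap⟧-≢ i j w j≢i))) ⟩
  p + (X - s + g (suc i) (⟦ swap i w ⟧ (suc i)))               ≡⟨ cong (λ t → p + (X - s + g (suc i) t)) (⟦swap⟧-i i w) ⟩
  p + (X - s + q)                                              ≡⟨ r p q (g zero (hd w)) s X ⟩
  g zero (hd w) + X + (p + q - g zero (hd w) - s)              ≡⟨ cong (_+ (p + q - g zero (hd w) - s)) (sym (∑-suc (λ j → g j (⟦ w ⟧ j)))) ⟩
  F g w + (p + q - g zero (hd w) - s)                          ∎
  where
  open ≡-Reasoning
  p = g zero (⟦ w ⟧ (suc i))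
  q = g (suc i) (hd w)
  s = g (suc i) (⟦ w ⟧ (suc i))
  X = ∑ (λ j → g (suc j) (⟦ w ⟧ (suc j)))
  r : ∀ p q h s X → p + (X - s + q) ≡ h + X + (p + q - h - s)
  r = solve-∀

-- The transposition (0 i+1) changes only two summands of `F g`. Summed over `i`, the changes
-- complete to the row of 0, the column of `hd w` and `F g w` itself. The additional terms depend on
-- `hd w` only, so `J` maps degree one to degree one.
J-F : ∀ {n} (g : Mat (suc n)) w →
      J (F g) w ≡ (+ n - 1ℤ) * F g w + row g zero + col g (hd w) - (+ n + 1ℤ) * g zero (hd w)
J-F {n} g w = begin
  ∑ (λ i → F g (swap i w))
    ≡⟨ ∑-cong (λ i → trans (F-swap g i w) (r₁ (F g w) (p i) (q i) h (s i))) ⟩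
  ∑ (λ i → (F g w - h) + (p i + q i - s i))
    ≡⟨ ∑-+ (λ _ → F g w - h) _ ⟩
  ∑ {n} (λ _ → F g w - h) + ∑ (λ i → p i + q i - s i)
    ≡⟨ cong₂ _+_ (∑-const n (F g w - h)) (trans (∑-- (λ i → p i + q i) s) (cong (_- ∑ s) (∑-+ p q))) ⟩
  + n * (F g w - h) + (∑ p + ∑ q - ∑ s)
    ≡⟨ r₂ (+ n) (F g w) h (∑ p) (∑ q) (∑ s) ⟩
  + n * (F g w - h) + ((h + ∑ p) + (h + ∑ q) - (h + ∑ s) - h)
    ≡⟨ cong₂ (λ x y → + n * (F g w - h) + (x + y - (h + ∑ s) - h))
         (trans (sym (∑-suc _)) (∑-⟦⟧ w (g zero))) (sym (∑-suc (λ j → g j (hd w)))) ⟩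
  + n * (F g w - h) + (row g zero + col g (hd w) - (h + ∑ s) - h)
    ≡⟨ cong (λ x → + n * (F g w - h) + (row g zero + col g (hd w) - x - h)) (sym (∑-suc (λ j → g j (⟦ w ⟧ j)))) ⟩
  + n * (F g w - h) + (row g zero + col g (hd w) - F g w - h)
    ≡⟨ r₃ (+ n) (F g w) h (row g zero) (col g (hd w)) ⟩
  (+ n - 1ℤ) * F g w + row g zero + col g (hd w) - (+ n + 1ℤ) * h ∎
  where
  open ≡-Reasoning
  h = g zero (hd w)
  p q s : Fin n → ℤ
  p i = g zero (⟦ w ⟧ (suc i))
  q i = g (suc i) (hd w)
  s i = g (suc i) (⟦ w ⟧ (suc i))
  r₁ : ∀ f p q h s → f + (p + q - h - s) ≡ (f - h) + (p + q - s)
  r₁ = solve-∀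
  r₂ : ∀ n f h p q s → n * (f - h) + (p + q - s) ≡ n * (f - h) + ((h + p) + (h + q) - (h + s) - h)
  r₂ = solve-∀
  r₃ : ∀ n f h a b → n * (f - h) + (a + b - f - h) ≡ (n - 1ℤ) * f + a + b - (n + 1ℤ) * h
  r₃ = solve-∀

-- Of the full cycles on `n + 2` points, `n !` send a given position to a given other one. So each
-- row of `g` is summed, `n !` times, over all values except its own under `w`.
A-F : ∀ {n} (g : Mat (suc (suc n))) w → A (F g) w ≡ fac n * (tot g - F g w)

-- Multiplied by `n`, the formula also makes sense on a single point, where the recursion on tails
-- ends.
n*A-F : ∀ n (g : Mat (suc n)) w → + n * A (F g) w ≡ fac n * (tot g - F g w)
n*A-F zero    g (zero ∷ []) = begin
  0ℤ * F g (zero ∷ [])                      ≡⟨ *-zeroˡ (F g (zero ∷ [])) ⟩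
  0ℤ                                        ≡⟨ +-inverseʳ (tot g) ⟨
  tot g - tot g                             ≡⟨ cong (λ t → tot g - t) (∑-cong λ { zero → trans (∑-suc _) (trans (+-congˡ (g zero zero) (∑-zero _)) (+-identityʳ (g zero zero))) }) ⟩
  tot g - F g (zero ∷ [])                   ≡⟨ *-identityˡ (tot g - F g (zero ∷ [])) ⟨
  1ℤ * (tot g - F g (zero ∷ []))            ≡⟨ cong (_* (tot g - F g (zero ∷ []))) fac-zero ⟨
  fac 0 * (tot g - F g (zero ∷ []))         ∎
  where open ≡-Reasoning
n*A-F (suc n) g w = begin
  + suc n * A (F g) w                       ≡⟨ cong (+ suc n *_) (A-F g w) ⟩
  + suc n * (fac n * (tot g - F g w))     ≡⟨ *-assoc (+ suc n) (fac n) (tot g - F g w) ⟨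
  + suc n * fac n * (tot g - F g w)       ≡⟨ cong (_* (tot g - F g w)) (sym (fac-suc n)) ⟩
  fac (suc n) * (tot g - F g w)             ∎
  where open ≡-Reasoning

A-F {n} g (k ∷ u) = begin
  A (λ v → J (F g) (k ∷ v)) u
    ≡⟨ A-cong (λ v → trans (J-F g (k ∷ v)) (trans (cong (λ t → (+ suc n - 1ℤ) * t + R + C - (+ suc n + 1ℤ) * h) (F-∷ g k v))
                       (r₁ (+ n) h (F g′ v) R C))) u ⟩
  -- With the first value `k` fixed, the terms of `J-F` in `hd w` are constants, collected in `c`.
  A (λ v → + n * F g′ v + 1ℤ * c) u
    ≡⟨ A-lin (+ n) 1ℤ (F g′) (λ _ → c) u ⟩
  + n * A (F g′) u + 1ℤ * A (λ _ → c) u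
    ≡⟨ cong₂ (λ x y → x + 1ℤ * y) (n*A-F n g′ u) (A-const c u) ⟩
  fac n * (tot g′ - F g′ u) + 1ℤ * (fac n * c)
    ≡⟨ cong (λ t → fac n * (t - F g′ u) + 1ℤ * (fac n * c)) (tot-minor g zero k) ⟩
  fac n * ((tot g - R - C + h) - F g′ u) + 1ℤ * (fac n * c)
    ≡⟨ r₂ (fac n) (tot g) R C h (F g′ u) ⟩
  fac n * (tot g - (h + F g′ u))
    ≡⟨ cong (λ t → fac n * (tot g - t)) (sym (F-∷ g k u)) ⟩
  fac n * (tot g - F g (k ∷ u)) ∎
  where
  open ≡-Reasoning
  g′ = minor zero k g
  h  = g zero k
  R  = row g zero
  C  = col g k
  c  = R + C - + 2 * h
  r₁ : ∀ n h f R C → (1ℤ + n - 1ℤ) * (h + f) + R + C - (1ℤ + n + 1ℤ) * h ≡ n * f + 1ℤ * (R + C - + 2 * h)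
  r₁ = solve-∀
  r₂ : ∀ m t R C h f → m * ((t - R - C + h) - f) + 1ℤ * (m * (R + C - + 2 * h)) ≡ m * (t - (h + f))
  r₂ = solve-∀

-- Inverses of full cycles are full cycles, so `A` is self-adjoint, but the recursion hides this:
-- the adjoint applies the same factors in the opposite order. The pairing with degree one functions
-- is therefore computed by an induction of its own.
A-F-adj : ∀ {n} (g : Mat (suc (suc n))) f → ⟪ F g , A f ⟫ ≡ fac n * (tot g * ∑ₚ f - ⟪ F g , f ⟫)
A-F-adj {zero} g f = begin
  ⟪ F g , A f ⟫                                     ≡⟨ ⟪⟫-congʳ (F g) A≡J ⟩
  ⟪ F g , J f ⟫                                     ≡⟨ J-adj (F g) f ⟩
  ⟪ J (F g) , f ⟫                                   ≡⟨ ∑ₚ-cong (λ w → cong (_* f w) (trans (sym (A≡J′ w)) (trans (A-F g w) (cong (_* (tot g - F g w)) fac-zero)))) ⟩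
  ∑ₚ (λ w → 1ℤ * (tot g - F g w) * f w)             ≡⟨ ∑ₚ-cong (λ w → r (tot g) (F g w) (f w)) ⟩
  ∑ₚ (λ w → tot g * f w + - 1ℤ * (F g w * f w))     ≡⟨ ∑ₚ-lin (tot g) (- 1ℤ) f _ ⟩
  tot g * ∑ₚ f + - 1ℤ * ⟪ F g , f ⟫                 ≡⟨ r′ (tot g * ∑ₚ f) ⟪ F g , f ⟫ ⟩
  1ℤ * (tot g * ∑ₚ f - ⟪ F g , f ⟫)                 ≡⟨ cong (_* (tot g * ∑ₚ f - ⟪ F g , f ⟫)) fac-zero ⟨
  fac 0 * (tot g * ∑ₚ f - ⟪ F g , f ⟫)              ∎
  where
  open ≡-Reasoning
  A≡J : ∀ w → A f w ≡ J f w
  A≡J (k ∷ u) = refl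
  A≡J′ : ∀ w → A (F g) w ≡ J (F g) w
  A≡J′ (k ∷ u) = refl
  r : ∀ a b c → 1ℤ * (a - b) * c ≡ a * c + - 1ℤ * (b * c)
  r = solve-∀
  r′ : ∀ a b → a + - 1ℤ * b ≡ 1ℤ * (a - b)
  r′ = solve-∀
A-F-adj {suc n} g f = begin
  ⟪ F g , A f ⟫
    ≡⟨ ∑ₚ-∷ _ ⟩
  ∑ (λ k → ∑ₚ (λ u → F g (k ∷ u) * A (fₖ k) u))
    ≡⟨ ∑-cong (λ k → trans (∑ₚ-cong λ u → trans (cong (_* A (fₖ k) u) (F-∷ g k u)) (*-distribʳ-+ (A (fₖ k) u) (h k) (F (gₖ k) u)))
                     (trans (∑ₚ-+ _ _) (cong₂ _+_ (∑ₚ-* (h k) _) refl))) ⟩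
  ∑ (λ k → h k * ∑ₚ (A (fₖ k)) + ⟪ F (gₖ k) , A (fₖ k) ⟫)
    ≡⟨ ∑-cong (λ k → cong₂ (λ x y → h k * x + y) (trans (∑ₚ-A (fₖ k)) (cong (_* ∑ₚ (fₖ k)) (fac-suc n))) (A-F-adj (gₖ k) (fₖ k))) ⟩
  ∑ (λ k → h k * (+ suc n * m * ∑ₚ (fₖ k)) + m * (tot (gₖ k) * ∑ₚ (fₖ k) - ⟪ F (gₖ k) , fₖ k ⟫))
    ≡⟨ ∑-cong (λ k → trans (cong (λ t → h k * (+ suc n * m * ∑ₚ (fₖ k)) + m * (t * ∑ₚ (fₖ k) - ⟪ F (gₖ k) , fₖ k ⟫)) (tot-minor g zero k))
         (trans (r₁ (h k) (+ n) m (∑ₚ (fₖ k)) (tot g) R (C k) ⟪ F (gₖ k) , fₖ k ⟫) (cong (m *_) (sym (∑ₚ-lin (c k) (- 1ℤ) (fₖ k) _))))) ⟩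
  ∑ (λ k → m * ∑ₚ (λ u → c k * fₖ k u + - 1ℤ * (F (gₖ k) u * fₖ k u)))
    ≡⟨ ∑-cong (λ k → cong (m *_) (∑ₚ-cong λ u → trans (r₂ (h k) (+ n) (tot g) R (C k) (fₖ k u) (F (gₖ k) u))
          (cong (λ t → ((+ n + + 3) * h k - C k + (tot g - R) - t) * fₖ k u) (sym (F-∷ g k u))))) ⟩
  ∑ (λ k → m * ∑ₚ (λ u → Φ (k ∷ u) * J f (k ∷ u)))
    ≡⟨ ∑-* m _ ⟩
  m * ∑ (λ k → ∑ₚ (λ u → Φ (k ∷ u) * J f (k ∷ u)))
    ≡⟨ cong (m *_) (trans (sym (∑ₚ-∷ (λ w → Φ w * J f w))) (J-adj Φ f)) ⟩
  m * ⟪ J Φ , f ⟫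
    ≡⟨ cong (m *_) (∑ₚ-cong λ w → trans (cong (_* f w) (JΦ w)) (r₄ (+ suc n) (tot g) (F g w) (f w))) ⟩
  m * ∑ₚ (λ w → + suc n * tot g * f w + - + suc n * (F g w * f w))
    ≡⟨ cong (m *_) (∑ₚ-lin (+ suc n * tot g) (- + suc n) f _) ⟩
  m * (+ suc n * tot g * ∑ₚ f + - + suc n * ⟪ F g , f ⟫)
    ≡⟨ r₅ m (+ suc n) (tot g) (∑ₚ f) ⟪ F g , f ⟫ ⟩
  + suc n * m * (tot g * ∑ₚ f - ⟪ F g , f ⟫)
    ≡⟨ cong (_* (tot g * ∑ₚ f - ⟪ F g , f ⟫)) (sym (fac-suc n)) ⟩
  fac (suc n) * (tot g * ∑ₚ f - ⟪ F g , f ⟫) ∎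
  where
  open ≡-Reasoning
  m = fac n
  R = row g zero
  gₖ : Fin _ → Mat (suc (suc n))
  gₖ k = minor zero k g
  fₖ : Fin _ → Code (suc (suc n)) → ℤ
  fₖ k v = J f (k ∷ v)
  h C c : Fin _ → ℤ
  h k = g zero k
  C k = col g k
  c k = (+ n + + 2) * h k - C k + (tot g - R)
  -- The induction hypothesis on the tails leaves `Φ` paired with `J f`. It is again of degree one,
  -- so `J` can be moved over and evaluated.
  Φ : Code _ → ℤ
  Φ w = (+ n + + 3) * h (hd w) - C (hd w) + (tot g - R) - F g w
  r₁ : ∀ h n m s t R C q → h * ((1ℤ + n) * m * s) + m * ((t - R - C + h) * s - q) ≡ m * (((n + + 2) * h - C + (t - R)) * s + - 1ℤ * q)
  r₁ = solve-∀
  r₂ : ∀ h n t R C f F → ((n + + 2) * h - C + (t - R)) * f + - 1ℤ * (F * f) ≡ ((n + + 3) * h - C + (t - R) - (h + F)) * f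
  r₂ = solve-∀
  r₃ : ∀ n t F R C h → (n + + 3) * (R - h) - (t - C) + (1ℤ + (1ℤ + n)) * (t - R) - ((1ℤ + (1ℤ + n) - 1ℤ) * F + R + C - (1ℤ + (1ℤ + n) + 1ℤ) * h)
       ≡ (1ℤ + n) * (t - F)
  r₃ = solve-∀
  r₄ : ∀ n t F f → n * (t - F) * f ≡ n * t * f + - n * (F * f)
  r₄ = solve-∀
  r₅ : ∀ m n t s q → m * (n * t * s + - n * q) ≡ n * m * (t * s - q)
  r₅ = solve-∀
  JΦ : ∀ w → J Φ w ≡ + suc n * (tot g - F g w)
  JΦ w = begin
    J Φ w
      ≡⟨ trans (∑-- _ (λ i → F g (swap i w))) (cong (_- J (F g) w) (trans (∑-+ _ (λ _ → tot g - R)) (cong (_+ J (λ _ → tot g - R) w) (trans (∑-- _ (λ i → C (hd (swap i w)))) (cong (_- J (λ v → C (hd v)) w) (∑-* (+ n + + 3) _)))))) ⟩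
    (+ n + + 3) * J (λ v → h (hd v)) w - J (λ v → C (hd v)) w + J (λ _ → tot g - R) w - J (F g) w
      ≡⟨ cong₂ _-_ (cong₂ _+_ (cong₂ (λ x y → (+ n + + 3) * x - y) (J-hd h w) (J-hd C w)) (J-const (tot g - R) w)) (J-F g w) ⟩
    (+ n + + 3) * (∑ h - h (hd w)) - (∑ C - C (hd w)) + + suc (suc n) * (tot g - R) - ((+ suc (suc n) - 1ℤ) * F g w + R + C (hd w) - (+ suc (suc n) + 1ℤ) * h (hd w))
      ≡⟨ cong (λ t → (+ n + + 3) * (R - h (hd w)) - (t - C (hd w)) + + suc (suc n) * (tot g - R) - ((+ suc (suc n) - 1ℤ) * F g w + R + C (hd w) - (+ suc (suc n) + 1ℤ) * h (hd w))) (∑-∑-comm (λ k j → g j k)) ⟩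
    (+ n + + 3) * (R - h (hd w)) - (tot g - C (hd w)) + + suc (suc n) * (tot g - R) - ((+ suc (suc n) - 1ℤ) * F g w + R + C (hd w) - (+ suc (suc n) + 1ℤ) * h (hd w))
      ≡⟨ r₃ (+ n) (tot g) (F g w) R (C (hd w)) (h (hd w)) ⟩
    + suc n * (tot g - F g w) ∎

-- The sum of f over the permutations sending j to k
Marg : ∀ {n} → (Code (suc n) → ℤ) → Mat (suc n)
Marg f j k = ∑ₚ λ u → f (ins j k u)

row-Marg : ∀ {n} (f : Code (suc n) → ℤ) j → row (Marg f) j ≡ ∑ₚ f
row-Marg f j = sym (∑ₚ-ins j f)

-- Degree one functions see `f` only through its marginals, so vanishing marginals mean
-- orthogonality to all functions of degree one.
⟪⟫-F : ∀ {n} (f : Code (suc n) → ℤ) g → ⟪ f , F g ⟫ ≡ ∑ (λ j → ∑ (λ k → g j k * Marg f j k))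
⟪⟫-F f g = begin
  ∑ₚ (λ w → f w * ∑ (λ j → g j (⟦ w ⟧ j)))   ≡⟨ ∑ₚ-cong (λ w → sym (∑-* (f w) _)) ⟩
  ∑ₚ (λ w → ∑ (λ j → f w * g j (⟦ w ⟧ j)))   ≡⟨ ∑ₚ-∑-comm _ ⟩
  ∑ (λ j → ∑ₚ (λ w → f w * g j (⟦ w ⟧ j)))   ≡⟨ ∑-cong (λ j → ∑ₚ-ins j _) ⟩
  ∑ (λ j → ∑ (λ k → ∑ₚ (λ u → f (ins j k u) * g j (⟦ ins j k u ⟧ j))))
    ≡⟨ ∑-cong (λ j → ∑-cong λ k → trans (∑ₚ-cong λ u → trans (cong (λ t → f (ins j k u) * g j t) (⟦ins⟧-j j k u)) (*-comm (f (ins j k u)) (g j k))) (∑ₚ-* (g j k) _)) ⟩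
  ∑ (λ j → ∑ (λ k → g j k * Marg f j k))     ∎
  where open ≡-Reasoning

⟪⟫-hd : ∀ {n} (f : Code (suc n) → ℤ) (φ : Fin (suc n) → ℤ) → ⟪ f , (λ w → φ (hd w)) ⟫ ≡ ∑ (λ k → φ k * Marg f zero k)
⟪⟫-hd f φ = trans (∑ₚ-∷ _) (∑-cong λ k → trans (∑ₚ-cong λ u → *-comm (f (k ∷ u)) (φ k)) (∑ₚ-* (φ k) _))

col-Marg : ∀ {n} (f : Code (suc n) → ℤ) k → col (Marg f) k ≡ ∑ₚ f
col-Marg f k = begin
  ∑ (λ j → Marg f j k)                          ≡⟨ ∑-cong (λ j → sym (∑-δ k (Marg f j))) ⟩
  ∑ (λ j → ∑ (λ l → δ k l * Marg f j l))        ≡⟨ ⟪⟫-F f (λ _ l → δ k l) ⟨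
  ⟪ f , F (λ _ l → δ k l) ⟫                     ≡⟨ ∑ₚ-cong (λ w → trans (cong (f w *_) (δ-sum w)) (*-identityʳ (f w))) ⟩
  ∑ₚ f                                          ∎
  where
  open ≡-Reasoning
  -- Every permutation takes the value `k` at exactly one position.
  δ-sum : ∀ w → F (λ _ l → δ k l) w ≡ 1ℤ
  δ-sum w = trans (∑-⟦⟧ w (δ k)) (trans (∑-cong λ l → sym (*-identityʳ (δ k l))) (∑-δ k (λ _ → 1ℤ)))

tot-Marg : ∀ {n} (f : Code (suc n) → ℤ) → tot (Marg f) ≡ + suc n * ∑ₚ f
tot-Marg {n} f = trans (∑-cong (row-Marg f)) (∑-const (suc n) (∑ₚ f))

Marg-lin : ∀ {n} a b (f g : Code (suc n) → ℤ) j k →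
           Marg (λ w → a * f w + b * g w) j k ≡ a * Marg f j k + b * Marg g j k
Marg-lin a b f g j k = ∑ₚ-lin a b (λ u → f (ins j k u)) (λ u → g (ins j k u))

∑ₚ-F : ∀ {n} (g : Mat (suc n)) → ∑ₚ (F g) ≡ fac n * tot g
∑ₚ-F {n} g = begin
  ∑ₚ (F g)                                          ≡⟨ ∑ₚ-cong (λ w → sym (*-identityˡ (F g w))) ⟩
  ⟪ (λ _ → 1ℤ) , F g ⟫                              ≡⟨ ⟪⟫-F (λ _ → 1ℤ) g ⟩
  ∑ (λ j → ∑ (λ k → g j k * ∑ₚ {n} (λ _ → 1ℤ)))     ≡⟨ ∑-cong (λ j → ∑-*ʳ (∑ₚ {n} (λ _ → 1ℤ)) (g j)) ⟩
  ∑ (λ j → row g j * ∑ₚ {n} (λ _ → 1ℤ))             ≡⟨ ∑-*ʳ (∑ₚ {n} (λ _ → 1ℤ)) (row g) ⟩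
  tot g * ∑ₚ {n} (λ _ → 1ℤ)                         ≡⟨ cong (tot g *_) (trans (∑ₚ-const n 1ℤ) (*-identityʳ (fac n))) ⟩
  tot g * fac n                                   ≡⟨ *-comm (tot g) (fac n) ⟩
  fac n * tot g                                   ∎
  where open ≡-Reasoning

-- When all rows and columns of `g` have the same sum, as for `g = Marg f`, this is a multiple of
-- `g` plus a constant. So `F (Marg f)` is, up to scaling and a constant, the projection of `f` to
-- degree one.
Marg-F : ∀ {n} (g : Mat (suc (suc n))) j k →
         Marg (F g) j k ≡ fac n * (tot g - row g j - col g k + (+ n + + 2) * g j k)
Marg-F {n} g j k = begin
  ∑ₚ (λ u → F g (ins j k u))                                ≡⟨ ∑ₚ-cong (F-ins g j k) ⟩
  ∑ₚ (λ u → g j k + F (minor j k g) u)                      ≡⟨ ∑ₚ-+ (λ _ → g j k) _ ⟩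
  ∑ₚ {suc n} (λ _ → g j k) + ∑ₚ (F (minor j k g))
    ≡⟨ cong₂ _+_ (trans (∑ₚ-const (suc n) (g j k)) (cong (_* g j k) (fac-suc n)))
                 (trans (∑ₚ-F (minor j k g)) (cong (fac n *_) (tot-minor g j k))) ⟩
  + suc n * fac n * g j k + fac n * (tot g - row g j - col g k + g j k)
    ≡⟨ r (+ n) (fac n) (g j k) (tot g) (row g j) (col g k) ⟩
  fac n * (tot g - row g j - col g k + (+ n + + 2) * g j k) ∎
  where
  open ≡-Reasoning
  r : ∀ n m x t a b → (1ℤ + n) * m * x + m * (t - a - b + x) ≡ m * (t - a - b + (n + + 2) * x)
  r = solve-∀

-- With two values prescribed, at least two of the four or more points are free, and the signs
-- cancel on them. Consequently a degree one function has the same marginals on even and on odd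
-- permutations.
Marg-sgn-F : ∀ {n} (g : Mat (suc (suc (suc (suc n))))) j k → Marg (λ w → sgn w * F g w) j k ≡ 0ℤ
Marg-sgn-F {n} g j k = begin
  ∑ₚ (λ u → sgn (ins j k u) * F g (ins j k u))
    ≡⟨ ∑ₚ-cong (λ u → trans (cong₂ _*_ (sgn-ins j k u) (F-ins g j k u)) (r (ε j * ε k) (sgn u) (g j k) (F g′ u))) ⟩
  ∑ₚ (λ u → ε j * ε k * g j k * sgn u + ε j * ε k * (sgn u * F g′ u))
    ≡⟨ ∑ₚ-lin (ε j * ε k * g j k) (ε j * ε k) sgn _ ⟩
  ε j * ε k * g j k * ∑ₚ sgn + ε j * ε k * ⟪ sgn , F g′ ⟫
    ≡⟨ cong₂ (λ x y → ε j * ε k * g j k * x + ε j * ε k * y) ∑ₚ-sgn sgnF ⟩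
  ε j * ε k * g j k * 0ℤ + ε j * ε k * 0ℤ
    ≡⟨ r′ (ε j * ε k * g j k) (ε j * ε k) ⟩
  0ℤ ∎
  where
  open ≡-Reasoning
  g′ = minor j k g
  r : ∀ e s a b → e * s * (a + b) ≡ e * a * s + e * (s * b)
  r = solve-∀
  r′ : ∀ a b → a * 0ℤ + b * 0ℤ ≡ 0ℤ
  r′ = solve-∀
  sgnF : ⟪ sgn , F g′ ⟫ ≡ 0ℤ
  sgnF = trans (⟪⟫-F sgn g′) (∑-0 λ i → ∑-0 λ l → trans (cong (g′ i l *_)
    (trans (∑ₚ-cong (sgn-ins i l)) (trans (∑ₚ-* (ε i * ε l) sgn) (trans (cong (ε i * ε l *_) ∑ₚ-sgn) (*-zeroʳ (ε i * ε l)))))) (*-zeroʳ (g′ i l)))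

-- Functions without marginals

NoMarg : ∀ {n} → (Code (suc n) → ℤ) → Set
NoMarg f = ∀ j k → Marg f j k ≡ 0ℤ

NoMarg-∑ₚ : ∀ {n} (f : Code (suc n) → ℤ) → NoMarg f → ∑ₚ f ≡ 0ℤ
NoMarg-∑ₚ f p = trans (sym (row-Marg f zero)) (∑-0 (p zero))

NoMarg-F : ∀ {n} (f : Code (suc n) → ℤ) → NoMarg f → ∀ g → ⟪ f , F g ⟫ ≡ 0ℤ
NoMarg-F f p g = trans (⟪⟫-F f g) (∑-0 λ j → ∑-0 λ k → trans (cong (g j k *_) (p j k)) (*-zeroʳ (g j k)))

NoMarg-hd : ∀ {n} (f : Code (suc n) → ℤ) → (∀ k → Marg f zero k ≡ 0ℤ) →
            ∀ (φ : Fin (suc n) → ℤ) → ⟪ f , (λ w → φ (hd w)) ⟫ ≡ 0ℤ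
NoMarg-hd f p φ = trans (⟪⟫-hd f φ) (∑-0 λ k → trans (cong (φ k *_) (p k)) (*-zeroʳ (φ k)))

NoMarg-JF : ∀ {n} (f : Code (suc n) → ℤ) → NoMarg f → ∀ g → ⟪ f , J (F g) ⟫ ≡ 0ℤ
NoMarg-JF {n} f p g = begin
  ⟪ f , J (F g) ⟫
    ≡⟨ ⟪⟫-congʳ f (λ w → trans (J-F g w) (r (+ n) (F g w) (row g zero) (col g (hd w)) (g zero (hd w)))) ⟩
  ⟪ f , (λ w → (+ n - 1ℤ) * F g w + 1ℤ * φ (hd w)) ⟫
    ≡⟨ ⟪⟫-linʳ f (+ n - 1ℤ) 1ℤ (F g) (λ w → φ (hd w)) ⟩
  (+ n - 1ℤ) * ⟪ f , F g ⟫ + 1ℤ * ⟪ f , (λ w → φ (hd w)) ⟫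
    ≡⟨ cong₂ (λ x y → (+ n - 1ℤ) * x + 1ℤ * y) (NoMarg-F f p g) (NoMarg-hd f (p zero) φ) ⟩
  (+ n - 1ℤ) * 0ℤ + 1ℤ * 0ℤ
    ≡⟨ r′ (+ n - 1ℤ) ⟩
  0ℤ ∎
  where
  open ≡-Reasoning
  φ : Fin (suc n) → ℤ
  φ k = row g zero + col g k - (+ n + 1ℤ) * g zero k
  r : ∀ n f a b h → (n - 1ℤ) * f + a + b - (n + 1ℤ) * h ≡ (n - 1ℤ) * f + 1ℤ * (a + b - (n + 1ℤ) * h)
  r = solve-∀
  r′ : ∀ a → a * 0ℤ + 1ℤ * 0ℤ ≡ 0ℤ
  r′ = solve-∀

-- `J` is self-adjoint and preserves degree one, hence also the orthogonal complement. The marginal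
-- at `j`, `k` is written as the pairing with `F` of an elementary matrix.
NoMarg-J : ∀ {n} (f : Code (suc n) → ℤ) → NoMarg f → NoMarg (J f)
NoMarg-J f p j k = begin
  Marg (J f) j k                                              ≡⟨ ∑-δ k (Marg (J f) j) ⟨
  ∑ (λ l → δ k l * Marg (J f) j l)                            ≡⟨ ∑-δ j (λ i → ∑ (λ l → δ k l * Marg (J f) i l)) ⟨
  ∑ (λ i → δ j i * ∑ (λ l → δ k l * Marg (J f) i l))
    ≡⟨ ∑-cong (λ i → trans (sym (∑-* (δ j i) _)) (∑-cong λ l → sym (*-assoc (δ j i) (δ k l) (Marg (J f) i l)))) ⟩
  ∑ (λ i → ∑ (λ l → δ j i * δ k l * Marg (J f) i l))          ≡⟨ ⟪⟫-F (J f) (λ i l → δ j i * δ k l) ⟨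
  ⟪ J f , F (λ i l → δ j i * δ k l) ⟫                         ≡⟨ J-adj f (F (λ i l → δ j i * δ k l)) ⟨
  ⟪ f , J (F (λ i l → δ j i * δ k l)) ⟫                       ≡⟨ NoMarg-JF f p (λ i l → δ j i * δ k l) ⟩
  0ℤ                                                          ∎
  where open ≡-Reasoning

-- The functions of the first value alone also form an invariant subspace of `J`. This is the part
-- of orthogonality that the induction on tails can use.
Marg₀-J : ∀ {n} (f : Code (suc n) → ℤ) → ∑ₚ f ≡ 0ℤ → (∀ k → Marg f zero k ≡ 0ℤ) → ∀ k → Marg (J f) zero k ≡ 0ℤ
Marg₀-J f s p k = begin
  Marg (J f) zero k                                 ≡⟨ ∑-δ k (Marg (J f) zero) ⟨
  ∑ (λ l → δ k l * Marg (J f) zero l)               ≡⟨ ⟪⟫-hd (J f) (δ k) ⟨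
  ⟪ J f , (λ w → δ k (hd w)) ⟫                      ≡⟨ J-adj f (λ w → δ k (hd w)) ⟨
  ⟪ f , J (λ w → δ k (hd w)) ⟫                      ≡⟨ ⟪⟫-congʳ f (λ w → trans (J-hd (δ k) w) (r (∑ (δ k)) (δ k (hd w)))) ⟩
  ⟪ f , (λ w → ∑ (δ k) * 1ℤ + - 1ℤ * δ k (hd w)) ⟫  ≡⟨ ⟪⟫-linʳ f (∑ (δ k)) (- 1ℤ) (λ _ → 1ℤ) (λ w → δ k (hd w)) ⟩
  ∑ (δ k) * ⟪ f , (λ _ → 1ℤ) ⟫ + - 1ℤ * ⟪ f , (λ w → δ k (hd w)) ⟫
    ≡⟨ cong₂ (λ x y → ∑ (δ k) * x + - 1ℤ * y) (trans (∑ₚ-cong λ w → *-identityʳ (f w)) s) (NoMarg-hd f p (δ k)) ⟩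
  ∑ (δ k) * 0ℤ + - 1ℤ * 0ℤ                          ≡⟨ r′ (∑ (δ k)) ⟩
  0ℤ                                                ∎
  where
  open ≡-Reasoning
  r : ∀ a b → a - b ≡ a * 1ℤ + - 1ℤ * b
  r = solve-∀
  r′ : ∀ a → a * 0ℤ + - 1ℤ * 0ℤ ≡ 0ℤ
  r′ = solve-∀

-- The spectral gap of J

Gap : ℕ → Set
Gap n = (f : Code (suc (suc n)) → ℤ) → ∑ₚ f ≡ 0ℤ → 0ℤ ≤ + n * ⟪ f , f ⟫ - ⟪ f , J f ⟫

-- Removing a position j ≠ 0 leaves a star with one ray less; averaging over j
-- recovers J, and each restriction of f has sum 0.
gap-NoMarg : ∀ {n} → Gap n → (f : Code (suc (suc (suc n))) → ℤ) → NoMarg f →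
             0ℤ ≤ + n * + suc (suc n) * ⟪ f , f ⟫ - + suc n * ⟪ f , J f ⟫
gap-NoMarg {n} G f p = subst (0ℤ ≤_) total
  (∑-0≤ λ j → ∑-0≤ λ k → G (restr j k) (p (suc j) k))
  where
  open ≡-Reasoning
  restr : Fin (suc (suc n)) → Fin (suc (suc (suc n))) → Code (suc (suc n)) → ℤ
  restr j k u = f (ins (suc j) k u)
  T : Fin (suc (suc n)) → ℤ
  T i = ∑ₚ λ w → f w * f (swap i w)
  ⟪fJf⟫ : ⟪ f , J f ⟫ ≡ ∑ T
  ⟪fJf⟫ = trans (∑ₚ-cong λ w → sym (∑-* (f w) _)) (∑ₚ-∑-comm _)
  restr-J : ∀ j → ∑ (λ k → ⟪ restr j k , J (restr j k) ⟫) ≡ ∑ T - T j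
  restr-J j = begin
    ∑ (λ k → ⟪ restr j k , J (restr j k) ⟫)
      ≡⟨ ∑-cong (λ k → trans (∑ₚ-cong λ u → sym (∑-* (restr j k u) _)) (∑ₚ-∑-comm _)) ⟩
    ∑ (λ k → ∑ (λ i → ∑ₚ (λ u → restr j k u * restr j k (swap i u))))
      ≡⟨ ∑-∑-comm _ ⟩
    ∑ (λ i → ∑ (λ k → ∑ₚ (λ u → restr j k u * restr j k (swap i u))))
      ≡⟨ ∑-cong (λ i → ∑-cong λ k → ∑ₚ-cong λ u → cong (λ v → restr j k u * f v) (sym (swap-ins j k i u))) ⟩
    ∑ (λ i → ∑ (λ k → ∑ₚ (λ u → f (ins (suc j) k u) * f (swap (punchIn j i) (ins (suc j) k u)))))
      ≡⟨ ∑-cong (λ i → sym (∑ₚ-ins (suc j) (λ w → f w * f (swap (punchIn j i) w)))) ⟩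
    ∑ (λ i → T (punchIn j i))
      ≡⟨ r (T j) _ ⟩
    T j + ∑ (λ i → T (punchIn j i)) - T j
      ≡⟨ cong (_- T j) (sym (∑-punchIn j T)) ⟩
    ∑ T - T j ∎
    where
    r : ∀ a b → b ≡ a + b - a
    r = solve-∀
  -- Each of the `n + 2` positions contributes the whole norm, while every transposition is lost for
  -- exactly one of them and counted `n + 1` times.
  total : ∑ (λ j → ∑ (λ k → + n * ⟪ restr j k , restr j k ⟫ - ⟪ restr j k , J (restr j k) ⟫))
          ≡ + n * + suc (suc n) * ⟪ f , f ⟫ - + suc n * ⟪ f , J f ⟫
  total = begin
    ∑ (λ j → ∑ (λ k → + n * ⟪ restr j k , restr j k ⟫ - ⟪ restr j k , J (restr j k) ⟫))
      ≡⟨ ∑-cong (λ j → trans (∑-- _ _) (cong₂ _-_ (trans (∑-* (+ n) _) (cong (+ n *_) (sym (∑ₚ-ins (suc j) (λ w → f w * f w))))) (restr-J j))) ⟩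
    ∑ (λ j → + n * ⟪ f , f ⟫ - (∑ T - T j))
      ≡⟨ ∑-cong (λ j → r₁ (+ n * ⟪ f , f ⟫) (∑ T) (T j)) ⟩
    ∑ (λ j → (+ n * ⟪ f , f ⟫ - ∑ T) + T j)
      ≡⟨ ∑-+ (λ _ → + n * ⟪ f , f ⟫ - ∑ T) T ⟩
    ∑ {suc (suc n)} (λ j → + n * ⟪ f , f ⟫ - ∑ T) + ∑ T
      ≡⟨ cong (_+ ∑ T) (∑-const (suc (suc n)) (+ n * ⟪ f , f ⟫ - ∑ T)) ⟩
    + suc (suc n) * (+ n * ⟪ f , f ⟫ - ∑ T) + ∑ T
      ≡⟨ r₂ (+ n) ⟪ f , f ⟫ (∑ T) ⟩
    + n * + suc (suc n) * ⟪ f , f ⟫ - + suc n * ∑ T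
      ≡⟨ cong (λ t → + n * + suc (suc n) * ⟪ f , f ⟫ - + suc n * t) (sym ⟪fJf⟫) ⟩
    + n * + suc (suc n) * ⟪ f , f ⟫ - + suc n * ⟪ f , J f ⟫ ∎
    where
    r₁ : ∀ a b c → a - (b - c) ≡ (a - b) + c
    r₁ = solve-∀
    r₂ : ∀ n x t → (1ℤ + (1ℤ + n)) * (n * x - t) + t ≡ n * (1ℤ + (1ℤ + n)) * x - (1ℤ + n) * t
    r₂ = solve-∀

0<-* : ∀ {x y} → 0ℤ < x → 0ℤ < y → 0ℤ < x * y
0<-* {+ suc m} {+ suc n} (+<+ _) (+<+ _) = +<+ (ℕ.s≤s ℕ.z≤n)

-- f is split into its projection onto the functions of degree one, F (Marg f) / N,
-- on which J is explicit, and a remainder without marginals.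
gap : ∀ n → Gap n
-- On two points a function of sum 0 has the values `a` and `− a`, and `J` negates it.
gap zero f s = subst (0ℤ ≤_) (sym e) (0≤-* (0≤+ 2) (0≤² a))
  where
  open ≡-Reasoning
  a b : ℤ
  a = f (zero ∷ zero ∷ [])
  b = f (suc zero ∷ zero ∷ [])
  two : (h : Fin 2 → ℤ) → ∑ h ≡ h zero + h (suc zero)
  two h = trans (∑-suc h) (+-congˡ (h zero) (trans (∑-suc _) (trans (+-congˡ (h (suc zero)) (∑-zero _)) (+-identityʳ _))))
  one : (h : Fin 1 → ℤ) → ∑ h ≡ h zero
  one h = trans (∑-suc _) (trans (+-congˡ (h zero) (∑-zero _)) (+-identityʳ _))
  all₂ : (h : Code 2 → ℤ) → ∑ₚ h ≡ h (zero ∷ zero ∷ []) + h (suc zero ∷ zero ∷ [])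
  all₂ h = trans (∑ₚ-∷ h) (trans (two _) (cong₂ _+_ (all₁ (λ u → h (zero ∷ u))) (all₁ (λ u → h (suc zero ∷ u)))))
    where
    all₁ : (h : Code 1 → ℤ) → ∑ₚ h ≡ h (zero ∷ [])
    all₁ h = trans (∑ₚ-∷ h) (trans (one _) (∑ₚ-[] _))
  b≡-a : b ≡ - a
  b≡-a = trans (r a b) (trans (cong (_- a) (trans (sym (all₂ f)) s)) (+-identityˡ (- a)))
    where
    r : ∀ a b → b ≡ (a + b) - a
    r = solve-∀
  e : 0ℤ * ⟪ f , f ⟫ - ⟪ f , J f ⟫ ≡ + 2 * (a * a)
  e = begin
    0ℤ * ⟪ f , f ⟫ - ⟪ f , J f ⟫     ≡⟨ cong (λ t → 0ℤ * ⟪ f , f ⟫ - t) (all₂ (λ w → f w * J f w)) ⟩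
    0ℤ * ⟪ f , f ⟫ - (a * J f (zero ∷ zero ∷ []) + b * J f (suc zero ∷ zero ∷ []))
      ≡⟨ cong₂ (λ x y → 0ℤ * ⟪ f , f ⟫ - (a * x + b * y)) (one _) (one _) ⟩
    0ℤ * ⟪ f , f ⟫ - (a * b + b * a) ≡⟨ cong (λ b → 0ℤ * ⟪ f , f ⟫ - (a * b + b * a)) b≡-a ⟩
    0ℤ * ⟪ f , f ⟫ - (a * - a + - a * a) ≡⟨ r ⟪ f , f ⟫ a ⟩
    + 2 * (a * a) ∎
    where
    r : ∀ x a → 0ℤ * x - (a * - a + - a * a) ≡ + 2 * (a * a)
    r = solve-∀
gap (suc n) f s = 0≤-cancel (0<-* 0<N 0<N) (subst (0ℤ ≤_) (sym split) (0≤-+ remainder (0≤-* (0≤+ (3 ℕ.+ n)) (0≤-* (<⇒≤ 0<N) (∑-0≤ λ k → 0≤² (M zero k))))))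
  where
  open ≡-Reasoning
  m = fac (suc n)
  -- For sum 0, applying `F` to the marginals and taking marginals again multiplies them by `N`. So
  -- `N f − F M` loses all marginals without a division.
  N = (+ n + + 3) * m
  0<N : 0ℤ < N
  0<N = subst (λ t → 0ℤ < t * m) (+-comm (+ 3) (+ n)) (0<-* {+ 3 + + n} (+<+ (ℕ.s≤s ℕ.z≤n)) (0<fac (suc n)))
  M : Mat (suc (suc (suc n)))
  M = Marg f
  f′ : Code (suc (suc (suc n))) → ℤ
  f′ w = N * f w + - 1ℤ * F M w
  row≡0 : ∀ j → row M j ≡ 0ℤ
  row≡0 j = trans (row-Marg f j) s
  col≡0 : ∀ k → col M k ≡ 0ℤ
  col≡0 k = trans (col-Marg f k) s
  Marg-FM : ∀ j k → Marg (F M) j k ≡ N * M j k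
  Marg-FM j k = begin
    Marg (F M) j k
      ≡⟨ Marg-F M j k ⟩
    m * (tot M - row M j - col M k + (+ suc n + + 2) * M j k)
      ≡⟨ cong (λ t → m * (t + (+ suc n + + 2) * M j k)) (cong₂ _-_ (cong₂ _-_ (∑-0 row≡0) (row≡0 j)) (col≡0 k)) ⟩
    m * (0ℤ - 0ℤ - 0ℤ + (+ suc n + + 2) * M j k)
      ≡⟨ r m (+ n) (M j k) ⟩
    N * M j k ∎
    where
    r : ∀ m n x → m * (0ℤ - 0ℤ - 0ℤ + (1ℤ + n + + 2) * x) ≡ (n + + 3) * m * x
    r = solve-∀
  p′ : NoMarg f′
  p′ j k = trans (Marg-lin N (- 1ℤ) f (F M) j k) (trans (cong (λ t → N * M j k + - 1ℤ * t) (Marg-FM j k)) (r (N * M j k)))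
    where
    r : ∀ x → x + - 1ℤ * x ≡ 0ℤ
    r = solve-∀
  X = ⟪ f′ , f′ ⟫
  Y = ⟪ F M , F M ⟫
  Z = ∑ λ k → M zero k * M zero k
  q′ = ⟪ f′ , J f′ ⟫
  remainder : 0ℤ ≤ + suc n * X - q′
  -- Since n (n + 2) = (n + 1)² - 1, adding one copy of the norm of `f′` yields a multiple of the
  -- desired bound.
  remainder = 0≤-cancel {+ suc n} (+<+ (ℕ.s≤s ℕ.z≤n)) (subst (0ℤ ≤_) (r (+ n) X q′) (0≤-+ (gap-NoMarg (gap n) f′ p′) (0≤⟪⟫ f′)))
    where
    r : ∀ n x q → (n * (1ℤ + (1ℤ + n)) * x - (1ℤ + n) * q) + x ≡ (1ℤ + n) * ((1ℤ + n) * x - q)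
    r = solve-∀
  Nf : ∀ w → N * f w ≡ 1ℤ * f′ w + 1ℤ * F M w
  Nf w = r (N * f w) (F M w)
    where
    r : ∀ x y → x ≡ 1ℤ * (x + - 1ℤ * y) + 1ℤ * y
    r = solve-∀
  JNf : ∀ w → N * J f w ≡ 1ℤ * J f′ w + 1ℤ * J (F M) w
  JNf w = trans (sym (∑-* N _)) (trans (J-cong Nf w) (J-lin 1ℤ 1ℤ f′ (F M) w))
  F⊥ : ⟪ f′ , F M ⟫ ≡ 0ℤ
  F⊥ = NoMarg-F f′ p′ M
  norm : N * N * ⟪ f , f ⟫ ≡ X + Y
  norm = begin
    N * N * ⟪ f , f ⟫                                             ≡⟨ ⟪⟫-scale N f f ⟨
    ⟪ (λ w → N * f w) , (λ w → N * f w) ⟫                         ≡⟨ ∑ₚ-cong (λ w → cong₂ _*_ (Nf w) (Nf w)) ⟩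
    ⟪ (λ w → 1ℤ * f′ w + 1ℤ * F M w) , (λ w → 1ℤ * f′ w + 1ℤ * F M w) ⟫
      ≡⟨ ⟪⟫-lin² 1ℤ 1ℤ 1ℤ 1ℤ f′ (F M) f′ (F M) ⟩
    1ℤ * X + 1ℤ * ⟪ f′ , F M ⟫ + 1ℤ * ⟪ F M , f′ ⟫ + 1ℤ * Y
      ≡⟨ cong₂ (λ x y → 1ℤ * X + 1ℤ * x + 1ℤ * y + 1ℤ * Y) F⊥ (trans (⟪⟫-sym (F M) f′) F⊥) ⟩
    1ℤ * X + 1ℤ * 0ℤ + 1ℤ * 0ℤ + 1ℤ * Y                           ≡⟨ r X Y ⟩
    X + Y                                                         ∎
    where
    r : ∀ x y → 1ℤ * x + 1ℤ * 0ℤ + 1ℤ * 0ℤ + 1ℤ * y ≡ x + y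
    r = solve-∀
  JF⊥ : ⟪ f′ , J (F M) ⟫ ≡ 0ℤ
  JF⊥ = NoMarg-JF f′ p′ M
  -- With zero row and column sums, `J` on `F M` is `n + 1` minus a term in the first value, whose
  -- pairing with `F M` is the nonnegative `N * Z`.
  qF : ⟪ F M , J (F M) ⟫ ≡ + suc n * Y - + (3 ℕ.+ n) * (N * Z)
  qF = begin
    ⟪ F M , J (F M) ⟫
      ≡⟨ ⟪⟫-congʳ (F M) (λ w → trans (J-F M w) (trans (cong₂ (λ x y → (+ suc (suc n) - 1ℤ) * F M w + x + y - (+ suc (suc n) + 1ℤ) * M zero (hd w)) (row≡0 zero) (col≡0 (hd w)))
           (r (+ n) (F M w) (M zero (hd w))))) ⟩
    ⟪ F M , (λ w → + suc n * F M w + - + (3 ℕ.+ n) * M zero (hd w)) ⟫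
      ≡⟨ ⟪⟫-linʳ (F M) (+ suc n) (- + (3 ℕ.+ n)) (F M) (λ w → M zero (hd w)) ⟩
    + suc n * Y + - + (3 ℕ.+ n) * ⟪ F M , (λ w → M zero (hd w)) ⟫
      ≡⟨ cong (λ t → + suc n * Y + - + (3 ℕ.+ n) * t) (trans (⟪⟫-hd (F M) (M zero)) (trans (∑-cong λ k → trans (cong (M zero k *_) (Marg-FM zero k)) (r₂ N (M zero k))) (∑-* N _))) ⟩
    + suc n * Y + - + (3 ℕ.+ n) * (N * Z)
      ≡⟨ r₃ (+ suc n * Y) (+ (3 ℕ.+ n)) (N * Z) ⟩
    + suc n * Y - + (3 ℕ.+ n) * (N * Z) ∎
    where
    r : ∀ n f h → (1ℤ + (1ℤ + n) - 1ℤ) * f + 0ℤ + 0ℤ - (1ℤ + (1ℤ + n) + 1ℤ) * h ≡ (1ℤ + n) * f + - (+ 3 + n) * h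
    r = solve-∀
    r₂ : ∀ N x → x * (N * x) ≡ N * (x * x)
    r₂ = solve-∀
    r₃ : ∀ a b c → a + - b * c ≡ a - b * c
    r₃ = solve-∀
  form : N * N * ⟪ f , J f ⟫ ≡ q′ + (+ suc n * Y - + (3 ℕ.+ n) * (N * Z))
  form = begin
    N * N * ⟪ f , J f ⟫                                           ≡⟨ ⟪⟫-scale N f (J f) ⟨
    ⟪ (λ w → N * f w) , (λ w → N * J f w) ⟫                       ≡⟨ ∑ₚ-cong (λ w → cong₂ _*_ (Nf w) (JNf w)) ⟩
    ⟪ (λ w → 1ℤ * f′ w + 1ℤ * F M w) , (λ w → 1ℤ * J f′ w + 1ℤ * J (F M) w) ⟫
      ≡⟨ ⟪⟫-lin² 1ℤ 1ℤ 1ℤ 1ℤ f′ (F M) (J f′) (J (F M)) ⟩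
    1ℤ * q′ + 1ℤ * ⟪ f′ , J (F M) ⟫ + 1ℤ * ⟪ F M , J f′ ⟫ + 1ℤ * ⟪ F M , J (F M) ⟫
      ≡⟨ cong₂ (λ x y → 1ℤ * q′ + 1ℤ * x + 1ℤ * y + 1ℤ * ⟪ F M , J (F M) ⟫) JF⊥ (trans (J-adj (F M) f′) (trans (⟪⟫-sym (J (F M)) f′) JF⊥)) ⟩
    1ℤ * q′ + 1ℤ * 0ℤ + 1ℤ * 0ℤ + 1ℤ * ⟪ F M , J (F M) ⟫
      ≡⟨ cong (λ t → 1ℤ * q′ + 1ℤ * 0ℤ + 1ℤ * 0ℤ + 1ℤ * t) qF ⟩
    1ℤ * q′ + 1ℤ * 0ℤ + 1ℤ * 0ℤ + 1ℤ * (+ suc n * Y - + (3 ℕ.+ n) * (N * Z))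
      ≡⟨ r q′ (+ suc n * Y - + (3 ℕ.+ n) * (N * Z)) ⟩
    q′ + (+ suc n * Y - + (3 ℕ.+ n) * (N * Z)) ∎
    where
    r : ∀ x y → 1ℤ * x + 1ℤ * 0ℤ + 1ℤ * 0ℤ + 1ℤ * y ≡ x + y
    r = solve-∀
  split : N * N * (+ suc n * ⟪ f , f ⟫ - ⟪ f , J f ⟫) ≡ (+ suc n * X - q′) + + (3 ℕ.+ n) * (N * Z)
  split = begin
    N * N * (+ suc n * ⟪ f , f ⟫ - ⟪ f , J f ⟫)
      ≡⟨ r (N * N) (+ suc n) ⟪ f , f ⟫ ⟪ f , J f ⟫ ⟩
    + suc n * (N * N * ⟪ f , f ⟫) - N * N * ⟪ f , J f ⟫
      ≡⟨ cong₂ (λ x y → + suc n * x - y) norm form ⟩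
    + suc n * (X + Y) - (q′ + (+ suc n * Y - + (3 ℕ.+ n) * (N * Z)))
      ≡⟨ r₂ (+ suc n) X Y q′ (+ (3 ℕ.+ n) * (N * Z)) ⟩
    (+ suc n * X - q′) + + (3 ℕ.+ n) * (N * Z) ∎
    where
    r : ∀ N a x y → N * (a * x - y) ≡ a * (N * x) - N * y
    r = solve-∀
    r₂ : ∀ a x y q z → a * (x + y) - (q + (a * y - z)) ≡ (a * x - q) + z
    r₂ = solve-∀

-- Functions supported on the permutations of one sign `η`

record Pure {n} (η : ℤ) (f : Code n → ℤ) : Set where
  constructor pure
  field
    eqn : ∀ w → sgn w * f w ≡ η * f w

open Pure

Pure-lin : ∀ {n η} a b {f g : Code n → ℤ} → Pure η f → Pure η g → Pure η (λ w → a * f w + b * g w)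
Pure-lin {η = η} a b {f} {g} p q = pure λ w → begin
  sgn w * (a * f w + b * g w)                ≡⟨ r (sgn w) a b (f w) (g w) ⟩
  a * (sgn w * f w) + b * (sgn w * g w)      ≡⟨ cong₂ (λ x y → a * x + b * y) (eqn p w) (eqn q w) ⟩
  a * (η * f w) + b * (η * g w)              ≡⟨ r η a b (f w) (g w) ⟨
  η * (a * f w + b * g w)                    ∎
  where
  open ≡-Reasoning
  r : ∀ s a b x y → s * (a * x + b * y) ≡ a * (s * x) + b * (s * y)
  r = solve-∀

Pure-J : ∀ {n η} {f : Code (suc n) → ℤ} → Pure η f → Pure (- η) (J f)
Pure-J {η = η} {f} p = pure λ w → begin
  sgn w * J f w                       ≡⟨ neg-involutive (sgn w * J f w) ⟨
  - - (sgn w * J f w)                 ≡⟨ cong -_ (J-sgn f w) ⟨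
  - J (λ w → sgn w * f w) w           ≡⟨ cong -_ (trans (J-cong (eqn p) w) (∑-* η _)) ⟩
  - (η * J f w)                       ≡⟨ neg-distribˡ-* η (J f w) ⟩
  - η * J f w                         ∎
  where open ≡-Reasoning

Pure-A : ∀ {n η} {f : Code (suc n) → ℤ} → Pure η f → Pure (altSign n * η) (A f)
Pure-A {n} {η} {f} p = pure λ w → begin
  sgn w * A f w                                    ≡⟨ *-identityˡ (sgn w * A f w) ⟨
  1ℤ * (sgn w * A f w)                             ≡⟨ cong (_* (sgn w * A f w)) (sym (altSign² n)) ⟩
  altSign n * altSign n * (sgn w * A f w)          ≡⟨ *-assoc (altSign n) (altSign n) (sgn w * A f w) ⟩
  altSign n * (altSign n * (sgn w * A f w))        ≡⟨ cong (altSign n *_) (A-sgn f w) ⟨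
  altSign n * A (λ w → sgn w * f w) w              ≡⟨ cong (altSign n *_) (trans (A-cong (eqn p) w) (A-* η f w)) ⟩
  altSign n * (η * A f w)                          ≡⟨ *-assoc (altSign n) η (A f w) ⟨
  altSign n * η * A f w                            ∎
  where open ≡-Reasoning

Pure-⊥ : ∀ {n η} {f g : Code n → ℤ} → η * η ≡ 1ℤ → Pure η f → Pure (- η) g → ⟪ f , g ⟫ ≡ 0ℤ
Pure-⊥ {η = η} {f} {g} η² p q = ∑ₚ-0 λ w → i≡-i⇒i≡0 (begin
  f w * g w                          ≡⟨ *-identityˡ (f w * g w) ⟨
  1ℤ * (f w * g w)                   ≡⟨ cong (_* (f w * g w)) (sym (sgn² w)) ⟩
  sgn w * sgn w * (f w * g w)        ≡⟨ r (sgn w) (sgn w) (f w) (g w) ⟩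
  (sgn w * f w) * (sgn w * g w)      ≡⟨ cong₂ _*_ (eqn p w) (eqn q w) ⟩
  (η * f w) * (- η * g w)            ≡⟨ r′ η (f w) (g w) ⟩
  - (η * η * (f w * g w))            ≡⟨ cong (λ t → - (t * (f w * g w))) η² ⟩
  - (1ℤ * (f w * g w))               ≡⟨ cong -_ (*-identityˡ (f w * g w)) ⟩
  - (f w * g w)                      ∎)
  where
  open ≡-Reasoning
  r : ∀ a b x y → a * b * (x * y) ≡ (a * x) * (b * y)
  r = solve-∀
  r′ : ∀ a x y → (a * x) * (- a * y) ≡ - (a * a * (x * y))
  r′ = solve-∀

-- For f of one sign, f ⟂ J f, so a one-sided bound for J at α f + β J f bounds |J f|.
J-norm : ∀ {n η} (f : Code (suc n) → ℤ) α β → η * η ≡ 1ℤ → Pure η f → 0ℤ < α →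
         (let h = λ w → α * f w + β * J f w in 0ℤ ≤ α * ⟪ h , h ⟫ - β * ⟪ h , J h ⟫) →
         0ℤ ≤ α * α * ⟪ f , f ⟫ - β * β * ⟪ J f , J f ⟫
J-norm {η = η} f α β η² p 0<α ineq = 0≤-cancel 0<α (subst (0ℤ ≤_) eq ineq)
  where
  open ≡-Reasoning
  h = λ w → α * f w + β * J f w
  X = ⟪ f , f ⟫
  Y = ⟪ J f , J f ⟫
  fJ : ⟪ f , J f ⟫ ≡ 0ℤ
  fJ = Pure-⊥ η² p (Pure-J p)
  JJ : ⟪ J f , J (J f) ⟫ ≡ 0ℤ
  JJ = Pure-⊥ (trans (r η) η²) (Pure-J p) (Pure-J (Pure-J p))
    where
    r : ∀ x → - x * - x ≡ x * x
    r = solve-∀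
  hh : ⟪ h , h ⟫ ≡ α * α * X + α * β * 0ℤ + β * α * 0ℤ + β * β * Y
  hh = trans (⟪⟫-lin² α β α β f (J f) f (J f))
    (cong₂ (λ x y → α * α * X + α * β * x + β * α * y + β * β * Y) fJ (trans (⟪⟫-sym (J f) f) fJ))
  -- `f` and `J (J f)` live on one parity and `J f` on the other, so only the cross terms remain,
  -- and both inner products in them are `Y`.
  hJ : ⟪ h , J h ⟫ ≡ α * α * 0ℤ + α * β * Y + β * α * Y + β * β * 0ℤ
  hJ = begin
    ⟪ h , J h ⟫                                      ≡⟨ ⟪⟫-congʳ h (J-lin α β f (J f)) ⟩
    ⟪ h , (λ w → α * J f w + β * J (J f) w) ⟫        ≡⟨ ⟪⟫-lin² α β α β f (J f) (J f) (J (J f)) ⟩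
    α * α * ⟪ f , J f ⟫ + α * β * ⟪ f , J (J f) ⟫ + β * α * Y + β * β * ⟪ J f , J (J f) ⟫
      ≡⟨ cong₂ (λ x y → α * α * x + α * β * ⟪ f , J (J f) ⟫ + β * α * Y + β * β * y) fJ JJ ⟩
    α * α * 0ℤ + α * β * ⟪ f , J (J f) ⟫ + β * α * Y + β * β * 0ℤ
      ≡⟨ cong (λ x → α * α * 0ℤ + α * β * x + β * α * Y + β * β * 0ℤ) (J-adj f (J f)) ⟩
    α * α * 0ℤ + α * β * Y + β * α * Y + β * β * 0ℤ ∎
  eq : α * ⟪ h , h ⟫ - β * ⟪ h , J h ⟫ ≡ α * (α * α * X - β * β * Y)
  eq = trans (cong₂ (λ x y → α * x - β * y) hh hJ) (r α β X Y)
    where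
    r : ∀ α β X Y → α * (α * α * X + α * β * 0ℤ + β * α * 0ℤ + β * β * Y) - β * (α * α * 0ℤ + α * β * Y + β * α * Y + β * β * 0ℤ)
        ≡ α * (α * α * X - β * β * Y)
    r = solve-∀

J-norm-sum : ∀ {n η} (f : Code (suc (suc (suc n))) → ℤ) → η * η ≡ 1ℤ → Pure η f → ∑ₚ f ≡ 0ℤ →
             0ℤ ≤ + suc n * + suc n * ⟪ f , f ⟫ - ⟪ J f , J f ⟫
J-norm-sum {n} f η² p s = subst (λ t → 0ℤ ≤ + suc n * + suc n * ⟪ f , f ⟫ - t) (*-identityˡ ⟪ J f , J f ⟫)
  (J-norm f (+ suc n) 1ℤ η² p (+<+ (ℕ.s≤s ℕ.z≤n))
    (subst (λ t → 0ℤ ≤ + suc n * ⟪ h , h ⟫ - t) (sym (*-identityˡ ⟪ h , J h ⟫)) (gap (suc n) h ∑h)))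
  where
  h = λ w → + suc n * f w + 1ℤ * J f w
  ∑h : ∑ₚ h ≡ 0ℤ
  ∑h = trans (∑ₚ-lin (+ suc n) 1ℤ f (J f)) (trans (cong₂ (λ x y → + suc n * x + 1ℤ * y) s (trans (∑ₚ-J f) (cong (+ suc (suc n) *_) s))) (r (+ suc n) (+ suc (suc n))))
    where
    r : ∀ a b → a * 0ℤ + 1ℤ * (b * 0ℤ) ≡ 0ℤ
    r = solve-∀

-- The quotient α / β from `gap-NoMarg` lies strictly below the bound `n + 2` of `J-norm-sum` on as
-- many points, because α = β² - 1. All strictness in the case of equality comes from here.
J-norm-NoMarg : ∀ {n η} (f : Code (suc (suc (suc (suc n)))) → ℤ) → η * η ≡ 1ℤ → Pure η f → NoMarg f →
                (let α = + suc n * + (3 ℕ.+ n) ; β = + (2 ℕ.+ n) in 0ℤ ≤ α * α * ⟪ f , f ⟫ - β * β * ⟪ J f , J f ⟫)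
J-norm-NoMarg {n} f η² p q = J-norm f α β η² p (+<+ (ℕ.s≤s ℕ.z≤n)) (gap-NoMarg (gap (suc n)) h noMarg)
  where
  α = + suc n * + (3 ℕ.+ n)
  β = + (2 ℕ.+ n)
  h = λ w → α * f w + β * J f w
  noMarg : NoMarg h
  noMarg j k = trans (Marg-lin α β f (J f) j k) (trans (cong₂ (λ x y → α * x + β * y) (q j k) (NoMarg-J f q j k)) (r α β))
    where
    r : ∀ a b → a * 0ℤ + b * 0ℤ ≡ 0ℤ
    r = solve-∀

-- The norm of A

ANorm : ℕ → Set
ANorm n = ∀ {η} (f : Code (suc (suc n)) → ℤ) → η * η ≡ 1ℤ → Pure η f → ∑ₚ f ≡ 0ℤ →
          0ℤ ≤ fac n * fac n * ⟪ f , f ⟫ - ⟪ A f , A f ⟫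

-- The tails of `J f` live on one parity each and have sum 0, as `J` keeps the first marginals zero.
-- So the bound for one point less applies to each tail, and the squares add up.
A-norm-tails : ∀ {n η} → ANorm n → (f : Code (suc (suc (suc n))) → ℤ) → η * η ≡ 1ℤ → Pure η f →
               (∀ k → Marg f zero k ≡ 0ℤ) →
               0ℤ ≤ fac n * fac n * ⟪ J f , J f ⟫ - ⟪ A f , A f ⟫
A-norm-tails {n} {η} E f η² p q = subst (0ℤ ≤_) eq (∑-0≤ λ k → E {ε k * - η} (tl k) (εη² k) (pureₖ k) (sum0 k))
  where
  open ≡-Reasoning
  m = fac n
  tl : Fin _ → Code (suc (suc n)) → ℤ
  tl k v = J f (k ∷ v)
  εη² : ∀ k → (ε k * - η) * (ε k * - η) ≡ 1ℤ
  εη² k = trans (r (ε k) η) (cong₂ _*_ (ε² k) η²)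
    where
    r : ∀ x y → (x * - y) * (x * - y) ≡ (x * x) * (y * y)
    r = solve-∀
  pureₖ : ∀ k → Pure (ε k * - η) (tl k)
  pureₖ k = pure λ v → begin
    sgn v * tl k v                               ≡⟨ *-identityˡ (sgn v * tl k v) ⟨
    1ℤ * (sgn v * tl k v)                        ≡⟨ cong (_* (sgn v * tl k v)) (sym (ε² k)) ⟩
    ε k * ε k * (sgn v * tl k v)                 ≡⟨ r (ε k) (sgn v) (tl k v) ⟩
    ε k * (ε k * sgn v * tl k v)                 ≡⟨ cong (ε k *_) (eqn (Pure-J p) (k ∷ v)) ⟩
    ε k * (- η * tl k v)                         ≡⟨ *-assoc (ε k) (- η) (tl k v) ⟨
    ε k * - η * tl k v                           ∎
    where
    r : ∀ e s x → e * e * (s * x) ≡ e * (e * s * x)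
    r = solve-∀
  sum0 : ∀ k → ∑ₚ (tl k) ≡ 0ℤ
  sum0 = Marg₀-J f (trans (sym (row-Marg f zero)) (∑-0 q)) q
  eq : ∑ (λ k → m * m * ⟪ tl k , tl k ⟫ - ⟪ A (tl k) , A (tl k) ⟫) ≡ m * m * ⟪ J f , J f ⟫ - ⟪ A f , A f ⟫
  eq = begin
    ∑ (λ k → m * m * ⟪ tl k , tl k ⟫ - ⟪ A (tl k) , A (tl k) ⟫)                  ≡⟨ ∑-- _ _ ⟩
    ∑ (λ k → m * m * ⟪ tl k , tl k ⟫) - ∑ (λ k → ⟪ A (tl k) , A (tl k) ⟫)        ≡⟨ cong₂ _-_ (∑-* (m * m) _) refl ⟩
    m * m * ∑ (λ k → ⟪ tl k , tl k ⟫) - ∑ (λ k → ⟪ A (tl k) , A (tl k) ⟫)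
      ≡⟨ cong₂ (λ x y → m * m * x - y) (sym (∑ₚ-∷ (λ w → J f w * J f w))) (sym (∑ₚ-∷ (λ w → A f w * A f w))) ⟩
    m * m * ⟪ J f , J f ⟫ - ⟪ A f , A f ⟫                                        ∎

-- For `c` = ±1 this is twice the restriction of the function `φ` of the first value to the
-- permutations of sign `c`.
spread : ∀ {n} → ℤ → (Fin (suc n) → ℤ) → Code (suc n) → ℤ
spread c φ w = φ (hd w) * (1ℤ + c * sgn w)

∑ₚ-1+sgn : ∀ n c → ∑ₚ {suc (suc n)} (λ u → 1ℤ + c * sgn u) ≡ fac (suc (suc n))
∑ₚ-1+sgn n c = begin
  ∑ₚ (λ u → 1ℤ + c * sgn u)                     ≡⟨ ∑ₚ-+ (λ _ → 1ℤ) _ ⟩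
  ∑ₚ {suc (suc n)} (λ _ → 1ℤ) + ∑ₚ (λ u → c * sgn u)
    ≡⟨ cong₂ _+_ (trans (∑ₚ-const (suc (suc n)) 1ℤ) (*-identityʳ (fac (suc (suc n))))) (trans (∑ₚ-* c sgn) (trans (cong (c *_) ∑ₚ-sgn) (*-zeroʳ c))) ⟩
  fac (suc (suc n)) + 0ℤ                        ≡⟨ +-identityʳ (fac (suc (suc n))) ⟩
  fac (suc (suc n))                             ∎
  where open ≡-Reasoning

spread-∷ : ∀ {n} c φ k (u : Code n) → spread c φ (k ∷ u) ≡ φ k * (1ℤ + c * ε k * sgn u)
spread-∷ c φ k u = cong (λ t → φ k * (1ℤ + t)) (sym (*-assoc c (ε k) (sgn u)))

Marg-spread : ∀ {n} c (φ : Fin (suc (suc (suc n))) → ℤ) k → Marg (spread c φ) zero k ≡ fac (suc (suc n)) * φ k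
Marg-spread {n} c φ k = begin
  ∑ₚ (λ u → spread c φ (k ∷ u))                  ≡⟨ ∑ₚ-cong (spread-∷ c φ k) ⟩
  ∑ₚ (λ u → φ k * (1ℤ + c * ε k * sgn u))        ≡⟨ ∑ₚ-* (φ k) _ ⟩
  φ k * ∑ₚ (λ u → 1ℤ + c * ε k * sgn u)          ≡⟨ cong (φ k *_) (∑ₚ-1+sgn n (c * ε k)) ⟩
  φ k * fac (suc (suc n))                        ≡⟨ *-comm (φ k) _ ⟩
  fac (suc (suc n)) * φ k                        ∎
  where open ≡-Reasoning

Pure-spread : ∀ {n} c (φ : Fin (suc n) → ℤ) → c * c ≡ 1ℤ → Pure c (spread c φ)
Pure-spread c φ c² = pure λ w → begin
  sgn w * (φ (hd w) * (1ℤ + c * sgn w))                   ≡⟨ r (sgn w) (φ (hd w)) c ⟩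
  φ (hd w) * (sgn w + c * (sgn w * sgn w))                ≡⟨ cong (λ t → φ (hd w) * (sgn w + c * t)) (sgn² w) ⟩
  φ (hd w) * (sgn w + c * 1ℤ)                             ≡⟨ cong (λ t → φ (hd w) * (t + c * 1ℤ)) (sym (*-identityˡ (sgn w))) ⟩
  φ (hd w) * (1ℤ * sgn w + c * 1ℤ)                        ≡⟨ cong (λ t → φ (hd w) * (t * sgn w + c * 1ℤ)) (sym c²) ⟩
  φ (hd w) * (c * c * sgn w + c * 1ℤ)                     ≡⟨ r′ (sgn w) (φ (hd w)) c ⟩
  c * (φ (hd w) * (1ℤ + c * sgn w))                       ∎
  where
  open ≡-Reasoning
  r : ∀ s x c → s * (x * (1ℤ + c * s)) ≡ x * (s + c * (s * s))
  r = solve-∀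
  r′ : ∀ s x c → x * (c * c * s + c * 1ℤ) ≡ c * (x * (1ℤ + c * s))
  r′ = solve-∀

Pure-⟪spread⟫ : ∀ {n} c (f : Code (suc n) → ℤ) φ → c * c ≡ 1ℤ → Pure c f →
                ⟪ f , spread c φ ⟫ ≡ + 2 * ⟪ f , (λ w → φ (hd w)) ⟫
Pure-⟪spread⟫ c f φ c² p = trans (∑ₚ-cong pt) (∑ₚ-* (+ 2) (λ w → f w * φ (hd w)))
  where
  open ≡-Reasoning
  r : ∀ x y c s → x * (y * (1ℤ + c * s)) ≡ y * (x + c * (s * x))
  r = solve-∀
  r′ : ∀ x y c → y * (x + c * (c * x)) ≡ y * (x + c * c * x)
  r′ = solve-∀
  r″ : ∀ x y → y * (x + 1ℤ * x) ≡ + 2 * (x * y)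
  r″ = solve-∀
  pt : ∀ w → f w * spread c φ w ≡ + 2 * (f w * φ (hd w))
  pt w = begin
    f w * (φ (hd w) * (1ℤ + c * sgn w))        ≡⟨ r (f w) (φ (hd w)) c (sgn w) ⟩
    φ (hd w) * (f w + c * (sgn w * f w))       ≡⟨ cong (λ t → φ (hd w) * (f w + c * t)) (eqn p w) ⟩
    φ (hd w) * (f w + c * (c * f w))           ≡⟨ r′ (f w) (φ (hd w)) c ⟩
    φ (hd w) * (f w + c * c * f w)             ≡⟨ cong (λ t → φ (hd w) * (f w + t * f w)) c² ⟩
    φ (hd w) * (f w + 1ℤ * f w)                ≡⟨ r″ (f w) (φ (hd w)) ⟩
    + 2 * (f w * φ (hd w))                     ∎

spread-norm : ∀ {n} c (φ : Fin (suc (suc (suc n))) → ℤ) → c * c ≡ 1ℤ →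
              ⟪ spread c φ , spread c φ ⟫ ≡ + 2 * (fac (suc (suc n)) * ∑ (λ k → φ k * φ k))
spread-norm {n} c φ c² = trans (Pure-⟪spread⟫ c (spread c φ) φ c² (Pure-spread c φ c²)) (cong (+ 2 *_)
  (trans (⟪⟫-hd (spread c φ) φ) (trans (∑-cong λ k → trans (cong (φ k *_) (Marg-spread c φ k)) (r (φ k) (fac (suc (suc n))))) (∑-* (fac (suc (suc n))) _))))
  where
  r : ∀ x t → x * (t * x) ≡ t * (x * x)
  r = solve-∀

-- As `φ` has sum 0, `J` negates it and flips the sign `c`. On each tail a combination of 1 and
-- `sgn` is left, and `A` of the tail is known on both. These functions attain the bound of `ANorm`.
A-spread : ∀ {n} c (φ : Fin (suc (suc (suc n))) → ℤ) → ∑ φ ≡ 0ℤ → ∀ w →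
           A (spread c φ) w ≡ - fac (suc n) * spread (altSign (suc (suc n)) * c) φ w
A-spread {n} c φ s (k ∷ u) = begin
  A (λ v → J (spread c φ) (k ∷ v)) u
    ≡⟨ A-cong (λ v → trans (J-spread (k ∷ v)) (r₁ (φ k) c (ε k) (sgn v))) u ⟩
  A (λ v → - φ k * 1ℤ + φ k * c * ε k * (sgn v * 1ℤ)) u
    ≡⟨ A-lin (- φ k) (φ k * c * ε k) (λ _ → 1ℤ) (λ v → sgn v * 1ℤ) u ⟩
  - φ k * A (λ _ → 1ℤ) u + φ k * c * ε k * A (λ v → sgn v * 1ℤ) u
    ≡⟨ cong₂ (λ x y → - φ k * x + φ k * c * ε k * y) (A-const 1ℤ u) (trans (A-sgn (λ _ → 1ℤ) u) (cong (λ t → altSign (suc n) * (sgn u * t)) (A-const 1ℤ u))) ⟩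
  - φ k * (m * 1ℤ) + φ k * c * ε k * (altSign (suc n) * (sgn u * (m * 1ℤ)))
    ≡⟨ r₂ (φ k) m c (ε k) (altSign (suc n)) (sgn u) ⟩
  - m * (φ k * (1ℤ + - altSign (suc n) * c * (ε k * sgn u))) ∎
  where
  open ≡-Reasoning
  m = fac (suc n)
  r₁ : ∀ x c e s → (0ℤ - x) * (1ℤ - c * (e * s)) ≡ - x * 1ℤ + x * c * e * (s * 1ℤ)
  r₁ = solve-∀
  r₂ : ∀ x m c e a s → - x * (m * 1ℤ) + x * c * e * (a * (s * (m * 1ℤ))) ≡ - m * (x * (1ℤ + - a * c * (e * s)))
  r₂ = solve-∀
  J-spread : ∀ w → J (spread c φ) w ≡ (0ℤ - φ (hd w)) * (1ℤ - c * sgn w)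
  J-spread w = begin
    ∑ (λ i → φ (hd (swap i w)) * (1ℤ + c * sgn (swap i w)))    ≡⟨ ∑-cong (λ i → cong (λ t → φ (hd (swap i w)) * (1ℤ + t)) (trans (cong (c *_) (sgn-swap i w)) (sym (neg-distribʳ-* c (sgn w))))) ⟩
    ∑ (λ i → φ (hd (swap i w)) * (1ℤ - c * sgn w))             ≡⟨ ∑-*ʳ (1ℤ - c * sgn w) _ ⟩
    J (λ w → φ (hd w)) w * (1ℤ - c * sgn w)                    ≡⟨ cong (_* (1ℤ - c * sgn w)) (trans (J-hd φ w) (cong (_- φ (hd w)) s)) ⟩
    (0ℤ - φ (hd w)) * (1ℤ - c * sgn w)                         ∎

-- T f = g + P, where P is constant on the permutations of sign η with given value at 0
-- and g sums to 0 over each of these sets.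
A-norm : ∀ n → ANorm n
A-norm zero {η} f η² p s = subst (0ℤ ≤_) (sym (trans (cong₂ (λ c t → c * c * ⟪ f , f ⟫ - t) fac-zero eq) (r ⟪ f , f ⟫))) ≤-refl
  where
  r : ∀ x → 1ℤ * 1ℤ * x - x ≡ 0ℤ
  r = solve-∀
  -- On two points `A` is the only transposition, an isometry.
  A≡ : ∀ w → A f w ≡ f (swap zero w)
  A≡ (k ∷ u) = trans (∑-suc _) (trans (+-congˡ (f (swap zero (k ∷ u))) (∑-zero _)) (+-identityʳ _))
  eq : ⟪ A f , A f ⟫ ≡ ⟪ f , f ⟫
  eq = trans (∑ₚ-cong λ w → cong₂ _*_ (A≡ w) (A≡ w)) (∑ₚ-swap zero (λ w → f w * f w))
A-norm (suc n) {η} f η² p s = 0≤-cancel (0<-* (0<fac (2 ℕ.+ n)) (0<fac (2 ℕ.+ n))) (subst (0ℤ ≤_) (sym eq) g-bound)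
  where
  open ≡-Reasoning
  T  = fac (2 ℕ.+ n)
  m  = fac n
  m₁ = fac (suc n)
  -- The sign of the permutations on which `A f` lives.
  c′ = altSign (suc (suc n)) * η
  φ : Fin (3 ℕ.+ n) → ℤ
  φ = Marg f zero
  ∑φ : ∑ φ ≡ 0ℤ
  ∑φ = trans (row-Marg f zero) s
  c′² : c′ * c′ ≡ 1ℤ
  c′² = trans (r (altSign (suc (suc n))) η) (cong₂ _*_ (altSign² (suc (suc n))) η²)
    where
    r : ∀ x y → (x * y) * (x * y) ≡ (x * x) * (y * y)
    r = solve-∀
  P g : Code (3 ℕ.+ n) → ℤ
  P = spread η φ
  g w = T * f w + - 1ℤ * P w
  pure-g : Pure η g
  pure-g = Pure-lin T (- 1ℤ) p (Pure-spread η φ η²)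
  Marg-g : ∀ k → Marg g zero k ≡ 0ℤ
  Marg-g k = trans (Marg-lin T (- 1ℤ) f P zero k) (trans (cong (λ t → T * φ k + - 1ℤ * t) (Marg-spread η φ k)) (r (T * φ k)))
    where
    r : ∀ x → x + - 1ℤ * x ≡ 0ℤ
    r = solve-∀
  ∑g : ∑ₚ g ≡ 0ℤ
  ∑g = trans (sym (row-Marg g zero)) (∑-0 Marg-g)
  g-bound : 0ℤ ≤ m₁ * m₁ * ⟪ g , g ⟫ - ⟪ A g , A g ⟫
  -- `J` contributes the factor `n + 1` and the tails `n !`, together `m₁`.
  g-bound = subst (0ℤ ≤_) e (0≤-+ (A-norm-tails (A-norm n) g η² pure-g Marg-g) (0≤-* (0≤² m) (J-norm-sum g η² pure-g ∑g)))
    where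
    r : ∀ m k x y z → (m * m * y - z) + m * m * (k * k * x - y) ≡ (k * m) * (k * m) * x - z
    r = solve-∀
    e : (m * m * ⟪ J g , J g ⟫ - ⟪ A g , A g ⟫) + m * m * (+ suc n * + suc n * ⟪ g , g ⟫ - ⟪ J g , J g ⟫) ≡ m₁ * m₁ * ⟪ g , g ⟫ - ⟪ A g , A g ⟫
    e = trans (r m (+ suc n) ⟪ g , g ⟫ ⟪ J g , J g ⟫ ⟪ A g , A g ⟫) (cong (λ t → t * t * ⟪ g , g ⟫ - ⟪ A g , A g ⟫) (sym (fac-suc n)))
  Q = spread c′ φ
  Tf : ∀ w → T * f w ≡ 1ℤ * g w + 1ℤ * P w
  Tf w = r (T * f w) (P w)
    where
    r : ∀ x y → x ≡ 1ℤ * (x + - 1ℤ * y) + 1ℤ * y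
    r = solve-∀
  TAf : ∀ w → T * A f w ≡ 1ℤ * A g w + - m₁ * Q w
  TAf w = trans (sym (A-* T f w)) (trans (A-cong Tf w) (trans (A-lin 1ℤ 1ℤ g P w) (+-congˡ (1ℤ * A g w) (trans (*-identityˡ (A P w)) (A-spread η φ ∑φ w)))))
  ⊥P : ∀ c h → c * c ≡ 1ℤ → Pure c h → (∀ k → Marg h zero k ≡ 0ℤ) → ⟪ h , spread c φ ⟫ ≡ 0ℤ
  ⊥P c h c² p q = trans (Pure-⟪spread⟫ c h φ c² p) (cong (+ 2 *_) (NoMarg-hd h q φ))
  Marg-Ag : ∀ k → Marg (A g) zero k ≡ 0ℤ
  Marg-Ag k = trans (∑ₚ-A (λ v → J g (k ∷ v))) (trans (cong (m₁ *_) (Marg₀-J g ∑g Marg-g k)) (*-zeroʳ m₁))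
  Z = ⟪ Q , Q ⟫
  norm-f : T * T * ⟪ f , f ⟫ ≡ ⟪ g , g ⟫ + Z
  norm-f = begin
    T * T * ⟪ f , f ⟫                         ≡⟨ ⟪⟫-scale T f f ⟨
    ⟪ (λ w → T * f w) , (λ w → T * f w) ⟫     ≡⟨ ∑ₚ-cong (λ w → cong₂ _*_ (Tf w) (Tf w)) ⟩
    ⟪ (λ w → 1ℤ * g w + 1ℤ * P w) , (λ w → 1ℤ * g w + 1ℤ * P w) ⟫    ≡⟨ ⟪⟫-lin² 1ℤ 1ℤ 1ℤ 1ℤ g P g P ⟩
    1ℤ * ⟪ g , g ⟫ + 1ℤ * ⟪ g , P ⟫ + 1ℤ * ⟪ P , g ⟫ + 1ℤ * ⟪ P , P ⟫
      ≡⟨ cong₂ (λ x y → 1ℤ * ⟪ g , g ⟫ + 1ℤ * x + 1ℤ * y + 1ℤ * ⟪ P , P ⟫) gP (trans (⟪⟫-sym P g) gP) ⟩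
    1ℤ * ⟪ g , g ⟫ + 1ℤ * 0ℤ + 1ℤ * 0ℤ + 1ℤ * ⟪ P , P ⟫
      ≡⟨ r ⟪ g , g ⟫ ⟪ P , P ⟫ ⟩
    ⟪ g , g ⟫ + ⟪ P , P ⟫                     ≡⟨ +-congˡ ⟪ g , g ⟫ (trans (spread-norm η φ η²) (sym (spread-norm c′ φ c′²))) ⟩
    ⟪ g , g ⟫ + Z                             ∎
    where
    gP : ⟪ g , P ⟫ ≡ 0ℤ
    gP = ⊥P η g η² pure-g Marg-g
    r : ∀ x y → 1ℤ * x + 1ℤ * 0ℤ + 1ℤ * 0ℤ + 1ℤ * y ≡ x + y
    r = solve-∀
  norm-Af : T * T * ⟪ A f , A f ⟫ ≡ ⟪ A g , A g ⟫ + m₁ * m₁ * Z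
  norm-Af = begin
    T * T * ⟪ A f , A f ⟫                         ≡⟨ ⟪⟫-scale T (A f) (A f) ⟨
    ⟪ (λ w → T * A f w) , (λ w → T * A f w) ⟫     ≡⟨ ∑ₚ-cong (λ w → cong₂ _*_ (TAf w) (TAf w)) ⟩
    ⟪ (λ w → 1ℤ * A g w + - m₁ * Q w) , (λ w → 1ℤ * A g w + - m₁ * Q w) ⟫    ≡⟨ ⟪⟫-lin² 1ℤ (- m₁) 1ℤ (- m₁) (A g) Q (A g) Q ⟩
    1ℤ * ⟪ A g , A g ⟫ + 1ℤ * - m₁ * ⟪ A g , Q ⟫ + - m₁ * 1ℤ * ⟪ Q , A g ⟫ + - m₁ * - m₁ * Z
      ≡⟨ cong₂ (λ x y → 1ℤ * ⟪ A g , A g ⟫ + 1ℤ * - m₁ * x + - m₁ * 1ℤ * y + - m₁ * - m₁ * Z) AgQ (trans (⟪⟫-sym Q (A g)) AgQ) ⟩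
    1ℤ * ⟪ A g , A g ⟫ + 1ℤ * - m₁ * 0ℤ + - m₁ * 1ℤ * 0ℤ + - m₁ * - m₁ * Z
      ≡⟨ r ⟪ A g , A g ⟫ m₁ Z ⟩
    ⟪ A g , A g ⟫ + m₁ * m₁ * Z                   ∎
    where
    AgQ : ⟪ A g , Q ⟫ ≡ 0ℤ
    AgQ = ⊥P c′ (A g) c′² (Pure-A pure-g) Marg-Ag
    r : ∀ x m y → 1ℤ * x + 1ℤ * - m * 0ℤ + - m * 1ℤ * 0ℤ + - m * - m * y ≡ x + m * m * y
    r = solve-∀
  -- The bound is attained on the part `P`, which therefore drops out of the difference.
  eq : T * T * (m₁ * m₁ * ⟪ f , f ⟫ - ⟪ A f , A f ⟫) ≡ m₁ * m₁ * ⟪ g , g ⟫ - ⟪ A g , A g ⟫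
  eq = begin
    T * T * (m₁ * m₁ * ⟪ f , f ⟫ - ⟪ A f , A f ⟫)               ≡⟨ r (T * T) (m₁ * m₁) ⟪ f , f ⟫ ⟪ A f , A f ⟫ ⟩
    m₁ * m₁ * (T * T * ⟪ f , f ⟫) - T * T * ⟪ A f , A f ⟫       ≡⟨ cong₂ (λ x y → m₁ * m₁ * x - y) norm-f norm-Af ⟩
    m₁ * m₁ * (⟪ g , g ⟫ + Z) - (⟪ A g , A g ⟫ + m₁ * m₁ * Z)   ≡⟨ r′ (m₁ * m₁) ⟪ g , g ⟫ Z ⟪ A g , A g ⟫ ⟩
    m₁ * m₁ * ⟪ g , g ⟫ - ⟪ A g , A g ⟫                         ∎
    where
    r : ∀ t m x y → t * (m * x - y) ≡ m * (t * x) - t * y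
    r = solve-∀
    r′ : ∀ m x z y → m * (x + z) - (y + m * z) ≡ m * x - y
    r′ = solve-∀

-- Restriction to even permutations, and the ratio bound

even : ∀ {n} → (Code n → ℤ) → Code n → ℤ
even h w = 1ℤ * h w + 1ℤ * (sgn w * h w)

Pure-even : ∀ {n} (h : Code n → ℤ) → Pure 1ℤ (even h)
Pure-even h = pure λ w → trans (r (sgn w) (h w)) (trans (cong (λ t → sgn w * h w + t * h w) (sgn² w)) (r′ (sgn w) (h w)))
  where
  r : ∀ s x → s * (1ℤ * x + 1ℤ * (s * x)) ≡ s * x + s * s * x
  r = solve-∀
  r′ : ∀ s x → s * x + 1ℤ * x ≡ 1ℤ * (1ℤ * x + 1ℤ * (s * x))
  r′ = solve-∀

⟪⟫-even : ∀ {n} {f : Code n → ℤ} → Pure 1ℤ f → ∀ h → ⟪ f , even h ⟫ ≡ + 2 * ⟪ f , h ⟫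
⟪⟫-even {f = f} p h = trans (∑ₚ-cong λ w → trans (r (f w) (sgn w) (h w)) (trans (cong (λ t → (f w + t) * h w) (eqn p w)) (r′ (f w) (h w)))) (∑ₚ-* (+ 2) _)
  where
  r : ∀ f s x → f * (1ℤ * x + 1ℤ * (s * x)) ≡ (f + s * f) * x
  r = solve-∀
  r′ : ∀ f x → (f + 1ℤ * f) * x ≡ + 2 * (f * x)
  r′ = solve-∀

-- The hypothesis makes the number `suc n` of points odd. Full cycles are then even, and `A`
-- respects the parity.
A-even : ∀ {n} → altSign n ≡ 1ℤ → (h : Code (suc n) → ℤ) → ∀ w → A (even h) w ≡ even (A h) w
A-even {n} alt h w = trans (A-lin 1ℤ 1ℤ h (λ w → sgn w * h w) w)
  (cong (λ t → 1ℤ * A h w + 1ℤ * t) (trans (A-sgn h w) (trans (cong (_* (sgn w * A h w)) alt) (*-identityˡ (sgn w * A h w)))))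

Marg-even-F : ∀ {n} (g : Mat (4 ℕ.+ n)) j k → Marg (even (F g)) j k ≡ Marg (F g) j k
Marg-even-F g j k = trans (Marg-lin 1ℤ 1ℤ (F g) (λ w → sgn w * F g w) j k)
  (trans (cong (λ t → 1ℤ * Marg (F g) j k + 1ℤ * t) (Marg-sgn-F g j k)) (r (Marg (F g) j k)))
  where
  r : ∀ x → 1ℤ * x + 1ℤ * 0ℤ ≡ x
  r = solve-∀

Marg-even-1 : ∀ {n} j k → Marg {suc (suc n)} (even (λ _ → 1ℤ)) j k ≡ fac (2 ℕ.+ n)
Marg-even-1 {n} j k = trans (∑ₚ-cong λ u → trans (cong (λ t → 1ℤ + 1ℤ * (t * 1ℤ)) (sgn-ins j k u)) (r (ε j * ε k) (sgn u))) (∑ₚ-1+sgn n (ε j * ε k))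
  where
  r : ∀ a b → 1ℤ + 1ℤ * (a * b * 1ℤ) ≡ 1ℤ + a * b
  r = solve-∀

-- Hoffman's bound for degree `U` and least eigenvalue `− K` is |Alt| K / (U + K). Here U + K = (4 +
-- n) K and 2 |Alt| = T = (4 + n) U, so it equals U / 2.
module Ratio {n : ℕ} (alt : altSign (3 ℕ.+ n) ≡ 1ℤ) (f : Code (4 ℕ.+ n) → ℤ) (pf : Pure 1ℤ f)
             (idem : ∀ w → f w * f w ≡ f w) (indep : ⟪ f , A f ⟫ ≡ 0ℤ) where
  open ≡-Reasoning

  s = ∑ₚ f
  K = fac (2 ℕ.+ n)
  U = + (3 ℕ.+ n) * K
  T = + (4 ℕ.+ n) * U

  M : Mat (4 ℕ.+ n)
  M = Marg f

  H rest : Code (4 ℕ.+ n) → ℤ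
  -- The coefficients are those for which `even H` has the marginals of `T f`. The constant
  -- compensates for the row sums of `M` being `s` instead of 0.
  H w = + (3 ℕ.+ n) * F M w + - (+ (2 ℕ.+ n) * s) * 1ℤ
  rest w = T * f w + - 1ℤ * even H w

  Tf : ∀ w → T * f w ≡ 1ℤ * rest w + 1ℤ * even H w
  Tf w = r (T * f w) (even H w)
    where
    r : ∀ x y → x ≡ 1ℤ * (x + - 1ℤ * y) + 1ℤ * y
    r = solve-∀

  rest-pure : Pure 1ℤ rest
  rest-pure = Pure-lin T (- 1ℤ) pf (Pure-even H)

  Marg-FM : ∀ j k → Marg (F M) j k ≡ K * (+ (2 ℕ.+ n) * s + + (4 ℕ.+ n) * M j k)
  Marg-FM j k = begin
    Marg (F M) j k
      ≡⟨ Marg-F M j k ⟩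
    K * (tot M - row M j - col M k + (+ (2 ℕ.+ n) + + 2) * M j k)
      ≡⟨ cong (λ t → K * (t + (+ (2 ℕ.+ n) + + 2) * M j k)) (cong₂ _-_ (cong₂ _-_ (tot-Marg f) (row-Marg f j)) (col-Marg f k)) ⟩
    K * (+ (4 ℕ.+ n) * s - s - s + (+ (2 ℕ.+ n) + + 2) * M j k)
      ≡⟨ r K (+ n) s (M j k) ⟩
    K * (+ (2 ℕ.+ n) * s + + (4 ℕ.+ n) * M j k) ∎
    where
    r : ∀ K n s x → K * ((+ 4 + n) * s - s - s + (+ 2 + n + + 2) * x) ≡ K * ((+ 2 + n) * s + (+ 4 + n) * x)
    r = solve-∀

  Marg-even-H : ∀ j k → Marg (even H) j k ≡ T * M j k
  Marg-even-H j k = begin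
    Marg (even H) j k
      ≡⟨ ∑ₚ-cong (λ u → r₁ (+ (3 ℕ.+ n)) (- (+ (2 ℕ.+ n) * s)) (F M (ins j k u)) (sgn (ins j k u))) ⟩
    Marg (λ w → + (3 ℕ.+ n) * even (F M) w + - (+ (2 ℕ.+ n) * s) * even (λ _ → 1ℤ) w) j k
      ≡⟨ Marg-lin (+ (3 ℕ.+ n)) (- (+ (2 ℕ.+ n) * s)) (even (F M)) (even (λ _ → 1ℤ)) j k ⟩
    + (3 ℕ.+ n) * Marg (even (F M)) j k + - (+ (2 ℕ.+ n) * s) * Marg (even (λ _ → 1ℤ)) j k
      ≡⟨ cong₂ (λ x y → + (3 ℕ.+ n) * x + - (+ (2 ℕ.+ n) * s) * y) (trans (Marg-even-F M j k) (Marg-FM j k)) (trans (Marg-even-1 {suc n} j k) (fac-suc (2 ℕ.+ n))) ⟩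
    + (3 ℕ.+ n) * (K * (+ (2 ℕ.+ n) * s + + (4 ℕ.+ n) * M j k)) + - (+ (2 ℕ.+ n) * s) * (+ (3 ℕ.+ n) * K)
      ≡⟨ r₂ (+ (3 ℕ.+ n)) (+ (2 ℕ.+ n)) (+ (4 ℕ.+ n)) K s (M j k) ⟩
    T * M j k ∎
    where
    r₁ : ∀ a b x s → 1ℤ * (a * x + b * 1ℤ) + 1ℤ * (s * (a * x + b * 1ℤ)) ≡ a * (1ℤ * x + 1ℤ * (s * x)) + b * (1ℤ * 1ℤ + 1ℤ * (s * 1ℤ))
    r₁ = solve-∀
    r₂ : ∀ a b c K s x → a * (K * (b * s + c * x)) + - (b * s) * (a * K) ≡ c * (a * K) * x
    r₂ = solve-∀

  rest-NoMarg : NoMarg rest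
  rest-NoMarg j k = trans (Marg-lin T (- 1ℤ) f (even H) j k) (trans (cong (λ t → T * M j k + - 1ℤ * t) (Marg-even-H j k)) (r (T * M j k)))
    where
    r : ∀ x → x + - 1ℤ * x ≡ 0ℤ
    r = solve-∀

  ∑rest : ∑ₚ rest ≡ 0ℤ
  ∑rest = NoMarg-∑ₚ rest rest-NoMarg

  ⟪-,1⟫ : ∀ (h : Code (4 ℕ.+ n) → ℤ) → ⟪ h , (λ _ → 1ℤ) ⟫ ≡ ∑ₚ h
  ⟪-,1⟫ h = ∑ₚ-cong λ w → *-identityʳ (h w)

  ⟪-,H⟫≡0 : ∀ h → ∑ₚ h ≡ 0ℤ → ⟪ h , F M ⟫ ≡ 0ℤ → ⟪ h , H ⟫ ≡ 0ℤ
  ⟪-,H⟫≡0 h p q = begin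
    ⟪ h , H ⟫
      ≡⟨ ⟪⟫-linʳ h (+ (3 ℕ.+ n)) (- (+ (2 ℕ.+ n) * s)) (F M) (λ _ → 1ℤ) ⟩
    + (3 ℕ.+ n) * ⟪ h , F M ⟫ + - (+ (2 ℕ.+ n) * s) * ⟪ h , (λ _ → 1ℤ) ⟫
      ≡⟨ cong₂ (λ x y → + (3 ℕ.+ n) * x + - (+ (2 ℕ.+ n) * s) * y) q (trans (⟪-,1⟫ h) p) ⟩
    + (3 ℕ.+ n) * 0ℤ + - (+ (2 ℕ.+ n) * s) * 0ℤ
      ≡⟨ r (+ (3 ℕ.+ n)) (- (+ (2 ℕ.+ n) * s)) ⟩
    0ℤ ∎
    where
    r : ∀ a b → a * 0ℤ + b * 0ℤ ≡ 0ℤ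
    r = solve-∀

  rest⊥H : ⟪ rest , H ⟫ ≡ 0ℤ
  rest⊥H = ⟪-,H⟫≡0 rest ∑rest (NoMarg-F rest rest-NoMarg M)

  rest⊥even-H : ⟪ rest , even H ⟫ ≡ 0ℤ
  rest⊥even-H = trans (⟪⟫-even rest-pure H) (cong (+ 2 *_) rest⊥H)

  H′ : Code (4 ℕ.+ n) → ℤ
  H′ w = K * + (4 ℕ.+ n) * s * 1ℤ + - K * H w

  A-H : ∀ w → A H w ≡ H′ w
  A-H w = begin
    A H w
      ≡⟨ A-lin (+ (3 ℕ.+ n)) (- (+ (2 ℕ.+ n) * s)) (F M) (λ _ → 1ℤ) w ⟩
    + (3 ℕ.+ n) * A (F M) w + - (+ (2 ℕ.+ n) * s) * A (λ _ → 1ℤ) w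
      ≡⟨ cong₂ (λ x y → + (3 ℕ.+ n) * x + - (+ (2 ℕ.+ n) * s) * y) (trans (A-F M w) (cong (λ t → K * (t - F M w)) (tot-Marg f)))
           (trans (A-const 1ℤ w) (cong (_* 1ℤ) (fac-suc (2 ℕ.+ n)))) ⟩
    + (3 ℕ.+ n) * (K * (+ (4 ℕ.+ n) * s - F M w)) + - (+ (2 ℕ.+ n) * s) * (U * 1ℤ)
      ≡⟨ r (+ n) K s (F M w) ⟩
    H′ w ∎
    where
    r : ∀ n K s F → (+ 3 + n) * (K * ((+ 4 + n) * s - F)) + - ((+ 2 + n) * s) * ((+ 3 + n) * K * 1ℤ)
        ≡ K * (+ 4 + n) * s * 1ℤ + - K * ((+ 3 + n) * F + - ((+ 2 + n) * s) * 1ℤ)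
    r = solve-∀

  A-even-H : ∀ w → A (even H) w ≡ even H′ w
  A-even-H w = trans (A-even alt H w) (cong (λ t → 1ℤ * t + 1ℤ * (sgn w * t)) (A-H w))

  X = ⟪ rest , rest ⟫
  P = ⟪ rest , A rest ⟫

  ⟪rest,A-even-H⟫ : ⟪ rest , A (even H) ⟫ ≡ 0ℤ
  ⟪rest,A-even-H⟫ = begin
    ⟪ rest , A (even H) ⟫     ≡⟨ ⟪⟫-congʳ rest A-even-H ⟩
    ⟪ rest , even H′ ⟫        ≡⟨ ⟪⟫-even rest-pure H′ ⟩
    + 2 * ⟪ rest , H′ ⟫       ≡⟨ cong (+ 2 *_) (⟪⟫-linʳ rest (K * + (4 ℕ.+ n) * s) (- K) (λ _ → 1ℤ) H) ⟩
    + 2 * (K * + (4 ℕ.+ n) * s * ⟪ rest , (λ _ → 1ℤ) ⟫ + - K * ⟪ rest , H ⟫)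
      ≡⟨ cong₂ (λ x y → + 2 * (K * + (4 ℕ.+ n) * s * x + - K * y)) (trans (⟪-,1⟫ rest) ∑rest) rest⊥H ⟩
    + 2 * (K * + (4 ℕ.+ n) * s * 0ℤ + - K * 0ℤ)
      ≡⟨ r (K * + (4 ℕ.+ n) * s) (- K) ⟩
    0ℤ ∎
    where
    r : ∀ a b → + 2 * (a * 0ℤ + b * 0ℤ) ≡ 0ℤ
    r = solve-∀

  ⟪even-H,A-rest⟫ : ⟪ even H , A rest ⟫ ≡ 0ℤ
  ⟪even-H,A-rest⟫ = begin
    ⟪ even H , A rest ⟫        ≡⟨ ⟪⟫-sym (even H) (A rest) ⟩
    ⟪ A rest , even H ⟫        ≡⟨ ⟪⟫-even (subst (λ η → Pure η (A rest)) (trans (*-identityʳ (altSign (3 ℕ.+ n))) alt) (Pure-A rest-pure)) H ⟩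
    + 2 * ⟪ A rest , H ⟫       ≡⟨ cong (+ 2 *_) (⟪-,H⟫≡0 (A rest) (trans (∑ₚ-A rest) (trans (cong (fac (3 ℕ.+ n) *_) ∑rest) (*-zeroʳ (fac (3 ℕ.+ n))))) FA) ⟩
    + 2 * 0ℤ                   ∎
    where
    r : ∀ K t → K * (t * 0ℤ - 0ℤ) ≡ 0ℤ
    r = solve-∀
    FA : ⟪ A rest , F M ⟫ ≡ 0ℤ
    FA = trans (⟪⟫-sym (A rest) (F M)) (trans (A-F-adj M rest)
      (trans (cong₂ (λ x y → K * (tot M * x - y)) ∑rest (trans (⟪⟫-sym (F M) rest) (NoMarg-F rest rest-NoMarg M))) (r K (tot M))))

  even-H-norm : ⟪ even H , even H ⟫ ≡ T * T * s - X
  even-H-norm = begin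
    ⟪ even H , even H ⟫
      ≡⟨ r X ⟪ even H , even H ⟫ ⟩
    (1ℤ * X + 1ℤ * 0ℤ + 1ℤ * 0ℤ + 1ℤ * ⟪ even H , even H ⟫) - X
      ≡⟨ cong₂ (λ x y → (1ℤ * X + 1ℤ * x + 1ℤ * y + 1ℤ * ⟪ even H , even H ⟫) - X) (sym rest⊥even-H) (sym (trans (⟪⟫-sym (even H) rest) rest⊥even-H)) ⟩
    (1ℤ * X + 1ℤ * ⟪ rest , even H ⟫ + 1ℤ * ⟪ even H , rest ⟫ + 1ℤ * ⟪ even H , even H ⟫) - X
      ≡⟨ cong (_- X) (sym (⟪⟫-lin² 1ℤ 1ℤ 1ℤ 1ℤ rest (even H) rest (even H))) ⟩
    ⟪ (λ w → 1ℤ * rest w + 1ℤ * even H w) , (λ w → 1ℤ * rest w + 1ℤ * even H w) ⟫ - X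
      ≡⟨ cong (_- X) (∑ₚ-cong λ w → sym (cong₂ _*_ (Tf w) (Tf w))) ⟩
    ⟪ (λ w → T * f w) , (λ w → T * f w) ⟫ - X
      ≡⟨ cong (_- X) (trans (⟪⟫-scale T f f) (cong (T * T *_) (∑ₚ-cong idem))) ⟩
    T * T * s - X ∎
    where
    r : ∀ x y → y ≡ (1ℤ * x + 1ℤ * 0ℤ + 1ℤ * 0ℤ + 1ℤ * y) - x
    r = solve-∀

  ∑even-H : ∑ₚ (even H) ≡ T * s
  ∑even-H = begin
    ∑ₚ (even H)                               ≡⟨ row-Marg (even H) zero ⟨
    ∑ (λ k → Marg (even H) zero k)            ≡⟨ ∑-cong (Marg-even-H zero) ⟩
    ∑ (λ k → T * M zero k)                    ≡⟨ ∑-* T (M zero) ⟩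
    T * row M zero                            ≡⟨ cong (T *_) (row-Marg f zero) ⟩
    T * s                                     ∎

  ⟪even-H,A-even-H⟫ : ⟪ even H , A (even H) ⟫ ≡ K * + (4 ℕ.+ n) * s * (+ 2 * (T * s)) + - K * (T * T * s - X)
  ⟪even-H,A-even-H⟫ = begin
    ⟪ even H , A (even H) ⟫
      ≡⟨ ⟪⟫-congʳ (even H) (λ w → trans (A-even-H w) (r (K * + (4 ℕ.+ n) * s) (- K) (H w) (sgn w))) ⟩
    ⟪ even H , (λ w → K * + (4 ℕ.+ n) * s * even (λ _ → 1ℤ) w + - K * even H w) ⟫
      ≡⟨ ⟪⟫-linʳ (even H) (K * + (4 ℕ.+ n) * s) (- K) (even (λ _ → 1ℤ)) (even H) ⟩
    K * + (4 ℕ.+ n) * s * ⟪ even H , even (λ _ → 1ℤ) ⟫ + - K * ⟪ even H , even H ⟫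
      ≡⟨ cong₂ (λ x y → K * + (4 ℕ.+ n) * s * x + - K * y)
           (trans (⟪⟫-even (Pure-even H) (λ _ → 1ℤ)) (cong (+ 2 *_) (trans (⟪-,1⟫ (even H)) ∑even-H))) even-H-norm ⟩
    K * + (4 ℕ.+ n) * s * (+ 2 * (T * s)) + - K * (T * T * s - X) ∎
    where
    r : ∀ a b x s → 1ℤ * (a * 1ℤ + b * x) + 1ℤ * (s * (a * 1ℤ + b * x)) ≡ a * (1ℤ * 1ℤ + 1ℤ * (s * 1ℤ)) + b * (1ℤ * x + 1ℤ * (s * x))
    r = solve-∀

  -- The left side is the form of `A + K` at `rest`. It comes from expanding T² ⟨f , A f⟩ = 0 along
  -- `rest` and `even H`, whose cross terms vanish; the right side carries the sign of the
  -- inequality sought.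
  balance : K * X + P ≡ K * (T * + (4 ℕ.+ n)) * (s * (U - + 2 * s))
  balance = begin
    K * X + P
      ≡⟨ r₁ K X P (+ (4 ℕ.+ n)) U s ⟩
    (1ℤ * P + 1ℤ * 0ℤ + 1ℤ * 0ℤ + 1ℤ * (K * + (4 ℕ.+ n) * s * (+ 2 * (T * s)) + - K * (T * T * s - X))) + K * (T * + (4 ℕ.+ n)) * (s * (U - + 2 * s))
      ≡⟨ cong (_+ K * (T * + (4 ℕ.+ n)) * (s * (U - + 2 * s))) zero-form ⟨
    0ℤ + K * (T * + (4 ℕ.+ n)) * (s * (U - + 2 * s))
      ≡⟨ +-identityˡ _ ⟩
    K * (T * + (4 ℕ.+ n)) * (s * (U - + 2 * s)) ∎
    where
    r₁ : ∀ K X P a U s → K * X + P ≡ (1ℤ * P + 1ℤ * 0ℤ + 1ℤ * 0ℤ + 1ℤ * (K * a * s * (+ 2 * (a * U * s)) + - K * (a * U * (a * U) * s - X))) + K * (a * U * a) * (s * (U - + 2 * s))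
    r₁ = solve-∀
    TAf : ∀ w → T * A f w ≡ 1ℤ * A rest w + 1ℤ * A (even H) w
    TAf w = trans (sym (A-* T f w)) (trans (A-cong Tf w) (A-lin 1ℤ 1ℤ rest (even H) w))
    zero-form : 0ℤ ≡ 1ℤ * P + 1ℤ * 0ℤ + 1ℤ * 0ℤ + 1ℤ * (K * + (4 ℕ.+ n) * s * (+ 2 * (T * s)) + - K * (T * T * s - X))
    zero-form = begin
      0ℤ                                                 ≡⟨ *-zeroʳ (T * T) ⟨
      T * T * 0ℤ                                         ≡⟨ cong (T * T *_) indep ⟨
      T * T * ⟪ f , A f ⟫                                ≡⟨ ⟪⟫-scale T f (A f) ⟨
      ⟪ (λ w → T * f w) , (λ w → T * A f w) ⟫            ≡⟨ ∑ₚ-cong (λ w → cong₂ _*_ (Tf w) (TAf w)) ⟩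
      ⟪ (λ w → 1ℤ * rest w + 1ℤ * even H w) , (λ w → 1ℤ * A rest w + 1ℤ * A (even H) w) ⟫
        ≡⟨ ⟪⟫-lin² 1ℤ 1ℤ 1ℤ 1ℤ rest (even H) (A rest) (A (even H)) ⟩
      1ℤ * P + 1ℤ * ⟪ rest , A (even H) ⟫ + 1ℤ * ⟪ even H , A rest ⟫ + 1ℤ * ⟪ even H , A (even H) ⟫
        ≡⟨ cong₂ (λ x y → 1ℤ * P + 1ℤ * x + 1ℤ * y + 1ℤ * ⟪ even H , A (even H) ⟫) ⟪rest,A-even-H⟫ ⟪even-H,A-rest⟫ ⟩
      1ℤ * P + 1ℤ * 0ℤ + 1ℤ * 0ℤ + 1ℤ * ⟪ even H , A (even H) ⟫
        ≡⟨ cong (λ t → 1ℤ * P + 1ℤ * 0ℤ + 1ℤ * 0ℤ + 1ℤ * t) ⟪even-H,A-even-H⟫ ⟩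
      1ℤ * P + 1ℤ * 0ℤ + 1ℤ * 0ℤ + 1ℤ * (K * + (4 ℕ.+ n) * s * (+ 2 * (T * s)) + - K * (T * T * s - X)) ∎

  m = fac (suc n)
  α = + suc n * + (3 ℕ.+ n)
  β = + (2 ℕ.+ n)

  -- This combines ‖A rest‖ ≤ m ‖J rest‖ and β ‖J rest‖ ≤ α ‖rest‖ with 0 ≤ ‖(K + A) rest‖². As K =
  -- β m, the coefficient left for `X` is m² (β⁴ - α²), and β² - α = 1 turns it into m² (β² + α) >
  -- 0.
  rest-bound : 0ℤ ≤ + 2 * K * (β * β) * (K * X + P) - m * m * (β * β + α) * X
  rest-bound = subst (0ℤ ≤_) eq
    (0≤-+ (0≤-+ (0≤-* (0≤² β) (0≤⟪⟫ (λ w → K * rest w + 1ℤ * A rest w)))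
                (0≤-* (0≤² m) (J-norm-NoMarg rest refl rest-pure rest-NoMarg)))
          (0≤-* (0≤² β) (A-norm-tails (A-norm (suc n)) rest refl rest-pure (rest-NoMarg zero))))
    where
    Y = ⟪ J rest , J rest ⟫
    W = ⟪ A rest , A rest ⟫
    r : ∀ n m X P Y W → (+ 2 + n) * (+ 2 + n) * ((+ 2 + n) * m * ((+ 2 + n) * m) * X + (+ 2 + n) * m * 1ℤ * P + 1ℤ * ((+ 2 + n) * m) * P + 1ℤ * 1ℤ * W)
          + m * m * ((1ℤ + n) * (+ 3 + n) * ((1ℤ + n) * (+ 3 + n)) * X - (+ 2 + n) * (+ 2 + n) * Y)
          + (+ 2 + n) * (+ 2 + n) * (m * m * Y - W)
        ≡ + 2 * ((+ 2 + n) * m) * ((+ 2 + n) * (+ 2 + n)) * ((+ 2 + n) * m * X + P) - m * m * ((+ 2 + n) * (+ 2 + n) + (1ℤ + n) * (+ 3 + n)) * X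
    r = solve-∀
    eq : β * β * ⟪ (λ w → K * rest w + 1ℤ * A rest w) , (λ w → K * rest w + 1ℤ * A rest w) ⟫
         + m * m * (α * α * X - β * β * Y) + β * β * (m * m * Y - W)
         ≡ + 2 * K * (β * β) * (K * X + P) - m * m * (β * β + α) * X
    eq = begin
      β * β * ⟪ (λ w → K * rest w + 1ℤ * A rest w) , (λ w → K * rest w + 1ℤ * A rest w) ⟫
         + m * m * (α * α * X - β * β * Y) + β * β * (m * m * Y - W)
        ≡⟨ cong (λ t → β * β * t + m * m * (α * α * X - β * β * Y) + β * β * (m * m * Y - W)) (⟪⟫-lin² K 1ℤ K 1ℤ rest (A rest) rest (A rest)) ⟩
      β * β * (K * K * X + K * 1ℤ * P + 1ℤ * K * ⟪ A rest , rest ⟫ + 1ℤ * 1ℤ * W)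
         + m * m * (α * α * X - β * β * Y) + β * β * (m * m * Y - W)
        ≡⟨ cong₂ (λ k q → β * β * (k * k * X + k * 1ℤ * P + 1ℤ * k * q + 1ℤ * 1ℤ * W) + m * m * (α * α * X - β * β * Y) + β * β * (m * m * Y - W)) (fac-suc (suc n)) (⟪⟫-sym (A rest) rest) ⟩
      β * β * (β * m * (β * m) * X + β * m * 1ℤ * P + 1ℤ * (β * m) * P + 1ℤ * 1ℤ * W)
         + m * m * (α * α * X - β * β * Y) + β * β * (m * m * Y - W)
        ≡⟨ r (+ n) m X P Y W ⟩
      + 2 * (β * m) * (β * β) * (β * m * X + P) - m * m * (β * β + α) * X
        ≡⟨ cong (λ k → + 2 * k * (β * β) * (k * X + P) - m * m * (β * β + α) * X) (sym (fac-suc (suc n))) ⟩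
      + 2 * K * (β * β) * (K * X + P) - m * m * (β * β + α) * X ∎

  0<α : 0ℤ < α
  0<α = +<+ (ℕ.s≤s ℕ.z≤n)

  0<c : 0ℤ < m * m * (β * β + α)
  0<c = 0<-* (0<-* (0<fac (suc n)) (0<fac (suc n))) (+-mono-≤-< (0≤² β) 0<α)

  0<K : 0ℤ < K
  0<K = 0<fac (2 ℕ.+ n)

  0<4+n : 0ℤ < + (4 ℕ.+ n)
  0<4+n = +<+ (ℕ.s≤s ℕ.z≤n)

  0<U : 0ℤ < U
  0<U = 0<-* {+ (3 ℕ.+ n)} (+<+ (ℕ.s≤s ℕ.z≤n)) 0<K

  bound : 0ℤ ≤ s * (U - + 2 * s)
  bound = 0≤-cancel (0<-* 0<K (0<-* (0<-* 0<4+n 0<U) 0<4+n)) (subst (0ℤ ≤_) balance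
    (0≤-cancel (0<-* (0<-* {+ 2} (+<+ (ℕ.s≤s ℕ.z≤n)) 0<K) (0<-* {β} {β} (+<+ (ℕ.s≤s ℕ.z≤n)) (+<+ (ℕ.s≤s ℕ.z≤n))))
      (subst (0ℤ ≤_) (r _ _) (0≤-+ rest-bound (0≤-* (<⇒≤ 0<c) (0≤⟪⟫ rest))))))
    where
    r : ∀ x y → x - y + y ≡ x
    r = solve-∀

  -- At equality the right side of `balance` is 0, and `rest-bound` leaves a negative multiple of
  -- the norm of `rest`.
  rest≡0 : U ≡ + 2 * s → ∀ w → rest w ≡ 0ℤ
  rest≡0 e w = sq0 (rest w) (∑ₚ-0⁻¹ (λ v → 0≤² (rest v)) X≡0 w)
    where
    sq0 : ∀ x → x * x ≡ 0ℤ → x ≡ 0ℤ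
    sq0 x p with i*j≡0⇒i≡0∨j≡0 x p
    ... | inj₁ q = q
    ... | inj₂ q = q
    b≡0 : K * X + P ≡ 0ℤ
    b≡0 = trans balance (trans (cong (λ t → K * (T * + (4 ℕ.+ n)) * (s * t)) (trans (cong (_- + 2 * s) e) (+-inverseʳ (+ 2 * s)))) (r (K * (T * + (4 ℕ.+ n))) s))
      where
      r : ∀ a b → a * (b * 0ℤ) ≡ 0ℤ
      r = solve-∀
    -X≥0 : 0ℤ ≤ - X
    -X≥0 = 0≤-cancel 0<c (subst (0ℤ ≤_) (trans (cong (λ t → + 2 * K * (β * β) * t - m * m * (β * β + α) * X) b≡0) (r (+ 2 * K * (β * β)) (m * m * (β * β + α)) X)) rest-bound)
      where
      r : ∀ a c x → a * 0ℤ - c * x ≡ c * - x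
      r = solve-∀
    X≡0 : X ≡ 0ℤ
    X≡0 = proj₁ (+-zero⁻¹ (0≤⟪⟫ rest) -X≥0 (+-inverseʳ X))

-- The case of equality

sgn-± : ∀ {n} (w : Code n) → sgn w ≡ 1ℤ ⊎ sgn w ≡ - 1ℤ
sgn-± w with i*j≡0⇒i≡0∨j≡0 (sgn w - 1ℤ) {sgn w + 1ℤ} (trans (r (sgn w)) (cong (_- 1ℤ) (sgn² w)))
  where
  r : ∀ s → (s - 1ℤ) * (s + 1ℤ) ≡ s * s - 1ℤ
  r = solve-∀
... | inj₁ e = inj₁ (i-j≡0⇒i≡j (sgn w) 1ℤ e)
... | inj₂ e = inj₂ (i-j≡0⇒i≡j (sgn w) (- 1ℤ) e)

-- w ∘ (p+1 q+1)
transp : ∀ {n} → Fin n → Fin n → Code (suc n) → Code (suc n)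
transp p q w = swap p (swap q (swap p w))

module _ {n : ℕ} {p q : Fin n} (p≢q : p ≢ q) (w : Code (suc n)) where

  ⟦transp⟧-0 : ⟦ transp p q w ⟧ zero ≡ ⟦ w ⟧ zero
  ⟦transp⟧-0 = trans (⟦swap⟧-0 p _) (trans (⟦swap⟧-≢ q p _ p≢q) (⟦swap⟧-i p w))

  ⟦transp⟧-p : ⟦ transp p q w ⟧ (suc p) ≡ ⟦ w ⟧ (suc q)
  ⟦transp⟧-p = trans (⟦swap⟧-i p _) (trans (⟦swap⟧-0 q _) (⟦swap⟧-≢ p q w (p≢q ∘ sym)))

  ⟦transp⟧-≢ : ∀ {r} → r ≢ p → r ≢ q → ⟦ transp p q w ⟧ (suc r) ≡ ⟦ w ⟧ (suc r)
  ⟦transp⟧-≢ r≢p r≢q = trans (⟦swap⟧-≢ p _ _ r≢p) (trans (⟦swap⟧-≢ q _ _ r≢q) (⟦swap⟧-≢ p _ w r≢p))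

  sgn-transp : sgn (transp p q w) ≡ - sgn w
  sgn-transp = trans (sgn-swap p _) (cong -_ (trans (sgn-swap q _) (trans (cong -_ (sgn-swap p w)) (neg-involutive (sgn w)))))

id-code : ∀ n → Code n
id-code zero    = []
id-code (suc n) = zero ∷ id-code n

code-with : ∀ {n} (b : Fin (suc n)) {x y} → x ≢ y → ∃ λ w → ⟦ w ⟧ zero ≡ x × ⟦ w ⟧ (suc b) ≡ y
code-with {n} b {x} {y} x≢y = x ∷ ins b (punchOut x≢y) (id-code n) , refl ,
  trans (cong (punchIn x) (⟦ins⟧-j b (punchOut x≢y) (id-code n))) (punchIn-punchOut x≢y)

0≰-2 : ¬ (0ℤ ≤ - + 2)
0≰-2 ()

-- A {0,1}-valued function on even permutations which is of degree one and has density 1/m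
-- depends on one value only.
module Extremal {n : ℕ} (K : ℤ) (0<K : 0ℤ < K) (f : Code (5 ℕ.+ n) → ℤ) (M : Mat (5 ℕ.+ n)) (s : ℤ)
                (f01 : ∀ w → f w ≡ 0ℤ ⊎ f w ≡ 1ℤ)
                (2s : + 2 * s ≡ + (4 ℕ.+ n) * K)
                (linear : ∀ w → sgn w ≡ 1ℤ → + 2 * F M w ≡ + (5 ℕ.+ n) * K * f w + + (3 ℕ.+ n) * K)
                (M≥0 : ∀ j k → 0ℤ ≤ M j k) (row-M : ∀ j → row M j ≡ s) where
  m : ℕ
  m = 5 ℕ.+ n

  open ≡-Reasoning

  N = + m * K

  0<N : 0ℤ < N
  0<N = 0<-* {+ m} (+<+ (ℕ.s≤s ℕ.z≤n)) 0<K

  rot : (b c : Fin (4 ℕ.+ n)) → Code m → Code m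
  rot b c w = swap b (swap c w)

  sgn-rot : ∀ b c w → sgn w ≡ 1ℤ → sgn (rot b c w) ≡ 1ℤ
  sgn-rot b c w e = trans (sgn-swap b _) (trans (cong -_ (sgn-swap c w)) (trans (neg-involutive (sgn w)) e))

  record Letters (b c : Fin (4 ℕ.+ n)) (x y z : Fin m) (w : Code m) : Set where
    constructor letters
    field
      at0 : ⟦ w ⟧ zero ≡ x
      atb : ⟦ w ⟧ (suc b) ≡ y
      atc : ⟦ w ⟧ (suc c) ≡ z
  open Letters

  rot-Letters : ∀ {b c x y z w} → b ≢ c → Letters b c x y z w → Letters b c y z x (rot b c w)
  rot-Letters {b} {c} {w = w} b≢c l = letters
    (trans (⟦swap⟧-0 b _) (trans (⟦swap⟧-≢ c b w b≢c) (atb l)))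
    (trans (⟦swap⟧-i b _) (trans (⟦swap⟧-0 c w) (atc l)))
    (trans (⟦swap⟧-≢ b c _ (b≢c ∘ sym)) (trans (⟦swap⟧-i c w) (at0 l)))

  s₃ : (b c : Fin (4 ℕ.+ n)) (x y z : Fin m) → ℤ
  s₃ b c x y z = M zero x + M (suc b) y + M (suc c) z

  rot-F : ∀ {b c x y z w} → b ≢ c → Letters b c x y z w → F M (rot b c w) ≡ F M w + (s₃ b c y z x - s₃ b c x y z)
  rot-F {b} {c} {w = w} b≢c (letters refl refl refl) = begin
    F M (swap b (swap c w))
      ≡⟨ F-swap M b (swap c w) ⟩
    F M (swap c w) + (M zero (⟦ v ⟧ (suc b)) + M (suc b) (⟦ v ⟧ zero) - M zero (⟦ v ⟧ zero) - M (suc b) (⟦ v ⟧ (suc b)))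
      ≡⟨ cong₂ (λ p q → F M (swap c w) + (M zero p + M (suc b) q - M zero q - M (suc b) p)) (⟦swap⟧-≢ c b w b≢c) (⟦swap⟧-0 c w) ⟩
    F M (swap c w) + (M zero y + M (suc b) z - M zero z - M (suc b) y)
      ≡⟨ cong (_+ (M zero y + M (suc b) z - M zero z - M (suc b) y)) (F-swap M c w) ⟩
    F M w + (M zero z + M (suc c) x - M zero x - M (suc c) z) + (M zero y + M (suc b) z - M zero z - M (suc b) y)
      ≡⟨ r (F M w) (M zero x) (M zero y) (M zero z) (M (suc b) y) (M (suc b) z) (M (suc c) x) (M (suc c) z) ⟩
    F M w + (s₃ b c y z x - s₃ b c x y z) ∎
    where
    v = swap c w
    x = ⟦ w ⟧ zero
    y = ⟦ w ⟧ (suc b)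
    z = ⟦ w ⟧ (suc c)
    r : ∀ F x0 y0 z0 yb zb xc zc → F + (z0 + xc - x0 - zc) + (y0 + zb - z0 - yb) ≡ F + (y0 + zb + xc - (x0 + yb + zc))
    r = solve-∀

  -- A 3-cycle of positions stays among the even permutations, where `linear` expresses changes of
  -- `F M` by changes of `f`. So `2 s₃` is invariant modulo `N` under cyclic shifts of the letters.
  rot-s₃ : ∀ {b c x y z w} → b ≢ c → Letters b c x y z w → sgn w ≡ 1ℤ →
           + 2 * (s₃ b c y z x - s₃ b c x y z) ≡ N * (f (rot b c w) - f w)
  rot-s₃ {b} {c} {x} {y} {z} {w} b≢c l e = begin
    + 2 * (s₃ b c y z x - s₃ b c x y z)
      ≡⟨ r (F M w) (s₃ b c y z x - s₃ b c x y z) ⟩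
    + 2 * (F M w + (s₃ b c y z x - s₃ b c x y z)) - + 2 * F M w
      ≡⟨ cong (λ t → + 2 * t - + 2 * F M w) (rot-F b≢c l) ⟨
    + 2 * F M (rot b c w) - + 2 * F M w
      ≡⟨ cong₂ _-_ (linear (rot b c w) (sgn-rot b c w e)) (linear w e) ⟩
    (N * f (rot b c w) + + (3 ℕ.+ n) * K) - (N * f w + + (3 ℕ.+ n) * K)
      ≡⟨ r′ N (f (rot b c w)) (f w) (+ (3 ℕ.+ n) * K) ⟩
    N * (f (rot b c w) - f w) ∎
    where
    r : ∀ F t → + 2 * t ≡ + 2 * (F + t) - + 2 * F
    r = solve-∀
    r′ : ∀ N a b c → (N * a + c) - (N * b + c) ≡ N * (a - b)
    r′ = solve-∀

  D : Fin (4 ℕ.+ n) → Fin m → ℤ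
  D b x = + 2 * (M zero x - M (suc b) x)

  0≤f : ∀ w → 0ℤ ≤ f w
  0≤f w = 01⇒0≤ (f01 w)

  f≤1 : ∀ w → 0ℤ ≤ 1ℤ - f w
  f≤1 w = 01⇒≤1 (f01 w)

  -- `q-eq` and `t-eq` make the differences of `D` multiples of `N`; the bounds on `t` then restrict
  -- which multiples occur.
  record Relations (b : Fin (4 ℕ.+ n)) (x y z : Fin m) : Set where
    field
      q  : ℤ
      q-eq : (D b x - D b y) - (D b y - D b z) ≡ N * q
      t  : ℤ
      t-eq : + 3 * (D b x - D b y) ≡ N * t
      t≤4 : 0ℤ ≤ + 4 - t
      -4≤t : 0ℤ ≤ t + + 4
  open Relations

  -- The two classes of bijections {0,b,c} → {x,y,z} are the rotations of w and of v.
  relations-even : ∀ {b c d e x y z w} → b ≢ c → d ≢ e → b ≢ d → b ≢ e → c ≢ d → c ≢ e →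
                   Letters b c x y z w → sgn w ≡ 1ℤ → Relations b x y z
  relations-even {b} {c} {d} {e} {x} {y} {z} {w} b≢c d≢e b≢d b≢e c≢d c≢e l ev = record
    { q = f0 - f1 - f3 + f5
    ; q-eq = begin
        (D b x - D b y) - (D b y - D b z)
          ≡⟨ cong₂ _-_ (D-S x y z) (D-S y z x) ⟩
        + 2 * (S x y z - S y x z) - + 2 * (S y z x - S z y x)
          ≡⟨ r₁ (S x y z) (S y z x) (S y x z) (S x z y) (S z y x) ⟩
        - (+ 2 * (S y z x - S x y z)) + (+ 2 * (S x z y - S y x z)) + (+ 2 * (S z y x - S x z y))
          ≡⟨ cong₂ _+_ (cong₂ (λ p q → - p + q) e01 e34) e45 ⟩
        - (N * (f1 - f0)) + N * (f4 - f3) + N * (f5 - f4)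
          ≡⟨ r₂ N f0 f1 f3 f4 f5 ⟩
        N * (f0 - f1 - f3 + f5) ∎
    ; t = + 2 * f0 - f1 - f2 - + 2 * f3 + f4 + f5
    ; t-eq = begin
        + 3 * (D b x - D b y)
          ≡⟨ cong (+ 3 *_) (D-S x y z) ⟩
        + 3 * (+ 2 * (S x y z - S y x z))
          ≡⟨ r₃ (S x y z) (S y z x) (S z x y) (S y x z) (S x z y) (S z y x) ⟩
        Δ + + 2 * ((S x y z + S y z x + S z x y) - (S y x z + S x z y + S z y x))
          -- The three rotations of either class use each of the nine entries once, so both classes
          -- have the same sum.
          ≡⟨ cong (λ t → Δ + + 2 * t) (i≡j⇒i-j≡0 (r₇ (M zero x) (M zero y) (M zero z) (M (suc b) x) (M (suc b) y) (M (suc b) z) (M (suc c) x) (M (suc c) y) (M (suc c) z))) ⟩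
        Δ + + 2 * 0ℤ
          ≡⟨ +-identityʳ Δ ⟩
        Δ
          ≡⟨ cong₂ _+_ (cong₂ (λ p q → p + + 2 * q) (cong₂ (λ p q → - + 2 * p - q) e01 e12) e34) e45 ⟩
        - + 2 * (N * (f1 - f0)) - N * (f2 - f1) + + 2 * (N * (f4 - f3)) + N * (f5 - f4)
          ≡⟨ r₄ N f0 f1 f2 f3 f4 f5 ⟩
        N * (+ 2 * f0 - f1 - f2 - + 2 * f3 + f4 + f5) ∎
    ; t≤4 = subst (0ℤ ≤_) (r₅ f0 f1 f2 f3 f4 f5)
        (0≤-+ (0≤-+ (0≤-+ (0≤-* (0≤+ 2) (f≤1 w)) (0≤f w₁)) (0≤-+ (0≤f w₂) (0≤-* (0≤+ 2) (0≤f v)))) (0≤-+ (f≤1 v₁) (f≤1 v₂)))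
    ; -4≤t = subst (0ℤ ≤_) (r₆ f0 f1 f2 f3 f4 f5)
        (0≤-+ (0≤-+ (0≤-+ (0≤-* (0≤+ 2) (0≤f w)) (f≤1 w₁)) (0≤-+ (f≤1 w₂) (0≤-* (0≤+ 2) (f≤1 v)))) (0≤-+ (0≤f v₁) (0≤f v₂)))
    }
    where
    S = s₃ b c
    w₁ = rot b c w
    w₂ = rot b c w₁
    -- Exchanging `x` and `y` alone would be odd. Transposing two further positions restores the
    -- parity, which takes five positions in all.
    u  = transp d e w
    v  = swap b u
    v₁ = rot b c v
    v₂ = rot b c v₁
    f0 = f w ; f1 = f w₁ ; f2 = f w₂ ; f3 = f v ; f4 = f v₁ ; f5 = f v₂
    lv : Letters b c y x z v
    lv = letters
      (trans (⟦swap⟧-0 b u) (trans (⟦transp⟧-≢ d≢e w b≢d b≢e) (atb l)))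
      (trans (⟦swap⟧-i b u) (trans (⟦transp⟧-0 d≢e w) (at0 l)))
      (trans (⟦swap⟧-≢ b c u (b≢c ∘ sym)) (trans (⟦transp⟧-≢ d≢e w c≢d c≢e) (atc l)))
    ev-v : sgn v ≡ 1ℤ
    ev-v = trans (sgn-swap b u) (trans (cong -_ (sgn-transp d≢e w)) (trans (neg-involutive (sgn w)) ev))
    e01 = rot-s₃ b≢c l ev
    e12 = rot-s₃ b≢c (rot-Letters b≢c l) (sgn-rot b c w ev)
    e34 = rot-s₃ b≢c lv ev-v
    e45 = rot-s₃ b≢c (rot-Letters b≢c lv) (sgn-rot b c v ev-v)
    D-S : ∀ x y z → D b x - D b y ≡ + 2 * (S x y z - S y x z)
    D-S x y z = r (M zero x) (M zero y) (M (suc b) x) (M (suc b) y) (M (suc c) z)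
      where
      r : ∀ ax ay bx by cz → + 2 * (ax - bx) - + 2 * (ay - by) ≡ + 2 * ((ax + by + cz) - (ay + bx + cz))
      r = solve-∀
    Δ = - + 2 * (+ 2 * (S y z x - S x y z)) - (+ 2 * (S z x y - S y z x)) + + 2 * (+ 2 * (S x z y - S y x z)) + (+ 2 * (S z y x - S x z y))
    r₁ : ∀ s0 s1 t0 t1 t2 → + 2 * (s0 - t0) - + 2 * (s1 - t2) ≡ - (+ 2 * (s1 - s0)) + (+ 2 * (t1 - t0)) + (+ 2 * (t2 - t1))
    r₁ = solve-∀
    r₂ : ∀ N a b d e f → - (N * (b - a)) + N * (e - d) + N * (f - e) ≡ N * (a - b - d + f)
    r₂ = solve-∀
    r₃ : ∀ s0 s1 s2 t0 t1 t2 → + 3 * (+ 2 * (s0 - t0))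
         ≡ - + 2 * (+ 2 * (s1 - s0)) - (+ 2 * (s2 - s1)) + + 2 * (+ 2 * (t1 - t0)) + (+ 2 * (t2 - t1)) + + 2 * ((s0 + s1 + s2) - (t0 + t1 + t2))
    r₃ = solve-∀
    r₇ : ∀ ax ay az bx by bz cx cy cz → (ax + by + cz) + (ay + bz + cx) + (az + bx + cy) ≡ (ay + bx + cz) + (ax + bz + cy) + (az + by + cx)
    r₇ = solve-∀
    r₄ : ∀ N a b c d e f → - + 2 * (N * (b - a)) - N * (c - b) + + 2 * (N * (e - d)) + N * (f - e) ≡ N * (+ 2 * a - b - c - + 2 * d + e + f)
    r₄ = solve-∀
    r₅ : ∀ a b c d e f → (+ 2 * (1ℤ - a) + b) + (c + + 2 * d) + ((1ℤ - e) + (1ℤ - f)) ≡ + 4 - (+ 2 * a - b - c - + 2 * d + e + f)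
    r₅ = solve-∀
    r₆ : ∀ a b c d e f → (+ 2 * a + (1ℤ - b)) + ((1ℤ - c) + + 2 * (1ℤ - d)) + (e + f) ≡ (+ 2 * a - b - c - + 2 * d + e + f) + + 4
    r₆ = solve-∀

  -- An odd `w` becomes even, with the same three letters, by transposing `d` and `e`.
  relations : ∀ {b c d e x y z w} → b ≢ c → d ≢ e → b ≢ d → b ≢ e → c ≢ d → c ≢ e →
              Letters b c x y z w → Relations b x y z
  relations {d = d} {e = e} {w = w} b≢c d≢e b≢d b≢e c≢d c≢e l with sgn-± w
  ... | inj₁ ev = relations-even b≢c d≢e b≢d b≢e c≢d c≢e l ev
  ... | inj₂ od = relations-even {w = transp d e w} b≢c d≢e b≢d b≢e c≢d c≢e
    (letters (trans (⟦transp⟧-0 d≢e w) (at0 l)) (trans (⟦transp⟧-≢ d≢e w b≢d b≢e) (atb l)) (trans (⟦transp⟧-≢ d≢e w c≢d c≢e) (atc l)))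
    (trans (sgn-transp d≢e w) (cong -_ od))

  Trichotomy : ℤ → Set
  Trichotomy a = a ≡ 0ℤ ⊎ (a ≡ N ⊎ a ≡ - N)

  -- Cancelling `N` gives t = 3 u, and |t| ≤ 4 leaves only -1, 0 and 1 for `u`.
  small : ∀ a u t → a ≡ N * u → + 3 * a ≡ N * t → 0ℤ ≤ + 4 - t → 0ℤ ≤ t + + 4 → Trichotomy a
  small a u t a≡ 3a≡ hi lo = go u a≡ (subst (λ t → 0ℤ ≤ + 4 - t) t≡ hi) (subst (λ t → 0ℤ ≤ t + + 4) t≡ lo)
    where
    t≡ : t ≡ + 3 * u
    t≡ = *-cancelˡ-≡ N t (+ 3 * u) {{>-nonZero 0<N}} (trans (sym 3a≡) (trans (cong (+ 3 *_) a≡) (r N u)))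
      where
      r : ∀ N u → + 3 * (N * u) ≡ N * (+ 3 * u)
      r = solve-∀
    go : ∀ u → a ≡ N * u → 0ℤ ≤ + 4 - + 3 * u → 0ℤ ≤ + 3 * u + + 4 → Trichotomy a
    go (+ 0)             e _ _ = inj₁ (trans e (*-zeroʳ N))
    go (+ 1)             e _ _ = inj₂ (inj₁ (trans e (*-identityʳ N)))
    go (+ suc (suc k))   e p _ = contradiction (subst (0ℤ ≤_) (r (+ k)) (0≤-+ (0≤-* (0≤+ 3) (0≤+ k)) p)) 0≰-2
      where
      r : ∀ k → + 3 * k + (+ 4 - + 3 * (+ 2 + k)) ≡ - + 2
      r = solve-∀
    go -[1+ 0 ]          e _ _ = inj₂ (inj₂ (trans e (trans (*-comm N (- 1ℤ)) (-1*i≡-i N))))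
    go -[1+ suc k ]      e _ p = contradiction (subst (0ℤ ≤_) (r (+ k)) (0≤-+ (0≤-* (0≤+ 3) (0≤+ k)) p)) 0≰-2
      where
      r : ∀ k → + 3 * k + (+ 3 * - (+ 2 + k) + + 4) ≡ - + 2
      r = solve-∀

  module _ (b : Fin (4 ℕ.+ n)) where

    private
      c = punchIn b zero
      d = punchIn b (suc zero)
      e = punchIn b (suc (suc zero))
      b≢ : ∀ i → b ≢ punchIn b i
      b≢ i = punchInᵢ≢i b i ∘ sym
      c≢d : c ≢ d
      c≢d q with punchIn-injective b _ _ q
      ... | ()
      c≢e : c ≢ e
      c≢e q with punchIn-injective b _ _ q
      ... | ()
      d≢e : d ≢ e
      d≢e q with punchIn-injective b _ _ q
      ... | ()

    -- For the words xyz, tyz and xyt at 0, b, c the relations say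
    -- Dx − Dy ≡ Dy − Dz, Dt − Dy ≡ Dy − Dz and Dx − Dy ≡ Dy − Dt (mod N), so 2 (Dx − Dy) ≡ 0;
    -- also 3 (Dx − Dy) ≡ 0.
    D-diff : ∀ x y → Trichotomy (D b x - D b y)
    D-diff x y with x ≟ y
    ... | yes refl = inj₁ (+-inverseʳ (D b x))
    ... | no x≢y with code-with b x≢y
    ...   | w , w0 , wb = small (D b x - D b y) (t R₁ - (q R₁ + q R₃ - q R₂)) (t R₁) a≡ (t-eq R₁) (t≤4 R₁) (-4≤t R₁)
      where
      z = ⟦ w ⟧ (suc c)
      t′ = ⟦ w ⟧ (suc d)
      R₁ : Relations b x y z
      R₁ = relations {w = w} (b≢ _) d≢e (b≢ _) (b≢ _) c≢d c≢e (letters w0 wb refl)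
      R₂ : Relations b t′ y z
      R₂ = relations {w = swap d w} (b≢ _) d≢e (b≢ _) (b≢ _) c≢d c≢e
        (letters (⟦swap⟧-0 d w) (trans (⟦swap⟧-≢ d b w (b≢ _)) wb) (⟦swap⟧-≢ d c w c≢d))
      R₃ : Relations b x y t′
      R₃ = relations {w = transp c d w} (b≢ _) d≢e (b≢ _) (b≢ _) c≢d c≢e
        (letters (trans (⟦transp⟧-0 c≢d w) w0) (trans (⟦transp⟧-≢ c≢d w (b≢ _) (b≢ _)) wb) (⟦transp⟧-p c≢d w))
      Dx = D b x
      Dy = D b y
      Dz = D b z
      Dt = D b t′
      r : ∀ x y z t → x - y ≡ + 3 * (x - y) - (((x - y) - (y - z)) + ((x - y) - (y - t)) - ((t - y) - (y - z)))
      r = solve-∀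
      r′ : ∀ N t q₁ q₂ q₃ → N * t - (N * q₁ + N * q₃ - N * q₂) ≡ N * (t - (q₁ + q₃ - q₂))
      r′ = solve-∀
      a≡ : D b x - D b y ≡ N * (t R₁ - (q R₁ + q R₃ - q R₂))
      a≡ = begin
        Dx - Dy
          ≡⟨ r Dx Dy Dz Dt ⟩
        + 3 * (Dx - Dy) - (((Dx - Dy) - (Dy - Dz)) + ((Dx - Dy) - (Dy - Dt)) - ((Dt - Dy) - (Dy - Dz)))
          ≡⟨ cong₂ _-_ (t-eq R₁) (cong₂ _-_ (cong₂ _+_ (q-eq R₁) (q-eq R₃)) (q-eq R₂)) ⟩
        N * t R₁ - (N * q R₁ + N * q R₃ - N * q R₂)
          ≡⟨ r′ N (t R₁) (q R₁) (q R₂) (q R₃) ⟩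
        N * (t R₁ - (q R₁ + q R₃ - q R₂)) ∎

    ∑D : ∑ (D b) ≡ 0ℤ
    ∑D = begin
      ∑ (D b)                                   ≡⟨ ∑-* (+ 2) _ ⟩
      + 2 * ∑ (λ x → M zero x - M (suc b) x)    ≡⟨ cong (+ 2 *_) (∑-- (M zero) (M (suc b))) ⟩
      + 2 * (row M zero - row M (suc b))        ≡⟨ cong₂ (λ x y → + 2 * (x - y)) (row-M zero) (row-M (suc b)) ⟩
      + 2 * (s - s)                             ≡⟨ cong (+ 2 *_) (+-inverseʳ s) ⟩
      0ℤ                                        ∎

    M≤s : ∀ j k → 0ℤ ≤ s - M j k
    M≤s j k = subst (0ℤ ≤_) (trans (r (M j k) (∑ λ l → M j (punchIn k l))) (cong (_- M j k) (trans (sym (∑-punchIn k (M j))) (row-M j)))) (∑-0≤ λ l → M≥0 j (punchIn k l))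
      where
      r : ∀ a b → b ≡ a + b - a
      r = solve-∀

    heavy : ∀ j k → 0ℤ ≤ + 2 * M j k - + (4 ℕ.+ n) * K → M j k ≡ s
    heavy j k p = sym (i-j≡0⇒i≡j s (M j k) (proj₁ (+-zero⁻¹ (M≤s j k) (0≤-cancel {+ 2} (+<+ (ℕ.s≤s ℕ.z≤n)) (subst (0ℤ ≤_) (trans (cong (λ t → + 2 * M j k - t) (sym 2s)) (r (M j k) s)) p)) (r′ s (M j k)))))
      where
      r : ∀ x s → + 2 * x - + 2 * s ≡ + 2 * (x - s)
      r = solve-∀
      r′ : ∀ s x → (s - x) + (x - s) ≡ 0ℤ
      r′ = solve-∀

    module _ (x y : Fin m) (xy≡N : D b x - D b y ≡ N) where

      private
        N≢0 : N ≢ 0ℤ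
        N≢0 eq = <-irrefl (sym eq) 0<N

        kN≢0 : ∀ k → + suc k * N ≢ 0ℤ
        kN≢0 k eq with i*j≡0⇒i≡0∨j≡0 (+ suc k) eq
        ... | inj₂ q = N≢0 q

        no-2N : ∀ a → a ≡ N + N → ¬ Trichotomy a
        no-2N a 2N (inj₁ eq) = kN≢0 1 (trans (r N) (trans (sym 2N) eq))
          where
          r : ∀ N → + 2 * N ≡ N + N
          r = solve-∀
        no-2N a 2N (inj₂ (inj₁ eq)) = kN≢0 0 (trans (r N) (trans (cong (_- N) (trans (sym 2N) eq)) (+-inverseʳ N)))
          where
          r : ∀ N → + 1 * N ≡ N + N - N
          r = solve-∀
        no-2N a 2N (inj₂ (inj₂ eq)) = kN≢0 2 (trans (r N) (trans (cong (_+ N) (trans (sym 2N) eq)) (+-inverseˡ N)))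
          where
          r : ∀ N → + 3 * N ≡ N + N + N
          r = solve-∀

      -- A value above `D b x` would be at distance 2 N from `D b y`, against `D-diff`. So `D b` has
      -- two values, and `ι` indicates the larger.
      ι∃ : ∀ z → ∃ λ i → D b z ≡ D b y + N * i × (i ≡ 0ℤ ⊎ i ≡ 1ℤ)
      ι∃ z with D-diff z x
      ... | inj₁ e′ = 1ℤ , trans (r (D b z) (D b x) (D b y)) (trans (cong₂ (λ s t → D b y + (s + t)) e′ xy≡N) (r′ (D b y) N)) , inj₂ refl
        where
        r : ∀ a b c → a ≡ c + ((a - b) + (b - c))
        r = solve-∀
        r′ : ∀ a N → a + (0ℤ + N) ≡ a + N * 1ℤ
        r′ = solve-∀
      ... | inj₂ (inj₂ e′) = 0ℤ , trans (r (D b z) (D b x) (D b y)) (trans (cong₂ (λ s t → D b y + (s + t)) e′ xy≡N) (r′ (D b y) N)) , inj₁ refl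
        where
        r : ∀ a b c → a ≡ c + ((a - b) + (b - c))
        r = solve-∀
        r′ : ∀ a N → a + (- N + N) ≡ a + N * 0ℤ
        r′ = solve-∀
      ... | inj₂ (inj₁ e′) = contradiction (D-diff z y) (no-2N _ (trans (r (D b z) (D b x) (D b y)) (cong₂ _+_ e′ xy≡N)))
        where
        r : ∀ a b c → a - c ≡ (a - b) + (b - c)
        r = solve-∀

      ι : Fin m → ℤ
      ι z = proj₁ (ι∃ z)

      D≡ : ∀ z → D b z ≡ D b y + N * ι z
      D≡ z = proj₁ (proj₂ (ι∃ z))

      0≤ι : ∀ z → 0ℤ ≤ ι z
      0≤ι z = 01⇒0≤ (proj₂ (proj₂ (ι∃ z)))

      ι≤1 : ∀ z → 0ℤ ≤ 1ℤ - ι z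
      ι≤1 z = 01⇒≤1 (proj₂ (proj₂ (ι∃ z)))

      Nι : ∀ z → N * ι z ≡ D b z - D b y
      Nι z = trans (r (D b y) (N * ι z)) (cong (_- D b y) (sym (D≡ z)))
        where
        r : ∀ a b → b ≡ a + b - a
        r = solve-∀

      ιx : ι x ≡ 1ℤ
      ιx = *-cancelˡ-≡ N (ι x) 1ℤ {{>-nonZero 0<N}} (trans (Nι x) (trans xy≡N (sym (*-identityʳ N))))

      ιy : ι y ≡ 0ℤ
      ιy = *-cancelˡ-≡ N (ι y) 0ℤ {{>-nonZero 0<N}} (trans (Nι y) (trans (+-inverseʳ (D b y)) (sym (*-zeroʳ N))))

      p : ℤ
      p = ∑ ι

      1≤p : 0ℤ ≤ p - 1ℤ
      1≤p = subst (0ℤ ≤_) (trans (r (∑ λ l → ι (punchIn x l))) (cong (_- 1ℤ) (trans (cong (_+ ∑ (λ l → ι (punchIn x l))) (sym ιx)) (sym (∑-punchIn x ι))))) (∑-0≤ λ l → 0≤ι (punchIn x l))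
        where
        r : ∀ a → a ≡ 1ℤ + a - 1ℤ
        r = solve-∀

      p≤4+n : 0ℤ ≤ + (4 ℕ.+ n) - p
      p≤4+n = subst (0ℤ ≤_) eq (∑-0≤ λ l → ι≤1 (punchIn y l))
        where
        r : ∀ a b → b ≡ (a + b) - a
        r = solve-∀
        r′ : ∀ n p → (+ 5 + n) * 1ℤ - p - (1ℤ - 0ℤ) ≡ + 4 + n - p
        r′ = solve-∀
        eq : ∑ (λ l → 1ℤ - ι (punchIn y l)) ≡ + (4 ℕ.+ n) - p
        eq = begin
          ∑ (λ l → 1ℤ - ι (punchIn y l))                                  ≡⟨ r (1ℤ - ι y) _ ⟩
          (1ℤ - ι y) + ∑ (λ l → 1ℤ - ι (punchIn y l)) - (1ℤ - ι y)        ≡⟨ cong (_- (1ℤ - ι y)) (sym (∑-punchIn y (λ z → 1ℤ - ι z))) ⟩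
          ∑ (λ z → 1ℤ - ι z) - (1ℤ - ι y)                                 ≡⟨ cong₂ (λ s t → s - (1ℤ - t)) (trans (∑-- (λ _ → 1ℤ) ι) (cong (_- p) (∑-const m 1ℤ))) ιy ⟩
          + m * 1ℤ - p - (1ℤ - 0ℤ)                                        ≡⟨ r′ (+ n) p ⟩
          + (4 ℕ.+ n) - p                                                 ∎

      Dy : D b y ≡ - (K * p)
      Dy = i-j≡0⇒i≡j (D b y) (- (K * p)) (*-cancelˡ-≡ (+ m) _ 0ℤ (begin
        + m * (D b y - - (K * p))                  ≡⟨ r (+ m) (D b y) K p ⟩
        + m * D b y + N * p                        ≡⟨ cong₂ _+_ (∑-const m (D b y)) (∑-* N ι) ⟨
        ∑ {m} (λ _ → D b y) + ∑ (λ z → N * ι z)    ≡⟨ ∑-+ (λ _ → D b y) _ ⟨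
        ∑ (λ z → D b y + N * ι z)                  ≡⟨ ∑-cong (λ z → sym (D≡ z)) ⟩
        ∑ (D b)                                    ≡⟨ ∑D ⟩
        0ℤ                                         ≡⟨ *-zeroʳ (+ m) ⟨
        + m * 0ℤ                                   ∎))
        where
        r : ∀ m d K p → m * (d - - (K * p)) ≡ m * d + m * K * p
        r = solve-∀

      Dx : D b x ≡ K * (+ m - p)
      Dx = trans (D≡ x) (trans (cong₂ (λ s t → s + N * t) Dy ιx) (r K p (+ m)))
        where
        r : ∀ K p m → - (K * p) + m * K * 1ℤ ≡ K * (m - p)
        r = solve-∀

      2M₀≥ : ∀ z → 0ℤ ≤ + 2 * M zero z - ι z * D b x
      2M₀≥ z with proj₂ (proj₂ (ι∃ z))
      ... | inj₁ e′ = subst (0ℤ ≤_) (trans (r (M zero z) (D b x)) (cong (λ t → + 2 * M zero z - t * D b x) (sym e′))) (0≤-* (0≤+ 2) (M≥0 zero z))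
        where
        r : ∀ a d → + 2 * a ≡ + 2 * a - 0ℤ * d
        r = solve-∀
      ... | inj₂ e′ = subst (0ℤ ≤_) (trans (r (M zero z) (M (suc b) z)) (cong (λ t → + 2 * M zero z - t) (trans Dz≡Dx (sym (trans (cong (_* D b x) e′) (*-identityˡ (D b x))))))) (0≤-* (0≤+ 2) (M≥0 (suc b) z))
        where
        r : ∀ a c → + 2 * c ≡ + 2 * a - + 2 * (a - c)
        r = solve-∀
        Dz≡Dx : D b z ≡ D b x
        Dz≡Dx = trans (D≡ z) (trans (cong (λ t → D b y + N * t) (trans e′ (sym ιx))) (sym (D≡ x)))

      -- At the `p` places where `D b` is large, row 0 has entries at least D x / 2 = K (m - p) / 2.
      -- Its sum `s` forces p (m - p) ≤ m - 1, that is (p - 1)(m - 1 - p) ≤ 0, while both factors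
      -- are nonnegative.
      product≡0 : (p - 1ℤ) * (+ (4 ℕ.+ n) - p) ≡ 0ℤ
      product≡0 = proj₁ (+-zero⁻¹ (0≤-* 1≤p p≤4+n) (0≤-cancel 0<K (subst (0ℤ ≤_) eq (∑-0≤ 2M₀≥))) (+-inverseʳ ((p - 1ℤ) * (+ (4 ℕ.+ n) - p))))
        where
        r : ∀ n K p → (+ 4 + n) * K - p * (K * (+ 5 + n - p)) ≡ K * - ((p - 1ℤ) * (+ 4 + n - p))
        r = solve-∀
        eq : ∑ (λ z → + 2 * M zero z - ι z * D b x) ≡ K * - ((p - 1ℤ) * (+ (4 ℕ.+ n) - p))
        eq = begin
          ∑ (λ z → + 2 * M zero z - ι z * D b x)             ≡⟨ ∑-- _ _ ⟩
          ∑ (λ z → + 2 * M zero z) - ∑ (λ z → ι z * D b x)   ≡⟨ cong₂ _-_ (trans (∑-* (+ 2) (M zero)) (trans (cong (+ 2 *_) (row-M zero)) 2s)) (trans (∑-*ʳ (D b x) ι) (cong (p *_) Dx)) ⟩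
          + (4 ℕ.+ n) * K - p * (K * (+ m - p))              ≡⟨ r (+ n) K p ⟩
          K * - ((p - 1ℤ) * (+ (4 ℕ.+ n) - p))               ∎

      -- If p = 1, then `D b x` is 2 s and row 0 is concentrated at `x`. If p = m - 1, then `D b y`
      -- is -2 s and row `b + 1` is concentrated at `y`.
      two-values : ∃₂ λ j k → M j k ≡ s
      two-values = [ p≡1 , p≡4+n ]′ (i*j≡0⇒i≡0∨j≡0 (p - 1ℤ) {+ (4 ℕ.+ n) - p} product≡0)
        where
        p≡1 : p - 1ℤ ≡ 0ℤ → ∃₂ λ j k → M j k ≡ s
        p≡1 e′ = zero , x , heavy zero x (subst (0ℤ ≤_) eq (0≤-* (0≤+ 2) (M≥0 (suc b) x)))
          where
          r : ∀ a c → + 2 * c ≡ + 2 * a - + 2 * (a - c)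
          r = solve-∀
          r′ : ∀ K n → K * (+ 5 + n - 1ℤ) ≡ (+ 4 + n) * K
          r′ = solve-∀
          eq : + 2 * M (suc b) x ≡ + 2 * M zero x - + (4 ℕ.+ n) * K
          eq = begin
            + 2 * M (suc b) x                      ≡⟨ r (M zero x) (M (suc b) x) ⟩
            + 2 * M zero x - D b x                 ≡⟨ cong (λ t → + 2 * M zero x - t) Dx ⟩
            + 2 * M zero x - K * (+ m - p)         ≡⟨ cong (λ t → + 2 * M zero x - K * (+ m - t)) (i-j≡0⇒i≡j p 1ℤ e′) ⟩
            + 2 * M zero x - K * (+ m - 1ℤ)        ≡⟨ cong (λ t → + 2 * M zero x - t) (r′ K (+ n)) ⟩
            + 2 * M zero x - + (4 ℕ.+ n) * K       ∎
        p≡4+n : + (4 ℕ.+ n) - p ≡ 0ℤ → ∃₂ λ j k → M j k ≡ s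
        p≡4+n e′ = suc b , y , heavy (suc b) y (subst (0ℤ ≤_) eq (0≤-* (0≤+ 2) (M≥0 zero y)))
          where
          r : ∀ a c → + 2 * a ≡ + 2 * c + + 2 * (a - c)
          r = solve-∀
          r′ : ∀ K q a → a + - (K * q) ≡ a - q * K
          r′ = solve-∀
          eq : + 2 * M zero y ≡ + 2 * M (suc b) y - + (4 ℕ.+ n) * K
          eq = begin
            + 2 * M zero y                                 ≡⟨ r (M zero y) (M (suc b) y) ⟩
            + 2 * M (suc b) y + D b y                      ≡⟨ cong (λ t → + 2 * M (suc b) y + t) Dy ⟩
            + 2 * M (suc b) y + - (K * p)                  ≡⟨ cong (λ t → + 2 * M (suc b) y + - (K * t)) (i-j≡0⇒i≡j (+ (4 ℕ.+ n)) p e′) ⟨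
            + 2 * M (suc b) y + - (K * + (4 ℕ.+ n))        ≡⟨ r′ K (+ (4 ℕ.+ n)) (+ 2 * M (suc b) y) ⟩
            + 2 * M (suc b) y - + (4 ℕ.+ n) * K            ∎

    -- `D b` has sum 0, so it is not constant once it is nonzero somewhere. Of two different values
    -- the larger one plays the part of `x` in `two-values`.
    nonconstant : ∀ x → D b x ≢ 0ℤ → ∃₂ λ j k → M j k ≡ s
    nonconstant x Dx≢0 with any? (λ y → ¬? (D b x - D b y ≟ᶻ 0ℤ))
    ... | no all = contradiction (*-cancelˡ-≡ (+ m) (D b x) 0ℤ (trans (sym (∑-const m (D b x))) (trans (∑-cong same-as) (trans ∑D (sym (*-zeroʳ (+ m))))))) Dx≢0
      where
      same-as : ∀ y → D b x ≡ D b y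
      same-as y = i-j≡0⇒i≡j (D b x) (D b y) (decidable-stable (D b x - D b y ≟ᶻ 0ℤ) (λ ne → all (y , ne)))
    ... | yes (y , ne) with D-diff x y
    ...   | inj₁ e′        = contradiction e′ ne
    ...   | inj₂ (inj₁ e′) = two-values x y e′
    ...   | inj₂ (inj₂ e′) = two-values y x (trans (r (D b x) (D b y)) (trans (cong -_ e′) (neg-involutive N)))
      where
      r : ∀ a c → c - a ≡ - (a - c)
      r = solve-∀

  sgn-id : ∀ k → sgn (id-code k) ≡ 1ℤ
  sgn-id zero    = refl
  sgn-id (suc k) = trans (*-identityˡ (sgn (id-code k))) (sgn-id k)

  -- If all rows of `M` agree, `F M` is constantly `s`. Then `linear` at the identity reads K = m K
  -- f, impossible for the values 0 and 1 of `f`.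
  concentrated : ∃₂ λ j k → M j k ≡ s
  concentrated with any? (λ b → any? (λ x → ¬? (D b x ≟ᶻ 0ℤ)))
  ... | yes (b , x , ne) = nonconstant b x ne
  ... | no all = contradiction (trans (sym 2s) (trans (cong (+ 2 *_) (sym F≡s)) (linear w (sgn-id m)))) absurd
    where
    w = id-code m
    D≡0 : ∀ b x → D b x ≡ 0ℤ
    D≡0 b x = decidable-stable (D b x ≟ᶻ 0ℤ) (λ ne → all (b , x , ne))
    rows : ∀ j x → M j x ≡ M zero x
    rows zero    x = refl
    rows (suc b) x = sym (i-j≡0⇒i≡j (M zero x) (M (suc b) x) (*-cancelˡ-≡ (+ 2) _ 0ℤ (D≡0 b x)))
    F≡s : F M w ≡ s
    F≡s = trans (∑-cong λ j → rows j (⟦ w ⟧ j)) (trans (∑-⟦⟧ w (M zero)) (row-M zero))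
    0≢aK : ∀ a → + suc a * K ≢ 0ℤ
    0≢aK a eq with i*j≡0⇒i≡0∨j≡0 (+ suc a) eq
    ... | inj₂ K≡0 = <-irrefl (sym K≡0) 0<K
    absurd : + (4 ℕ.+ n) * K ≢ N * f w + + (3 ℕ.+ n) * K
    absurd eq with f01 w
    ... | inj₁ e′ = 0≢aK 0 (trans (r (+ n) K) (trans (cong (_- + (3 ℕ.+ n) * K) (trans eq (cong (λ t → N * t + + (3 ℕ.+ n) * K) e′))) (r′ N (+ (3 ℕ.+ n) * K))))
      where
      r : ∀ n K → + 1 * K ≡ (+ 4 + n) * K - (+ 3 + n) * K
      r = solve-∀
      r′ : ∀ N a → N * 0ℤ + a - a ≡ 0ℤ
      r′ = solve-∀
    ... | inj₂ e′ = 0≢aK (3 ℕ.+ n) (trans (r (+ n) K) (trans (cong (λ t → N * 1ℤ + + (3 ℕ.+ n) * K - t) (trans eq (cong (λ t → N * t + + (3 ℕ.+ n) * K) e′))) (+-inverseʳ (N * 1ℤ + + (3 ℕ.+ n) * K))))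
      where
      r : ∀ n K → (+ 4 + n) * K ≡ (+ 5 + n) * K * 1ℤ + (+ 3 + n) * K - (+ 4 + n) * K
      r = solve-∀

-- From permutations to codes

opaque
  enc : ∀ {n} → Permutation′ n → Code n
  enc {zero}  π = []
  enc {suc n} π = (π ⟨$⟩ʳ zero) ∷ enc (remove zero π)

  ⟦enc⟧ : ∀ {n} (π : Permutation′ n) x → ⟦ enc π ⟧ x ≡ π ⟨$⟩ʳ x
  ⟦enc⟧ {suc n} π zero    = refl
  ⟦enc⟧ {suc n} π (suc x) = trans (cong (punchIn (π ⟨$⟩ʳ zero)) (⟦enc⟧ (remove zero π) x)) (sym (punchIn-permute π zero x))

enc-cong : ∀ {n} {π σ : Permutation′ n} → π ≈ σ → enc π ≡ enc σ
enc-cong {π = π} {σ} e = ⟦⟧-ext (enc π) (enc σ) λ x → trans (⟦enc⟧ π x) (trans (e x) (sym (⟦enc⟧ σ x)))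

enc-injective : ∀ {n} {π σ : Permutation′ n} → enc π ≡ enc σ → π ≈ σ
enc-injective {π = π} {σ} e x = trans (sym (⟦enc⟧ π x)) (trans (cong (λ w → ⟦ w ⟧ x) e) (⟦enc⟧ σ x))

dec : ∀ {n} → Code n → Permutation′ n
dec []      = idₚ
dec (k ∷ u) = insert zero k (dec u)

dec-⟦⟧ : ∀ {n} (w : Code n) x → dec w ⟨$⟩ʳ x ≡ ⟦ w ⟧ x
dec-⟦⟧ (k ∷ u) zero    = refl
dec-⟦⟧ (k ∷ u) (suc x) = trans (insert-punchIn zero k (dec u) x) (cong (punchIn k) (dec-⟦⟧ u x))

enc-dec : ∀ {n} (w : Code n) → enc (dec w) ≡ w
enc-dec w = ⟦⟧-ext _ w λ x → trans (⟦enc⟧ (dec w) x) (dec-⟦⟧ w x)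

lsum : ∀ {a} {X : Set a} → (X → ℤ) → List X → ℤ
lsum g []       = 0ℤ
lsum g (x ∷ xs) = g x + lsum g xs

lsum-++ : ∀ {a} {X : Set a} (g : X → ℤ) xs ys → lsum g (xs ++ ys) ≡ lsum g xs + lsum g ys
lsum-++ g []       ys = sym (+-identityˡ (lsum g ys))
lsum-++ g (x ∷ xs) ys = trans (+-congˡ (g x) (lsum-++ g xs ys)) (sym (+-assoc (g x) (lsum g xs) (lsum g ys)))

lsum-map : ∀ {a b} {X : Set a} {Y : Set b} (g : Y → ℤ) (h : X → Y) xs → lsum g (map h xs) ≡ lsum (g ∘ h) xs
lsum-map g h []       = refl
lsum-map g h (x ∷ xs) = +-congˡ (g (h x)) (lsum-map g h xs)

lsum-× : ∀ {a b} {X : Set a} {Y : Set b} (g : X × Y → ℤ) xs ys →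
         lsum g (cartesianProduct xs ys) ≡ lsum (λ x → lsum (λ y → g (x , y)) ys) xs
lsum-× g []       ys = refl
lsum-× g (x ∷ xs) ys = trans (lsum-++ g (map (x ,_) ys) _) (cong₂ _+_ (lsum-map g (x ,_) ys) (lsum-× g xs ys))

lsum-tabulate : ∀ {a} {X : Set a} {n} (g : X → ℤ) (h : Fin n → X) → lsum g (tabulate h) ≡ ∑ (g ∘ h)
lsum-tabulate {n = zero}  g h = sym (∑-zero _)
lsum-tabulate {n = suc n} g h = trans (+-congˡ (g (h zero)) (lsum-tabulate g (h ∘ suc))) (sym (∑-suc _))

bit : Bool → ℤ
bit true  = 1ℤ
bit false = 0ℤ

bit-∧ : ∀ a b → bit (a ∧ b) ≡ bit a * bit b
bit-∧ true  b = sym (*-identityˡ (bit b))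
bit-∧ false b = refl

length-filter : ∀ {a p} {X : Set a} {P : Pred X p} (P? : Decidable P) xs →
                + length (filter P? xs) ≡ lsum (λ x → bit (does (P? x))) xs
length-filter P? []       = refl
length-filter P? (x ∷ xs) with does (P? x)
... | true  = +-congˡ 1ℤ (length-filter P? xs)
... | false = trans (length-filter P? xs) (sym (+-identityˡ _))

-- The Lehmer code counts inversions

lt : ∀ {n} → Fin n → Fin n → ℤ
lt i j = bit (toℕ i <ᵇ toℕ j)

lt-punchIn : ∀ {n} (k : Fin (suc n)) (a b : Fin n) → lt (punchIn k a) (punchIn k b) ≡ lt a b
lt-punchIn zero    a       b       = refl
lt-punchIn (suc k) zero    zero    = refl
lt-punchIn (suc k) zero    (suc b) = refl
lt-punchIn (suc k) (suc a) zero    = refl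
lt-punchIn (suc k) (suc a) (suc b) = lt-punchIn k a b

∑-lt : ∀ {n} (k : Fin (suc n)) → ∑ (λ l → lt (punchIn k l) k) ≡ + toℕ k
∑-lt {n}     zero    = ∑-0 λ l → refl
∑-lt {suc n} (suc k) = trans (∑-suc _) (+-congˡ 1ℤ (∑-lt k))

digits : ∀ {n} → Code n → ℕ
digits []      = 0
digits (k ∷ u) = toℕ k ℕ.+ digits u

inversions-code : ∀ {n} (w : Code n) → ∑ (λ i → ∑ (λ j → lt i j * lt (⟦ w ⟧ j) (⟦ w ⟧ i))) ≡ + digits w
inversions-code []      = ∑-zero _
inversions-code (k ∷ u) = begin
  ∑ (λ i → ∑ (λ j → lt i j * lt (⟦ k ∷ u ⟧ j) (⟦ k ∷ u ⟧ i)))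
    ≡⟨ ∑-suc _ ⟩
  ∑ (λ j → lt zero j * lt (⟦ k ∷ u ⟧ j) k) + ∑ (λ i → ∑ (λ j → lt (suc i) j * lt (⟦ k ∷ u ⟧ j) (⟦ k ∷ u ⟧ (suc i))))
    ≡⟨ cong₂ _+_ first (∑-cong rest) ⟩
  + toℕ k + ∑ (λ i → ∑ (λ j → lt i j * lt (⟦ u ⟧ j) (⟦ u ⟧ i)))
    ≡⟨ +-congˡ (+ toℕ k) (inversions-code u) ⟩
  + toℕ k + + digits u ∎
  where
  open ≡-Reasoning
  first : ∑ (λ j → lt zero j * lt (⟦ k ∷ u ⟧ j) k) ≡ + toℕ k
  first = begin
    ∑ (λ j → lt zero j * lt (⟦ k ∷ u ⟧ j) k)              ≡⟨ ∑-suc _ ⟩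
    0ℤ * lt k k + ∑ (λ j → 1ℤ * lt (punchIn k (⟦ u ⟧ j)) k)   ≡⟨ cong₂ _+_ (*-zeroˡ (lt k k)) (∑-cong λ j → *-identityˡ (lt (punchIn k (⟦ u ⟧ j)) k)) ⟩
    0ℤ + ∑ (λ j → lt (punchIn k (⟦ u ⟧ j)) k)             ≡⟨ +-identityˡ _ ⟩
    ∑ (λ j → lt (punchIn k (⟦ u ⟧ j)) k)                  ≡⟨ ∑-⟦⟧ u (λ l → lt (punchIn k l) k) ⟩
    ∑ (λ l → lt (punchIn k l) k)                          ≡⟨ ∑-lt k ⟩
    + toℕ k                                               ∎
  rest : ∀ i → ∑ (λ j → lt (suc i) j * lt (⟦ k ∷ u ⟧ j) (⟦ k ∷ u ⟧ (suc i))) ≡ ∑ (λ j → lt i j * lt (⟦ u ⟧ j) (⟦ u ⟧ i))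
  rest i = trans (∑-suc _) (trans (cong₂ _+_ (*-zeroˡ (lt k (punchIn k (⟦ u ⟧ i)))) (∑-cong λ j → cong (lt i j *_) (lt-punchIn k (⟦ u ⟧ j) (⟦ u ⟧ i)))) (+-identityˡ _))

inversions-enc : ∀ {n} (π : Permutation′ n) → inversions π ≡ digits (enc π)
inversions-enc {n} π = +-injective (begin
  + inversions π
    ≡⟨ length-filter _ (cartesianProduct (allFin n) (allFin n)) ⟩
  lsum _ (cartesianProduct (allFin n) (allFin n))
    ≡⟨ lsum-× _ (allFin n) (allFin n) ⟩
  lsum _ (allFin n)
    ≡⟨ lsum-tabulate _ (λ i → i) ⟩
  ∑ (λ i → lsum _ (allFin n))
    ≡⟨ ∑-cong (λ i → lsum-tabulate _ (λ j → j)) ⟩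
  ∑ (λ i → ∑ (λ j → bit ((toℕ i <ᵇ toℕ j) ∧ (toℕ (π ⟨$⟩ʳ j) <ᵇ toℕ (π ⟨$⟩ʳ i)))))
    ≡⟨ ∑-cong (λ i → ∑-cong λ j → trans (bit-∧ (toℕ i <ᵇ toℕ j) _) (cong₂ (λ a b → lt i j * lt a b) (sym (⟦enc⟧ π j)) (sym (⟦enc⟧ π i)))) ⟩
  ∑ (λ i → ∑ (λ j → lt i j * lt (⟦ enc π ⟧ j) (⟦ enc π ⟧ i)))
    ≡⟨ inversions-code (enc π) ⟩
  + digits (enc π) ∎)
  where open ≡-Reasoning

altSign-+ : ∀ a b → altSign (a ℕ.+ b) ≡ altSign a * altSign b
altSign-+ zero    b = sym (*-identityˡ (altSign b))
altSign-+ (suc a) b = trans (cong -_ (altSign-+ a b)) (neg-distribˡ-* (altSign a) (altSign b))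

altSign-toℕ : ∀ {n} (k : Fin n) → altSign (toℕ k) ≡ ε k
altSign-toℕ zero    = refl
altSign-toℕ (suc k) = cong -_ (altSign-toℕ k)

altSign-digits : ∀ {n} (w : Code n) → altSign (digits w) ≡ sgn w
altSign-digits []      = refl
altSign-digits (k ∷ u) = trans (altSign-+ (toℕ k) (digits u)) (cong₂ _*_ (altSign-toℕ k) (altSign-digits u))

altSign-even : ∀ k → k % 2 ≡ 0 → altSign k ≡ 1ℤ
altSign-even zero          e = refl
altSign-even (suc (suc k)) e = trans (neg-involutive (altSign k)) (altSign-even k e)

altSign-odd : ∀ k → k % 2 ≡ 1 → altSign k ≡ - 1ℤ
altSign-odd (suc zero)    e = refl
altSign-odd (suc (suc k)) e = trans (neg-involutive (altSign k)) (altSign-odd k e)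

even⇐altSign : ∀ k → altSign k ≡ 1ℤ → k % 2 ≡ 0
even⇐altSign zero          e = refl
even⇐altSign (suc (suc k)) e = even⇐altSign k (trans (sym (neg-involutive (altSign k))) e)

IsEven⇒sgn : ∀ {n} (π : Permutation′ n) → IsEven π → sgn (enc π) ≡ 1ℤ
IsEven⇒sgn π e = trans (sym (altSign-digits (enc π))) (altSign-even (digits (enc π)) (subst (λ k → k % 2 ≡ 0) (inversions-enc π) e))

sgn⇒IsEven : ∀ {n} (π : Permutation′ n) → sgn (enc π) ≡ 1ℤ → IsEven π
sgn⇒IsEven π e = subst (λ k → k % 2 ≡ 0) (sym (inversions-enc π)) (even⇐altSign (digits (enc π)) (trans (altSign-digits (enc π)) e))

-- Full cycles

csucc-fromℕ : ∀ m → csucc (fromℕ m) ≡ zero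
csucc-fromℕ m with suc (toℕ (fromℕ m)) ℕₚ.<? suc m
... | yes p = contradiction (subst (ℕ._< m) (toℕ-fromℕ m) (ℕ.s<s⁻¹ p)) (ℕₚ.<-irrefl refl)
... | no _  = refl

csucc-inject₁ : ∀ {m} (i : Fin m) → csucc (inject₁ i) ≡ suc i
csucc-inject₁ {m} i with suc (toℕ (inject₁ i)) ℕₚ.<? suc m
... | yes p = toℕ-injective (trans (toℕ-fromℕ< p) (cong suc (toℕ-inject₁ i)))
... | no ¬p = contradiction (ℕ.s<s (subst (ℕ._< m) (sym (toℕ-inject₁ i)) (toℕ<n i))) ¬p

cpred : ∀ {m} → Fin (suc m) → Fin (suc m)
cpred zero    = fromℕ _
cpred (suc i) = inject₁ i

csuccₚ : ∀ {m} → Permutation′ (suc m)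
csuccₚ = permutation csucc cpred csucc-cpred cpred-csucc
  where
  csucc-cpred : ∀ x → csucc (cpred x) ≡ x
  csucc-cpred zero    = csucc-fromℕ _
  csucc-cpred (suc i) = csucc-inject₁ i
  cpred-csucc : ∀ x → cpred (csucc x) ≡ x
  cpred-csucc x with topView x
  ... | ‵fromℕ     = cong cpred (csucc-fromℕ _)
  ... | ‵inject₁ i = cong cpred (csucc-inject₁ i)

Enumerates : ∀ {m} → Permutation′ (suc m) → Permutation′ (suc m) → Set
Enumerates a c = ∀ k → c ⟨$⟩ʳ (a ⟨$⟩ʳ k) ≡ a ⟨$⟩ʳ csucc k

-- Rotating an enumeration by one place makes the successor of its last element the last one, so any
-- element can be brought to the end. `extend-cycle` inserts the new point right after it.
rotate-to : ∀ {m} (a c : Permutation′ (suc m)) → Enumerates a c → ∀ p →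
            ∃ λ a′ → Enumerates a′ c × a′ ⟨$⟩ʳ fromℕ m ≡ a ⟨$⟩ʳ p
rotate-to {m} a c e = <-weakInduction _
  (csuccₚ ∘ₚ a , (λ k → e (csucc k)) , cong (a ⟨$⟩ʳ_) (csucc-fromℕ m))
  λ i (a′ , e′ , l) → csuccₚ ∘ₚ a′ , (λ k → e′ (csucc k)) ,
    trans (sym (e′ (fromℕ m))) (trans (cong (c ⟨$⟩ʳ_) l) (trans (e (inject₁ i)) (cong (a ⟨$⟩ʳ_) (csucc-inject₁ i))))

τ-i : ∀ {n} (i : Fin n) → transpose zero (suc i) ⟨$⟩ʳ suc i ≡ zero
τ-i i rewrite dec-true (i ≟ i) refl = refl

τ-≢ : ∀ {n} {i j : Fin n} → j ≢ i → transpose zero (suc i) ⟨$⟩ʳ suc j ≡ suc j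
τ-≢ {i = i} {j} j≢i rewrite dec-false (j ≟ i) j≢i = refl

-- (0 i+1) followed by a cycle c of the other points inserts 0 after i+1.
extend-cycle : ∀ {m} (c : Permutation′ (suc m)) (i : Fin (suc m)) → IsNCycle c →
               IsNCycle (transpose zero (suc i) ∘ₚ lift₀ c)
extend-cycle {m} c i (a₀ , e₀) with rotate-to a₀ c e₀ (a₀ ⟨$⟩ˡ i)
-- With `i` last, the new cycle is 0 followed by the old one in order; it ends in `i + 1`, which
-- returns to 0.
... | a , e , last′ = lift₀ a , enum
  where
  open ≡-Reasoning
  last : a ⟨$⟩ʳ fromℕ m ≡ i
  last = trans last′ (inverseʳ a₀)
  c⁺ = transpose zero (suc i) ∘ₚ lift₀ c
  enum : Enumerates (lift₀ a) c⁺
  enum zero = cong suc (trans (cong (c ⟨$⟩ʳ_) (sym last)) (trans (e (fromℕ m)) (cong (a ⟨$⟩ʳ_) (csucc-fromℕ m))))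
  enum (suc k) with topView k
  ... | ‵fromℕ = begin
    c⁺ ⟨$⟩ʳ suc (a ⟨$⟩ʳ fromℕ m)       ≡⟨ cong (λ x → c⁺ ⟨$⟩ʳ suc x) last ⟩
    c⁺ ⟨$⟩ʳ suc i                      ≡⟨ cong (lift₀ c ⟨$⟩ʳ_) (τ-i i) ⟩
    zero                               ≡⟨ cong (lift₀ a ⟨$⟩ʳ_) (csucc-fromℕ (suc m)) ⟨
    lift₀ a ⟨$⟩ʳ csucc (fromℕ (suc m)) ∎
  ... | ‵inject₁ j = begin
    c⁺ ⟨$⟩ʳ suc (a ⟨$⟩ʳ inject₁ j)             ≡⟨ cong (lift₀ c ⟨$⟩ʳ_) (τ-≢ a≢i) ⟩
    suc (c ⟨$⟩ʳ (a ⟨$⟩ʳ inject₁ j))            ≡⟨ cong suc (e (inject₁ j)) ⟩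
    suc (a ⟨$⟩ʳ csucc (inject₁ j))             ≡⟨ cong (λ x → suc (a ⟨$⟩ʳ x)) (csucc-inject₁ j) ⟩
    suc (a ⟨$⟩ʳ suc j)                         ≡⟨ cong (lift₀ a ⟨$⟩ʳ_) (csucc-inject₁ (suc j)) ⟨
    lift₀ a ⟨$⟩ʳ csucc (suc (inject₁ j))       ∎
    where
    a≢i : a ⟨$⟩ʳ inject₁ j ≢ i
    a≢i q = 0≢suc (trans (sym (csucc-fromℕ m)) (trans (cong csucc (sym eq)) (csucc-inject₁ j)))
      where
      0≢suc : ∀ {n} {x : Fin n} → zero ≢ suc x
      0≢suc ()
      eq : inject₁ j ≡ fromℕ m
      eq = trans (sym (inverseˡ a)) (trans (cong (a ⟨$⟩ˡ_) (trans q (sym last))) (inverseˡ a))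

-- `A f w` evaluates `f` only at `w ∘ c` with full cycles `c`: each factor of `A` prolongs the cycle
-- by one point as in `extend-cycle`.
A-vanishes : ∀ {n} (f : Code (suc n) → ℤ) w →
             (∀ v (c : Permutation′ (suc n)) → IsNCycle c → (∀ x → ⟦ v ⟧ x ≡ ⟦ w ⟧ (c ⟨$⟩ʳ x)) → f v ≡ 0ℤ) →
             A f w ≡ 0ℤ
A-vanishes {zero}  f w       h = h w idₚ (idₚ , λ { zero → refl }) λ x → refl
A-vanishes {suc n} f (k ∷ u) h = A-vanishes (λ v → J f (k ∷ v)) u λ v c cyc e →
  ∑-0 λ i → h (swap i (k ∷ v)) (transpose zero (suc i) ∘ₚ lift₀ c) (extend-cycle c i cyc) (agree v c e i)
  where
  lifted : ∀ v c → (∀ x → ⟦ v ⟧ x ≡ ⟦ u ⟧ (c ⟨$⟩ʳ x)) → ∀ x → ⟦ k ∷ v ⟧ x ≡ ⟦ k ∷ u ⟧ (lift₀ c ⟨$⟩ʳ x)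
  lifted v c e zero    = refl
  lifted v c e (suc x) = cong (punchIn k) (e x)
  agree : ∀ v c → (∀ x → ⟦ v ⟧ x ≡ ⟦ u ⟧ (c ⟨$⟩ʳ x)) → ∀ i x →
          ⟦ swap i (k ∷ v) ⟧ x ≡ ⟦ k ∷ u ⟧ ((transpose zero (suc i) ∘ₚ lift₀ c) ⟨$⟩ʳ x)
  agree v c e i x = trans (swap-τ x) (lifted v c e (transpose zero (suc i) ⟨$⟩ʳ x))
    where
    swap-τ : ∀ x → ⟦ swap i (k ∷ v) ⟧ x ≡ ⟦ k ∷ v ⟧ (transpose zero (suc i) ⟨$⟩ʳ x)
    swap-τ zero    = ⟦swap⟧-0 i (k ∷ v)
    swap-τ (suc j) = by (j ≟ i)
      where
      by : Dec (j ≡ i) → ⟦ swap i (k ∷ v) ⟧ (suc j) ≡ ⟦ k ∷ v ⟧ (transpose zero (suc i) ⟨$⟩ʳ suc j)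
      by (yes refl) = trans (⟦swap⟧-i i (k ∷ v)) (cong ⟦ k ∷ v ⟧ (sym (τ-i i)))
      by (no j≢i)   = trans (⟦swap⟧-≢ i j (k ∷ v) j≢i) (cong ⟦ k ∷ v ⟧ (sym (τ-≢ j≢i)))

-- The indicator function of a list of permutations

δ-dec : ∀ {n} (i j : Fin n) → (i ≡ j × δ i j ≡ 1ℤ) ⊎ (i ≢ j × δ i j ≡ 0ℤ)
δ-dec zero    zero    = inj₁ (refl , refl)
δ-dec zero    (suc j) = inj₂ ((λ ()) , refl)
δ-dec (suc i) zero    = inj₂ ((λ ()) , refl)
δ-dec (suc i) (suc j) with δ-dec i j
... | inj₁ (refl , e) = inj₁ (refl , e)
... | inj₂ (i≢j , e)  = inj₂ ((λ { refl → i≢j refl }) , e)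

δₚ : ∀ {n} → Code n → Code n → ℤ
δₚ []      []      = 1ℤ
δₚ (k ∷ u) (l ∷ v) = δ k l * δₚ u v

δₚ-dec : ∀ {n} (v w : Code n) → (v ≡ w × δₚ v w ≡ 1ℤ) ⊎ (v ≢ w × δₚ v w ≡ 0ℤ)
δₚ-dec []      []      = inj₁ (refl , refl)
δₚ-dec (k ∷ u) (l ∷ v) with δ-dec k l | δₚ-dec u v
... | inj₁ (refl , e) | inj₁ (refl , e′) = inj₁ (refl , cong₂ _*_ e e′)
... | inj₁ (refl , e) | inj₂ (u≢v , e′)  = inj₂ ((λ { refl → u≢v refl }) , trans (cong (δ k k *_) e′) (*-zeroʳ (δ k k)))
... | inj₂ (k≢l , e)  | _                = inj₂ ((λ { refl → k≢l refl }) , trans (cong (_* δₚ u v) e) (*-zeroˡ (δₚ u v)))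

∑ₚ-δₚ : ∀ {n} (v : Code n) → ∑ₚ (δₚ v) ≡ 1ℤ
∑ₚ-δₚ []      = ∑ₚ-[] _
∑ₚ-δₚ (k ∷ u) = begin
  ∑ₚ (δₚ (k ∷ u))                       ≡⟨ ∑ₚ-∷ _ ⟩
  ∑ (λ l → ∑ₚ (λ v → δ k l * δₚ u v))   ≡⟨ ∑-cong (λ l → ∑ₚ-* (δ k l) (δₚ u)) ⟩
  ∑ (λ l → δ k l * ∑ₚ (δₚ u))           ≡⟨ ∑-δ k (λ _ → ∑ₚ (δₚ u)) ⟩
  ∑ₚ (δₚ u)                             ≡⟨ ∑ₚ-δₚ u ⟩
  1ℤ                                    ∎
  where open ≡-Reasoning

Has : ∀ {n} → List (Permutation′ n) → Code n → Set
Has S w = Any (λ π → enc π ≡ w) S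

-- As a count with multiplicity it has the length of `S` as its total; the distinctness of the
-- entries makes its values 0 and 1.
ind : ∀ {n} → List (Permutation′ n) → Code n → ℤ
ind S w = lsum (λ π → δₚ (enc π) w) S

∑ₚ-ind : ∀ {n} (S : List (Permutation′ n)) → ∑ₚ (ind S) ≡ + length S
∑ₚ-ind []      = ∑ₚ-0 λ _ → refl
∑ₚ-ind (π ∷ S) = trans (∑ₚ-+ _ _) (cong₂ _+_ (∑ₚ-δₚ (enc π)) (∑ₚ-ind S))

ind-spec : ∀ {n} {S : List (Permutation′ n)} → AllPairs (λ π σ → ¬ (π ≈ σ)) S → ∀ w →
           (Has S w × ind S w ≡ 1ℤ) ⊎ (¬ Has S w × ind S w ≡ 0ℤ)
ind-spec []           w = inj₂ ((λ ()) , refl)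
ind-spec {S = π ∷ S} (π∉ ∷ distinct) w with δₚ-dec (enc π) w | ind-spec distinct w
... | inj₁ (refl , e) | inj₁ (has , _) = contradiction (Any.map (λ e → enc-injective (sym e)) has) (All¬⇒¬Any π∉)
... | inj₁ (refl , e) | inj₂ (_ , e′)   = inj₁ (here refl , cong₂ _+_ e e′)
... | inj₂ (_ , e)    | inj₁ (has , e′) = inj₁ (there has , cong₂ _+_ e e′)
... | inj₂ (ne , e)   | inj₂ (¬has , e′) = inj₂ ((λ { (here q) → ne q ; (there q) → ¬has q }) , cong₂ _+_ e e′)

∑ₚ-at : ∀ {n} (h : Code (suc n) → ℤ) i j → ∑ₚ (λ w → δ j (⟦ w ⟧ i) * h w) ≡ Marg h i j
∑ₚ-at h i j = begin
  ∑ₚ (λ w → δ j (⟦ w ⟧ i) * h w)                                      ≡⟨ ∑ₚ-ins i _ ⟩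
  ∑ (λ l → ∑ₚ (λ u → δ j (⟦ ins i l u ⟧ i) * h (ins i l u)))          ≡⟨ ∑-cong (λ l → trans (∑ₚ-cong λ u → cong (λ t → δ j t * h (ins i l u)) (⟦ins⟧-j i l u)) (∑ₚ-* (δ j l) _)) ⟩
  ∑ (λ l → δ j l * Marg h i l)                                        ≡⟨ ∑-δ j (Marg h i) ⟩
  Marg h i j                                                          ∎
  where open ≡-Reasoning

half-≤ : ∀ l q → 2 ℕ.* l ℕ.≤ q → l ℕ.≤ q / 2
half-≤ l q p = subst (ℕ._≤ q / 2) (m*n/n≡m l 2) (/-monoˡ-≤ 2 (subst (ℕ._≤ q) (ℕₚ.*-comm 2 l) p))

half-≡ : ∀ l q → 2 ∣ q → l ≡ q / 2 ⇔ 2 ℕ.* l ≡ q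
half-≡ l q 2∣q = mk⇔
  (λ e → trans (ℕₚ.*-comm 2 l) (trans (cong (ℕ._* 2) e) (m/n*n≡m 2∣q)))
  (λ e → trans (sym (m*n/n≡m l 2)) (cong (_/ 2) (trans (ℕₚ.*-comm l 2) e)))

Has⇒sgn : ∀ {n} {S : List (Permutation′ n)} → All IsEven S → ∀ {w} → Has S w → sgn w ≡ 1ℤ
Has⇒sgn {S = π ∷ S} (e ∷ _)  (here refl) = IsEven⇒sgn π e
Has⇒sgn {S = π ∷ S} (_ ∷ es) (there has) = Has⇒sgn es has

module _ {m : ℕ} (S : List (Permutation′ (suc m)))
         (distinct : AllPairs (λ π σ → ¬ (π ≈ σ)) S) (even-S : ∀ {w} → Has S w → sgn w ≡ 1ℤ) where

  private
    f : Code (suc m) → ℤ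
    f = ind S

    spec : ∀ w → (Has S w × f w ≡ 1ℤ) ⊎ (¬ Has S w × f w ≡ 0ℤ)
    spec = ind-spec distinct

  ind-01 : ∀ w → f w ≡ 0ℤ ⊎ f w ≡ 1ℤ
  ind-01 w with spec w
  ... | inj₁ (_ , e) = inj₂ e
  ... | inj₂ (_ , e) = inj₁ e

  Has⇒1 : ∀ {w} → Has S w → f w ≡ 1ℤ
  Has⇒1 {w} has with spec w
  ... | inj₁ (_ , e)    = e
  ... | inj₂ (¬has , _) = contradiction has ¬has

  1⇒Has : ∀ {w} → f w ≡ 1ℤ → Has S w
  1⇒Has {w} e with spec w
  ... | inj₁ (has , _) = has
  ... | inj₂ (_ , e′)  = contradiction (trans (sym e′) e) λ ()

  ind-pure : Pure 1ℤ f
  ind-pure = pure λ w → by w (spec w)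
    where
    by : ∀ w → (Has S w × f w ≡ 1ℤ) ⊎ (¬ Has S w × f w ≡ 0ℤ) → sgn w * f w ≡ 1ℤ * f w
    by w (inj₁ (has , _)) = cong (_* f w) (even-S has)
    by w (inj₂ (_ , e))   = trans (cong (sgn w *_) e) (trans (*-zeroʳ (sgn w)) (sym (trans (*-identityˡ (f w)) e)))

  ind-indep : (∀ {π σ} → π ∈ S → σ ∈ S → ¬ IsNCycle (π · σ ⁻¹)) → ⟪ f , A f ⟫ ≡ 0ℤ
  ind-indep free = ∑ₚ-0 λ w → by w (spec w)
    where
    by : ∀ w → (Has S w × f w ≡ 1ℤ) ⊎ (¬ Has S w × f w ≡ 0ℤ) → f w * A f w ≡ 0ℤ
    by w (inj₂ (_ , e))   = trans (cong (_* A f w) e) (*-zeroˡ (A f w))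
    by w (inj₁ (has , _)) = trans (cong (f w *_) (A-vanishes f w vanish)) (*-zeroʳ (f w))
      where
      vanish : ∀ v (c : Permutation′ (suc m)) → IsNCycle c → (∀ x → ⟦ v ⟧ x ≡ ⟦ w ⟧ (c ⟨$⟩ʳ x)) → f v ≡ 0ℤ
      vanish v c (a , enum) e = by₂ (spec v)
        where
        by₂ : (Has S v × f v ≡ 1ℤ) ⊎ (¬ Has S v × f v ≡ 0ℤ) → f v ≡ 0ℤ
        by₂ (inj₂ (_ , e′))    = e′
        -- From v = w ∘ c follows π σ⁻¹ = σ c σ⁻¹, a cycle enumerated by `σ` applied to the
        -- enumeration of `c`.
        by₂ (inj₁ (has-v , _)) = contradiction (a ∘ₚ σ , cyc) (free (proj₁ (proj₂ (find has-v))) (proj₁ (proj₂ (find has))))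
          where
          open ≡-Reasoning
          π = proj₁ (find has-v)
          σ = proj₁ (find has)
          π≡ : ∀ x → π ⟨$⟩ʳ x ≡ ⟦ v ⟧ x
          π≡ x = trans (sym (⟦enc⟧ π x)) (cong (λ u → ⟦ u ⟧ x) (proj₂ (proj₂ (find has-v))))
          σ≡ : ∀ x → ⟦ w ⟧ x ≡ σ ⟨$⟩ʳ x
          σ≡ x = trans (cong (λ u → ⟦ u ⟧ x) (sym (proj₂ (proj₂ (find has))))) (⟦enc⟧ σ x)
          cyc : ∀ x → (π · σ ⁻¹) ⟨$⟩ʳ ((a ∘ₚ σ) ⟨$⟩ʳ x) ≡ (a ∘ₚ σ) ⟨$⟩ʳ csucc x
          cyc x = begin
            π ⟨$⟩ʳ (σ ⟨$⟩ˡ (σ ⟨$⟩ʳ (a ⟨$⟩ʳ x)))      ≡⟨ cong (π ⟨$⟩ʳ_) (inverseˡ σ) ⟩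
            π ⟨$⟩ʳ (a ⟨$⟩ʳ x)                        ≡⟨ π≡ (a ⟨$⟩ʳ x) ⟩
            ⟦ v ⟧ (a ⟨$⟩ʳ x)                         ≡⟨ e (a ⟨$⟩ʳ x) ⟩
            ⟦ w ⟧ (c ⟨$⟩ʳ (a ⟨$⟩ʳ x))                ≡⟨ cong ⟦ w ⟧ (enum x) ⟩
            ⟦ w ⟧ (a ⟨$⟩ʳ csucc x)                   ≡⟨ σ≡ (a ⟨$⟩ʳ csucc x) ⟩
            σ ⟨$⟩ʳ (a ⟨$⟩ʳ csucc x)                  ∎

  IsCoset : Fin (suc m) → Fin (suc m) → Set
  IsCoset i j = ∀ (π : Permutation′ (suc m)) → IsEven π → (π ∈ₚ S ⇔ (π ⟨$⟩ʳ i ≡ j))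

  coset⇒ind : ∀ i j → IsCoset i j → ∀ w → + 2 * f w ≡ δ j (⟦ w ⟧ i) * (1ℤ + sgn w)
  coset⇒ind i j coset w = by (spec w) (sgn-± w) (δ-dec j (⟦ w ⟧ i))
    where
    by : (Has S w × f w ≡ 1ℤ) ⊎ (¬ Has S w × f w ≡ 0ℤ) → sgn w ≡ 1ℤ ⊎ sgn w ≡ - 1ℤ →
         (j ≡ ⟦ w ⟧ i × δ j (⟦ w ⟧ i) ≡ 1ℤ) ⊎ (j ≢ ⟦ w ⟧ i × δ j (⟦ w ⟧ i) ≡ 0ℤ) →
         + 2 * f w ≡ δ j (⟦ w ⟧ i) * (1ℤ + sgn w)
    by (inj₁ (has , e)) (inj₁ e₁) (inj₁ (_ , e₂)) = trans (cong (+ 2 *_) e) (sym (cong₂ (λ a b → a * (1ℤ + b)) e₂ e₁))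
    by (inj₁ (has , e)) (inj₁ e₁) (inj₂ (j≢ , _)) = contradiction (trans (sym at-i) (trans (sym (⟦enc⟧ π i)) (cong (λ u → ⟦ u ⟧ i) π≡w))) j≢
      where
      π = proj₁ (find has)
      π≡w = proj₂ (proj₂ (find has))
      at-i : π ⟨$⟩ʳ i ≡ j
      at-i = Equivalence.to (coset π (sgn⇒IsEven π (trans (cong sgn π≡w) e₁))) (lose (proj₁ (proj₂ (find has))) (λ _ → refl))
    by (inj₁ (has , e)) (inj₂ e₁) _ = contradiction (trans (sym (even-S has)) e₁) λ ()
    by (inj₂ (¬has , e)) (inj₁ e₁) (inj₁ (j≡ , _)) = contradiction (Any.map (λ {σ} σ≈ → trans (enc-cong {π = σ} σ≈) (enc-dec w)) in-S) ¬has
      where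
      in-S : dec w ∈ₚ S
      in-S = Equivalence.from (coset (dec w) (sgn⇒IsEven (dec w) (trans (cong sgn (enc-dec w)) e₁))) (trans (dec-⟦⟧ w i) (sym j≡))
    by (inj₂ (_ , e)) (inj₁ e₁) (inj₂ (_ , e₂)) = trans (cong (+ 2 *_) e) (sym (cong₂ (λ a b → a * (1ℤ + b)) e₂ e₁))
    by (inj₂ (_ , e)) (inj₂ e₁) _ = trans (cong (+ 2 *_) e) (sym (trans (cong (λ t → δ j (⟦ w ⟧ i) * (1ℤ + t)) e₁) (*-zeroʳ (δ j (⟦ w ⟧ i)))))

  ind⇒coset : ∀ i j → (∀ w → (1ℤ - δ j (⟦ w ⟧ i)) * f w ≡ 0ℤ) →
              (∀ w → δ j (⟦ w ⟧ i) * ((1ℤ + sgn w) - + 2 * f w) ≡ 0ℤ) → IsCoset i j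
  ind⇒coset i j outside inside π ev = mk⇔ to from
    where
    to : π ∈ₚ S → π ⟨$⟩ʳ i ≡ j
    to π∈S = by (δ-dec j (⟦ enc π ⟧ i))
      where
      by : _ → π ⟨$⟩ʳ i ≡ j
      by (inj₁ (j≡ , _)) = trans (sym (⟦enc⟧ π i)) (sym j≡)
      by (inj₂ (_ , e))  = contradiction (trans (sym (cong₂ (λ a b → (1ℤ - a) * b) e (Has⇒1 (Any.map (λ {σ} → enc-cong {π = σ}) π∈S)))) (outside (enc π))) λ ()
    from : π ⟨$⟩ʳ i ≡ j → π ∈ₚ S
    from π≡ = by (ind-01 (enc π)) (δ-dec j (⟦ enc π ⟧ i))
      where
      by : _ → _ → π ∈ₚ S
      by (inj₂ e) _             = Any.map (λ {σ} → enc-injective {π = σ}) (1⇒Has e)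
      by (inj₁ e) (inj₂ (j≢ , _)) = contradiction (trans (sym π≡) (sym (⟦enc⟧ π i))) j≢
      by (inj₁ e) (inj₁ (_ , e₂)) = contradiction (trans (sym (cong₂ (λ a b → a * b) e₂ (cong₂ (λ a b → (1ℤ + a) - + 2 * b) (IsEven⇒sgn π ev) e))) (inside (enc π))) λ ()

-- Both sides are twice the number of even permutations sending `i` to `j`.
Marg-1+sgn : ∀ {n} i j → Marg {2 ℕ.+ n} (λ w → 1ℤ + sgn w) i j ≡ fac (2 ℕ.+ n)
Marg-1+sgn {n} i j = trans (∑ₚ-cong λ u → +-congˡ 1ℤ (sgn-ins i j u)) (∑ₚ-1+sgn n (ε i * ε j))

-- The size bound and the extremal sets

module Independent (k : ℕ) (alt : altSign (4 ℕ.+ k) ≡ 1ℤ) (f : Code (5 ℕ.+ k) → ℤ)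
                   (f01 : ∀ w → f w ≡ 0ℤ ⊎ f w ≡ 1ℤ) (f-pure : Pure 1ℤ f) (f-indep : ⟪ f , A f ⟫ ≡ 0ℤ) where
  n : ℕ
  n = 5 ℕ.+ k

  open ≡-Reasoning

  f-idem : ∀ w → f w * f w ≡ f w
  f-idem w with f01 w
  ... | inj₁ e = trans (cong₂ _*_ e e) (sym e)
  ... | inj₂ e = trans (cong₂ _*_ e e) (sym e)

  module R = Ratio {suc k} alt f f-pure f-idem f-indep

  K : ℤ
  K = fac (3 ℕ.+ k)

  U≡ : R.U ≡ fac (4 ℕ.+ k)
  U≡ = sym (fac-suc (3 ℕ.+ k))

  size≤ : ∀ l → ∑ₚ f ≡ + l → + (2 ℕ.* l) ≤ fac (4 ℕ.+ k)
  -- `R.bound` carries a factor `s`, which can be cancelled only when it is positive.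
  size≤ zero    e = <⇒≤ (0<fac (4 ℕ.+ k))
  size≤ (suc l) e = subst (_≤ fac (4 ℕ.+ k)) (sym (pos-* 2 (suc l)))
    (0≤i-j⇒j≤i (0≤-cancel {+ suc l} (+<+ (ℕ.s≤s ℕ.z≤n)) (subst (0ℤ ≤_) (cong₂ (λ u s → s * (u - + 2 * s)) U≡ e) R.bound)))

  f-size : ∀ i j → (∀ w → + 2 * f w ≡ δ j (⟦ w ⟧ i) * (1ℤ + sgn w)) → + 2 * ∑ₚ f ≡ fac (4 ℕ.+ k)
  f-size i j h = begin
    + 2 * ∑ₚ f                                    ≡⟨ ∑ₚ-* (+ 2) f ⟨
    ∑ₚ (λ w → + 2 * f w)                          ≡⟨ ∑ₚ-cong h ⟩
    ∑ₚ (λ w → δ j (⟦ w ⟧ i) * (1ℤ + sgn w))       ≡⟨ ∑ₚ-at (λ w → 1ℤ + sgn w) i j ⟩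
    Marg (λ w → 1ℤ + sgn w) i j                   ≡⟨ Marg-1+sgn i j ⟩
    fac (4 ℕ.+ k)                                 ∎

  0≤f : ∀ w → 0ℤ ≤ f w
  0≤f w = 01⇒0≤ (f01 w)

  f≤even : ∀ w → 0ℤ ≤ (1ℤ + sgn w) - + 2 * f w
  f≤even w with f01 w | sgn-± w
  ... | _      | inj₁ e₁ = subst (λ t → 0ℤ ≤ (1ℤ + t) - + 2 * f w) (sym e₁) (subst (0ℤ ≤_) (r (f w)) (0≤-* (0≤+ 2) (01⇒≤1 (f01 w))))
    where
    r : ∀ x → + 2 * (1ℤ - x) ≡ (1ℤ + 1ℤ) - + 2 * x
    r = solve-∀
  ... | inj₁ e | inj₂ e₁ = subst (0ℤ ≤_) (sym (cong₂ (λ a b → (1ℤ + a) - + 2 * b) e₁ e)) ≤-refl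
  ... | inj₂ e | inj₂ e₁ = contradiction (trans (sym (cong₂ _*_ e₁ e)) (trans (eqn f-pure w) (cong (1ℤ *_) e))) λ ()

  module _ (size : + 2 * ∑ₚ f ≡ fac (4 ℕ.+ k)) where

    2s≡U : + 2 * R.s ≡ R.U
    2s≡U = trans size (sym U≡)

    -- On even permutations the vanishing of `rest` reads T f = 2 H. Replacing 2 s by `U` makes
    -- everything divisible by `4 + k`.
    linear : ∀ w → sgn w ≡ 1ℤ → + 2 * F R.M w ≡ + n * K * f w + + (3 ℕ.+ k) * K
    linear w e = *-cancelˡ-≡ (+ (4 ℕ.+ k)) (+ 2 * F R.M w) (+ n * K * f w + + (3 ℕ.+ k) * K) (begin
      + (4 ℕ.+ k) * (+ 2 * F R.M w)
        ≡⟨ r₁ (+ (4 ℕ.+ k)) (+ (3 ℕ.+ k)) (F R.M w) R.s R.T (f w) ⟩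
      R.T * f w + + (3 ℕ.+ k) * (+ 2 * R.s) - (R.T * f w + - 1ℤ * (1ℤ * R.H w + 1ℤ * (1ℤ * R.H w)))
        ≡⟨ cong₂ (λ a b → R.T * f w + + (3 ℕ.+ k) * a - b) 2s≡U (trans (cong (λ t → R.T * f w + - 1ℤ * (1ℤ * R.H w + 1ℤ * (t * R.H w))) (sym e)) (R.rest≡0 (sym 2s≡U) w)) ⟩
      R.T * f w + + (3 ℕ.+ k) * R.U - 0ℤ
        ≡⟨ r₂ (+ n) (+ (4 ℕ.+ k)) (+ (3 ℕ.+ k)) K (f w) ⟩
      + (4 ℕ.+ k) * (+ n * K * f w + + (3 ℕ.+ k) * K) ∎)
      where
      r₁ : ∀ a b F s T f → a * (+ 2 * F) ≡ T * f + b * (+ 2 * s) - (T * f + - 1ℤ * (1ℤ * (a * F + - (b * s) * 1ℤ) + 1ℤ * (1ℤ * (a * F + - (b * s) * 1ℤ))))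
      r₁ = solve-∀
      r₂ : ∀ n a b K f → n * (a * K) * f + b * (a * K) - 0ℤ ≡ a * (n * K * f + b * K)
      r₂ = solve-∀

    concentrated : ∃₂ λ i j → R.M i j ≡ R.s
    concentrated = Extremal.concentrated {k} K (0<fac (3 ℕ.+ k)) f R.M R.s f01 2s≡U linear
                     (λ j l → ∑ₚ-0≤ λ u → 0≤f (ins j l u)) (row-Marg f)

    module _ {i j : Fin n} (M≡s : R.M i j ≡ R.s) where

      -- The permutations with i ↦ j already account for the whole sum of the nonnegative `f`.
      outside : ∀ w → (1ℤ - δ j (⟦ w ⟧ i)) * f w ≡ 0ℤ
      outside = ∑ₚ-0⁻¹ nonneg (begin
        ∑ₚ (λ w → (1ℤ - δ j (⟦ w ⟧ i)) * f w)             ≡⟨ ∑ₚ-cong (λ w → r (δ j (⟦ w ⟧ i)) (f w)) ⟩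
        ∑ₚ (λ w → f w - δ j (⟦ w ⟧ i) * f w)              ≡⟨ ∑ₚ-- _ _ ⟩
        R.s - ∑ₚ (λ w → δ j (⟦ w ⟧ i) * f w)              ≡⟨ cong (λ t → R.s - t) (trans (∑ₚ-at f i j) M≡s) ⟩
        R.s - R.s                                         ≡⟨ +-inverseʳ R.s ⟩
        0ℤ                                                ∎)
        where
        r : ∀ d x → (1ℤ - d) * x ≡ x - d * x
        r = solve-∀
        nonneg : ∀ w → 0ℤ ≤ (1ℤ - δ j (⟦ w ⟧ i)) * f w
        nonneg w with δ-dec j (⟦ w ⟧ i)
        ... | inj₁ (_ , e) = subst (λ t → 0ℤ ≤ (1ℤ - t) * f w) (sym e) ≤-refl
        ... | inj₂ (_ , e) = subst (λ t → 0ℤ ≤ (1ℤ - t) * f w) (sym e) (subst (0ℤ ≤_) (sym (*-identityˡ (f w))) (0≤f w))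

      -- `2 f` is at most `1 + sgn`, and over the permutations with i ↦ j both have the sum `U`, so
      -- they agree there.
      inside : ∀ w → δ j (⟦ w ⟧ i) * ((1ℤ + sgn w) - + 2 * f w) ≡ 0ℤ
      inside = ∑ₚ-0⁻¹ nonneg (begin
        ∑ₚ (λ w → δ j (⟦ w ⟧ i) * ((1ℤ + sgn w) - + 2 * f w))     ≡⟨ ∑ₚ-at (λ w → (1ℤ + sgn w) - + 2 * f w) i j ⟩
        Marg (λ w → (1ℤ + sgn w) - + 2 * f w) i j                 ≡⟨ ∑ₚ-- _ _ ⟩
        Marg (λ w → 1ℤ + sgn w) i j - Marg (λ w → + 2 * f w) i j  ≡⟨ cong₂ _-_ (trans (Marg-1+sgn i j) (sym U≡)) (trans (∑ₚ-* (+ 2) _) (trans (cong (+ 2 *_) M≡s) 2s≡U)) ⟩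
        R.U - R.U                                                 ≡⟨ +-inverseʳ R.U ⟩
        0ℤ                                                        ∎)
        where
        nonneg : ∀ w → 0ℤ ≤ δ j (⟦ w ⟧ i) * ((1ℤ + sgn w) - + 2 * f w)
        nonneg w with δ-dec j (⟦ w ⟧ i)
        ... | inj₁ (_ , e) = 0≤-* (subst (0ℤ ≤_) (sym e) (0≤+ 1)) (f≤even w)
        ... | inj₂ (_ , e) = 0≤-* (subst (0ℤ ≤_) (sym e) ≤-refl) (f≤even w)

theorem7p25 : (n : ℕ) → 5 ℕ.≤ n → n % 2 ≡ 1 →
    (S : List (Permutation′ n)) →
    AllPairs (λ π σ → ¬ (π ≈ σ)) S →
    All IsEven S →
    (∀ {π σ} → π ∈ S → σ ∈ S → ¬ IsNCycle (π · σ ⁻¹)) →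
    (length S ℕ.≤ (n ℕ.∸ 1) ! / 2)
    × (length S ≡ (n ℕ.∸ 1) ! / 2
    ⇔ ∃₂ λ (i j : Fin n) →
    ∀ (π : Permutation′ n) → IsEven π → (π ∈ₚ S ⇔ (π ⟨$⟩ʳ i ≡ j)))
theorem7p25 (suc (suc (suc (suc (suc k))))) (ℕ.s≤s (ℕ.s≤s (ℕ.s≤s (ℕ.s≤s (ℕ.s≤s ℕ.z≤n))))) odd S distinct evens free =
  half-≤ l q (drop‿+≤+ (subst (+ (2 ℕ.* l) ≤_) (fac-! (4 ℕ.+ k)) (I.size≤ l (∑ₚ-ind S)))) ,
  mk⇔ (λ e → size⇒coset (Equivalence.to (half-≡ l q 2∣q) e))
      (λ (i , j , coset) → Equivalence.from (half-≡ l q 2∣q) (coset⇒size i j coset))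
  where
  l = length S
  ev : ∀ {w} → Has S w → sgn w ≡ 1ℤ
  ev = Has⇒sgn evens
  q = (4 ℕ.+ k) !
  -- The quotient `q / 2` is exact because 2 = 2! divides `q`, so equality with it can be tested
  -- after doubling.
  2∣q : 2 ∣ q
  2∣q = m≤n⇒m!∣n! {2} {4 ℕ.+ k} (ℕ.s≤s (ℕ.s≤s ℕ.z≤n))
  module I = Independent k (neg-injective (altSign-odd (5 ℕ.+ k) odd)) (ind S) (ind-01 S distinct ev)
               (ind-pure S distinct ev) (ind-indep S distinct ev free)
  2*l : + 2 * ∑ₚ (ind S) ≡ + (2 ℕ.* l)
  2*l = trans (cong (+ 2 *_) (∑ₚ-ind S)) (sym (pos-* 2 l))
  size⇒coset : 2 ℕ.* l ≡ q → ∃₂ (IsCoset S distinct ev)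
  size⇒coset e = i , j , ind⇒coset S distinct ev i j (I.outside size M≡s) (I.inside size M≡s)
    where
    size : + 2 * ∑ₚ (ind S) ≡ fac (4 ℕ.+ k)
    size = trans 2*l (trans (cong +_ e) (sym (fac-! (4 ℕ.+ k))))
    i = proj₁ (I.concentrated size)
    j = proj₁ (proj₂ (I.concentrated size))
    M≡s = proj₂ (proj₂ (I.concentrated size))
  coset⇒size : ∀ i j → IsCoset S distinct ev i j → 2 ℕ.* l ≡ q
  coset⇒size i j coset = +-injective (trans (sym 2*l)
    (trans (I.f-size i j (coset⇒ind S distinct ev i j coset)) (fac-! (4 ℕ.+ k))))
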